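{- The following two identities hold in the ring $\mathbb{Q}[[q]][[X]]$ of formal power series in $X$ with coefficients in $\mathbb{Q}[[q]]$: \begin{align*} 1+ \sum_{r\geq 1} A_r(q)\, X^{2r} &= \frac{2}{X} \arcsin\left( \frac{X}{2} \right) \exp\left( \sum_{j \geq 1} \frac{(-1)^{j-1}}{j}\, G_{2j}(q) \left( 2 \arcsin\left( \frac{X}{2} \right)\right)^{2j} \right),\\ 1+\sum_{r\geq 1} C_r(q)\, X^{2r} &= \exp\left( \sum_{j \geq 1} \frac{(-1)^{j-1}}{j}\, G^{\mathbf{o}}_{2j}(q) \left( 2 \arcsin\left( \frac{X}{2} \right)\right)^{2j} \right). \end{align*}
   Context: For $r\geq 1$, MacMahon's $q$-series are $$A_r(q) = \sum_{m_1>\dots>m_r>0} \frac{q^{m_1+\dots+m_r}}{(1-q^{m_1})^2\cdots (1-q^{m_r})^2}, \qquad C_r(q) = \sum_{\substack{m_1>\dots>m_r>0\\ m_1,\dots,m_r \text{ odd}}}\frac{q^{m_1+\dots+m_r}}{(1-q^{m_1})^2\cdots (1-q^{m_r})^2},$$ where the $m_i$ are integers; both are viewed as elements of $\mathbb{Q}[[q]]$. For $k\geq 2$, the Eisenstein series of weight $k$ and its odd variant are $$G_k(q) = -\frac{B_k}{2\,k!} + \frac{1}{(k-1)!}\sum_{m,n \geq 1} n^{k-1} q^{mn}, \qquad G^{\mathbf{o}}_k(q) = G_k(q) - G_k(q^2) = \frac{1}{(k-1)!}\sum_{\substack{m,n \geq 1\\ m \text{ odd}}} n^{k-1} q^{mn},$$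 where $B_k$ is the $k$-th Bernoulli number (so $B_2=\tfrac16$). Here $\arcsin(X/2)$ denotes its Taylor series at $X=0$, so that $2\arcsin(X/2) = X + \dots\in X\,\mathbb{Q}[[X]]$ and $\frac{2}{X}\arcsin(X/2)\in 1+X^2\mathbb{Q}[[X]]$; $\exp$ is the formal exponential series. -}

module Defs where

open import Algebra.Bundles.Raw using (RawRing)
import Algebra.Definitions.RawSemiring as RawSemiringDefs
open import Data.Fin.Base using (toℕ)
open import Data.Integer.Base using (+_)
open import Data.List.Base as List using (List; upTo; filter; concatMap)
open import Data.Nat.Base as ℕ using (ℕ; zero; suc; _∸_; _!; NonZero)
open import Data.Nat.Combinatorics using () renaming (_C_ to binomial)
open import Data.Nat.Divisibility using (_∣_; _∣?_)
open import Data.Nat.Properties using (_!≢0)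
open import Data.Rational.Base as ℚ using (ℚ; ½; _/_)
open import Data.Vec.Base as Vec using (Vec; []; _∷_)
open import Data.Vec.Relation.Unary.All using (All; all?)
open import Relation.Nullary.Decidable.Core using (¬?)
open import Relation.Nullary.Negation.Core using (¬_)
open import Relation.Unary using (Decidable)

-- R⟦T⟧: a series is its sequence of coefficients, and f n is the coefficient
-- of Tⁿ in f. The construction is applied twice to obtain ℚ⟦q⟧⟦X⟧.
module PowerSeries {c ℓ} (R : RawRing c ℓ) where

  private
    module R = RawRing R
  open RawSemiringDefs R.rawSemiring using (sum)

  infix  4 _≈_
  infixl 6 _+_ _-_
  infixl 7 _*_
  infixr 7 _•_
  infix  8 -_
  infix  9 _⟪_⟫

  Series : Set c
  Series = ℕ → R.Carrier

  _≈_ : Series → Series → Set ℓ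
  f ≈ g = ∀ n → f n R.≈ g n

  const : R.Carrier → Series
  const a zero    = a
  const a (suc n) = R.0#

  0# 1# var : Series
  0#  = const R.0#
  1#  = const R.1#
  var zero    = R.0#
  var (suc n) = 1# n

  -_ : Series → Series
  (- f) n = R.- f n

  _+_ _-_ _*_ : Series → Series → Series
  (f + g) n = f n R.+ g n
  (f - g)   = f + (- g)
  (f * g) n = sum {suc n} λ i → f (toℕ i) R.* g (n ∸ toℕ i)

  _•_ : R.Carrier → Series → Series
  (a • f) n = a R.* f n

  rawRing : RawRing c ℓ
  rawRing = record
    { Carrier = Series ; _≈_ = _≈_ ; _+_ = _+_ ; _*_ = _*_ ; -_ = -_
    ; 0# = 0# ; 1# = 1# }

  open RawSemiringDefs (RawRing.rawSemiring rawRing) public using (_^_)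
  open RawSemiringDefs (RawRing.rawSemiring rawRing) using () renaming (sum to sumₛ)

  -- T-adic limit of a sequence of series. Meaningful when, for every n, the
  -- coefficient of Tⁿ in s N is the same for all N ≥ n; this is the case at
  -- every use below.
  limit : (ℕ → Series) → Series
  limit s n = s n n

  -- Infinite sum, for families in which T^i divides f i.
  Σ≥0 : (ℕ → Series) → Series
  Σ≥0 f = limit λ N → sumₛ {suc N} λ i → f (toℕ i)

  -- Infinite sum over i ≥ 1, for families in which T^(i-1) divides f i.
  Σ≥1 : ((i : ℕ) .{{_ : NonZero i}} → Series) → Series
  Σ≥1 f = Σ≥0 λ i → f (suc i)

  -- f(g(T)), for g without constant term.
  _⟪_⟫ : Series → Series → Series
  f ⟪ g ⟫ = Σ≥0 λ n → f n • g ^ n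

  -- f(T)/T, for f without constant term.
  _/T : Series → Series
  (f /T) n = f (suc n)

  -- 1/f = Σ (1-f)ⁿ, for f with constant term 1.
  inverse : Series → Series
  inverse f = Σ≥0 λ n → (1# - f) ^ n

-- Strictly decreasing r-tuples N ≥ m₁ > … > m_r > 0.
decreasing : ∀ r → ℕ → List (Vec ℕ r)
decreasing zero    N = [] List.∷ List.[]
decreasing (suc r) N =
  concatMap (λ m → List.map (suc m ∷_) (decreasing r m)) (upTo N)

Odd : ℕ → Set
Odd m = ¬ 2 ∣ m

odd? : Decidable Odd
odd? m = ¬? (2 ∣? m)

1/[_]! : ℕ → ℚ
1/[ n ]! = _/_ (+ 1) (n !) {{n !≢0}}

-- Series over ℚ; depending on the use, the variable stands for q or for X.
module _ where

  open PowerSeries ℚ.+-*-rawRing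
  open RawSemiringDefs ℚ.+-*-rawSemiring using () renaming (_^_ to _^ℚ_)

  private
    q X : Series
    q = var
    X = var

    sumList : List Series → Series
    sumList = List.foldr _+_ 0#

  -- q^(m₁+…+m_r) / ((1-q^m₁)² ⋯ (1-q^m_r)²), for positive mᵢ
  macMahonTerm : ∀ {r} → Vec ℕ r → Series
  macMahonTerm ms =
    q ^ Vec.sum ms * inverse (Vec.foldr′ _*_ 1# (Vec.map (λ m → (1# - q ^ m) ^ 2) ms))

  -- The tuples with m₁ > N only contribute to coefficients of qⁿ with n > N.
  A C : ℕ → Series
  A r = limit λ N → sumList (List.map macMahonTerm (decreasing r N))
  C r = limit λ N → sumList (List.map macMahonTerm (filter (all? odd?) (decreasing r N)))

  expSeries : Series
  expSeries n = 1/[ n ]!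

  -- t / (eᵗ - 1) = Σ B_k tᵏ / k!
  bernoulli : ℕ → ℚ
  bernoulli k = (+ (k !) / 1) ℚ.* inverse ((expSeries - 1#) /T) k

  -- for weight k ≥ 2
  G Gᵒ : ℕ → Series
  G k = const (ℚ.- (bernoulli k ℚ.* ½ ℚ.* 1/[ k ]!))
      + 1/[ k ∸ 1 ]! • (Σ≥1 λ m → Σ≥1 λ n → (+ (n ℕ.^ (k ∸ 1)) / 1) • q ^ (m ℕ.* n))
  Gᵒ k = G k - G k ⟪ q ^ 2 ⟫

  -- arcsin x = Σ binom(2n,n) / (4ⁿ (2n+1)) x^(2n+1)
  arcsinSeries : Series
  arcsinSeries = Σ≥0 λ n →
    ((+ (binomial (2 ℕ.* n) n) / suc (2 ℕ.* n)) ℚ.* (+ 1 / 4) ^ℚ n) • X ^ suc (2 ℕ.* n)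

  2arcsin[X/2] : Series
  2arcsin[X/2] = (+ 2 / 1) • arcsinSeries ⟪ ½ • X ⟫

  [2/X]arcsin[X/2] : Series
  [2/X]arcsin[X/2] = 2arcsin[X/2] /T

module ℚ⟦X⟧ = PowerSeries ℚ.+-*-rawRing
module ℚ⟦q⟧ = PowerSeries ℚ.+-*-rawRing
module ℚ⟦q⟧⟦X⟧ = PowerSeries ℚ⟦q⟧.rawRing

-- The inclusion ℚ⟦X⟧ ⊂ ℚ⟦q⟧⟦X⟧.
ι : ℚ⟦X⟧.Series → ℚ⟦q⟧⟦X⟧.Series
ι f n = ℚ⟦q⟧.const (f n)

exp : ℚ⟦q⟧⟦X⟧.Series → ℚ⟦q⟧⟦X⟧.Series
exp f = ι expSeries ⟪ f ⟫
  where open ℚ⟦q⟧⟦X⟧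

open ℚ⟦q⟧⟦X⟧ public
  using (_≈_; 1#; _+_; _*_; _^_; _•_; Σ≥1)
  renaming (var to X)

infixr 7 _·_
_·_ : ℚ → ℚ⟦q⟧.Series → ℚ⟦q⟧.Series
_·_ = ℚ⟦q⟧._•_

{-# OPTIONS --safe #-}
-- Since q^m/(1-q^m)² enters the left-hand side as an elementary symmetric function, the first
-- series is Π (1 + X² q^m/(1-q^m)²). With X = 2 sin(u/2), that is 2 - X² = 2 cos u, each factor
-- is (1 - 2 cos(u) q^m + q^(2m))/(1-q^m)², and its logarithmic derivative with respect to X is
-- 2 (du/dX) Σ sin(nu) q^(mn). Expanding sin(nu) in powers of u gives the derivative of the
-- divisor sums in the exponent, and the Bernoulli numbers contribute the logarithmic derivative
-- of X/u by the expansion of (u/2) cot(u/2). So both sides satisfy the same linear differential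
-- equation in X and agree at X = 0. All of this is done modulo q^N, where every sum over m and n
-- is finite.

module Submission where

open import Algebra.Bundles using (CommutativeRing; RawRing)
import Algebra.Definitions.RawSemiring as RawSemiringDefs
open import Algebra.Morphism.Structures using (module RingMorphisms)
open import Algebra.Solver.Ring.AlmostCommutativeRing using (fromCommutativeRing; _-Raw-AlmostCommutative⟶_)
open import Algebra.Structures using (IsCommutativeRing)
open import Data.Bool.Base using (Bool; true; false; if_then_else_)
open import Data.Fin.Base using (toℕ)
open import Data.Integer.Base as ℤ using (ℤ; +_; -1ℤ) renaming (_^_ to _^ℤ_)
import Data.Integer.Properties as ℤ
open import Data.List.Base as List using (List; []; _∷_; _++_; map; filter; upTo)
open import Data.List.Properties using (map-++; concatMap-++; upTo-∷ʳ; filter-++; filter-all; ++-identityʳ)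
open import Data.List.Relation.Unary.All as All using (All; []; _∷_)
import Data.List.Relation.Unary.All.Properties as All
open import Data.Maybe.Base using (Maybe; just; nothing)
open import Data.Nat.Base as ℕ using (ℕ; zero; suc; z≤n; s≤s; _!; NonZero)
open import Data.Nat.Combinatorics using (nCk≡n!/k![n-k]!; k![n∸k]!∣n!) renaming (_C_ to binomial)
open import Data.Nat.Divisibility using (_∣_; ∣m+n∣m⇒∣n; m∣m*n; ∣1⇒≡1)
import Data.Nat.DivMod as ℕ
import Data.Nat.Properties as ℕ
open import Data.Nat.Properties using (_!≢0; _!*_!≢0)
open import Data.Nat.Solver using (module +-*-Solver)
open import Data.Product.Base as P using (_,_)
open import Data.Rational.Base as ℚ using (ℚ; 0ℚ; 1ℚ; ½; _/_; fromℚᵘ)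
import Data.Rational.Properties as ℚ
open import Data.Rational.Unnormalised.Base as ℚᵘ using (ℚᵘ; mkℚᵘ; *≡*)
import Data.Rational.Unnormalised.Properties as ℚᵘ
open import Data.Unit.Base using (⊤; tt)
open import Data.Vec.Base as Vec using (Vec; []; _∷_)
import Data.Vec.Relation.Unary.All as VecAll
open import Function.Base using (_∘_; id)
open import Level using (0ℓ) renaming (_⊔_ to _⊔ˡ_; suc to sucˡ)
open import Relation.Binary.PropositionalEquality as ≡ using (_≡_)
import Relation.Binary.Reasoning.Setoid as SetoidReasoning
open import Relation.Binary.Structures using (IsEquivalence)
open import Relation.Nullary.Decidable using (does; yes; no; dec-true; dec-false)
open import Relation.Nullary.Negation.Core using (¬_)
open import Relation.Unary using (Pred; Decidable)
open import Defs using (module PowerSeries; decreasing; odd?; 1/[_]!; expSeries; bernoulli; arcsinSeries; 2arcsin[X/2]; [2/X]arcsin[X/2])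

-- Two features of the setting shape the proof. There is no imaginary unit, although sine, cotangent
-- and Bernoulli numbers are usually linked through e^(iu). Here every trigonometric series is a
-- series in -u² whose coefficients are those of sinh T / T and cosh T in the variable T². The same
-- coefficients occur in the even and odd parts of (e^T - 1)/T, so a comparison of parities in the
-- equation defining the Bernoulli numbers yields the cotangent. The alternating signs of the
-- exponent are absorbed by the same variable. Moreover, the logarithmic derivatives are infinite
-- sums over powers of q inside the coefficients of series in X. The calculus is therefore built
-- over an arbitrary ℚ-algebra whose equality is part of the structure: coarsening the equality
-- makes q nilpotent while the elements stay the same, and a geometric sum then ends without a
-- remainder. Square roots do not have to be extracted either: √(1 - X²/4) is obtained from du/dX,
-- and what is used about it is its square and its product with du/dX.

module Rationals where
  open import Relation.Binary.PropositionalEquality using (sym; trans; cong; cong₂; module ≡-Reasoning)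

  fromℚᵘ-homo-+ : ∀ p q → fromℚᵘ p ℚ.+ fromℚᵘ q ≡ fromℚᵘ (p ℚᵘ.+ q)
  fromℚᵘ-homo-+ p q = ℚ.toℚᵘ-injective (ℚᵘ.≃-trans (ℚ.toℚᵘ-homo-+ (fromℚᵘ p) (fromℚᵘ q))
    (ℚᵘ.≃-trans (ℚᵘ.+-cong (ℚ.toℚᵘ-fromℚᵘ p) (ℚ.toℚᵘ-fromℚᵘ q)) (ℚᵘ.≃-sym (ℚ.toℚᵘ-fromℚᵘ (p ℚᵘ.+ q)))))

  fromℚᵘ-homo-* : ∀ p q → fromℚᵘ p ℚ.* fromℚᵘ q ≡ fromℚᵘ (p ℚᵘ.* q)
  fromℚᵘ-homo-* p q = ℚ.toℚᵘ-injective (ℚᵘ.≃-trans (ℚ.toℚᵘ-homo-* (fromℚᵘ p) (fromℚᵘ q))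
    (ℚᵘ.≃-trans (ℚᵘ.*-cong (ℚ.toℚᵘ-fromℚᵘ p) (ℚ.toℚᵘ-fromℚᵘ q)) (ℚᵘ.≃-sym (ℚ.toℚᵘ-fromℚᵘ (p ℚᵘ.* q)))))

  fromℤ : ℤ → ℚ
  fromℤ i = i / 1

  fromℕ : ℕ → ℚ
  fromℕ n = fromℤ (+ n)

  fromℤ-+ : ∀ i j → fromℤ (i ℤ.+ j) ≡ fromℤ i ℚ.+ fromℤ j
  fromℤ-+ i j = sym (trans (fromℚᵘ-homo-+ (mkℚᵘ i 0) (mkℚᵘ j 0)) (cong fromℤ (cong₂ ℤ._+_ (ℤ.*-identityʳ i) (ℤ.*-identityʳ j))))

  fromℤ-* : ∀ i j → fromℤ (i ℤ.* j) ≡ fromℤ i ℚ.* fromℤ j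
  fromℤ-* i j = sym (fromℚᵘ-homo-* (mkℚᵘ i 0) (mkℚᵘ j 0))

  fromℕ-+ : ∀ m n → fromℕ (m ℕ.+ n) ≡ fromℕ m ℚ.+ fromℕ n
  fromℕ-+ m n = fromℤ-+ (+ m) (+ n)

  fromℕ-suc : ∀ n → fromℕ (suc n) ≡ 1ℚ ℚ.+ fromℕ n
  fromℕ-suc n = fromℕ-+ 1 n

  fromℕ-* : ∀ m n → fromℕ (m ℕ.* n) ≡ fromℕ m ℚ.* fromℕ n
  fromℕ-* m n = trans (cong fromℤ (ℤ.pos-* m n)) (fromℤ-* (+ m) (+ n))

  fromℕ-even : ∀ n → fromℕ (2 ℕ.* n) ≡ fromℕ n ℚ.+ fromℕ n
  fromℕ-even n = trans (cong (λ k → fromℕ (n ℕ.+ k)) (ℕ.+-identityʳ n)) (fromℕ-+ n n)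

  /-*-fromℕ : ∀ i d .{{_ : NonZero d}} → (i / d) ℚ.* fromℕ d ≡ fromℤ i
  /-*-fromℕ i d@(suc e) = trans (fromℚᵘ-homo-* (mkℚᵘ i e) (mkℚᵘ (+ d) 0))
    (ℚ.fromℚᵘ-cong {mkℚᵘ i e ℚᵘ.* mkℚᵘ (+ d) 0} {mkℚᵘ i 0} (*≡* (trans (ℤ.*-identityʳ (i ℤ.* + d)) (cong (λ n → i ℤ.* + n) (sym (ℕ.*-identityʳ d))))))

  fromℕ-cancelˡ : ∀ d .{{_ : NonZero d}} {x y} → fromℕ d ℚ.* x ≡ fromℕ d ℚ.* y → x ≡ y
  fromℕ-cancelˡ d {x} {y} p = begin
    x                                ≡⟨ recip x ⟩
    (+ 1 / d) ℚ.* (fromℕ d ℚ.* x)  ≡⟨ cong ((+ 1 / d) ℚ.*_) p ⟩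
    (+ 1 / d) ℚ.* (fromℕ d ℚ.* y)  ≡⟨ recip y ⟨
    y                                ∎
    where
    open ≡-Reasoning
    recip : ∀ z → z ≡ (+ 1 / d) ℚ.* (fromℕ d ℚ.* z)
    recip z = sym (trans (sym (ℚ.*-assoc (+ 1 / d) (fromℕ d) z)) (trans (cong (ℚ._* z) (/-*-fromℕ (+ 1) d)) (ℚ.*-identityˡ z)))

-- Division by positive integers is what recovers a series from its derivative and its constant
-- term. With the equality left abstract, ℚ, the series rings and their truncations can all serve as
-- coefficients.
record ℚ-Algebra c ℓ : Set (sucˡ (c ⊔ˡ ℓ)) where
  field
    commutativeRing : CommutativeRing c ℓ
  open CommutativeRing commutativeRing public
  open RingMorphisms ℚ.+-*-rawRing rawRing using (IsRingHomomorphism)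
  field
    φ                     : ℚ → Carrier
    φ-isRingHomomorphism : IsRingHomomorphism φ
  open IsRingHomomorphism φ-isRingHomomorphism public
    using () renaming (+-homo to φ-+; *-homo to φ-*; -‿homo to φ-neg; 0#-homo to φ-0; 1#-homo to φ-1)

module RingSolver {c ℓ} (A : ℚ-Algebra c ℓ) where
  open ℚ-Algebra A

  -- Sending 0 and 1 to 0# and 1# on the nose lets solver goals mention these constants.
  private
    ⟦_⟧ : ℚ → Carrier
    ⟦ x ⟧ with x ℚ.≟ 0ℚ | x ℚ.≟ 1ℚ
    ... | yes _ | _     = 0#
    ... | no _  | yes _ = 1#
    ... | no _  | no _  = φ x

    ⟦⟧≈φ : ∀ x → ⟦ x ⟧ ≈ φ x
    ⟦⟧≈φ x with x ℚ.≟ 0ℚ | x ℚ.≟ 1ℚ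
    ... | yes ≡.refl | _          = sym φ-0
    ... | no _       | yes ≡.refl = sym φ-1
    ... | no _       | no _       = refl

    morphism : ℚ.+-*-rawRing -Raw-AlmostCommutative⟶ fromCommutativeRing commutativeRing
    morphism = record
      { ⟦_⟧    = ⟦_⟧
      ; +-homo = λ x y → trans (⟦⟧≈φ _) (trans (φ-+ x y) (sym (+-cong (⟦⟧≈φ x) (⟦⟧≈φ y))))
      ; *-homo = λ x y → trans (⟦⟧≈φ _) (trans (φ-* x y) (sym (*-cong (⟦⟧≈φ x) (⟦⟧≈φ y))))
      ; -‿homo = λ x → trans (⟦⟧≈φ _) (trans (φ-neg x) (sym (-‿cong (⟦⟧≈φ x))))
      ; 0-homo = refl
      ; 1-homo = refl
      }

    _≟_ : ∀ x y → Maybe (⟦ x ⟧ ≈ ⟦ y ⟧)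
    x ≟ y with x ℚ.≟ y
    ... | yes x≡y = just (reflexive (≡.cong ⟦_⟧ x≡y))
    ... | no _    = nothing

  open import Algebra.Solver.Ring ℚ.+-*-rawRing (fromCommutativeRing commutativeRing) morphism _≟_ public
    using (solve; _:=_; _:+_; _:*_; _:-_; :-_; _:^_; con)

-- Formal power series: ring structure, truncation, infinite sums

module SeriesRing {c ℓ} (R : CommutativeRing c ℓ) where
  private
    module R = CommutativeRing R
  open PowerSeries R.rawRing public
  open SetoidReasoning R.setoid
  open import Algebra.Properties.CommutativeSemigroup R.+-commutativeSemigroup using (interchange; x∙yz≈y∙xz)

  -- Wrapped in a record so that both sides can be inferred.
  record _≋_ (f g : Series) : Set ℓ where
    constructor coeffwise
    field at : ∀ n → f n R.≈ g n
  open _≋_ public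

  infix 4 _≋_ _≈[_]_

  -- f ≡ g mod Tⁿ
  record _≈[_]_ (f : Series) (n : ℕ) (g : Series) : Set ℓ where
    constructor below
    field at[_]< : ∀ {k} → k ℕ.< n → f k R.≈ g k
  open _≈[_]_ public

  const-0 : ∀ n → 0# n ≡ R.0#
  const-0 zero    = ≡.refl
  const-0 (suc n) = ≡.refl

  -- The sum defining a product unfolds by computation to `f 0 R.* g (suc n) R.+ (f /T * g) n`, so
  -- most laws below go by induction on n with `f` replaced by `f /T`. Only coefficients up to n are
  -- compared, which makes the lemma usable for congruence modulo a power of T as well.
  *-coeff-cong : ∀ {f f′ g g′} n → (∀ k → k ℕ.≤ n → f k R.≈ f′ k) → (∀ k → k ℕ.≤ n → g k R.≈ g′ k) →
                 (f * g) n R.≈ (f′ * g′) n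
  *-coeff-cong zero    p q = R.+-congʳ (R.*-cong (p 0 z≤n) (q 0 z≤n))
  *-coeff-cong (suc n) p q = R.+-cong (R.*-cong (p 0 z≤n) (q (suc n) ℕ.≤-refl))
    (*-coeff-cong n (λ k k≤n → p (suc k) (s≤s k≤n)) (λ k k≤n → q k (ℕ.m≤n⇒m≤1+n k≤n)))

  *-coeff-distribʳ : ∀ f g h n → ((f + g) * h) n R.≈ (f * h + g * h) n
  *-coeff-distribʳ f g h zero    = begin
    (f 0 R.+ g 0) R.* h 0 R.+ R.0#                     ≈⟨ R.+-identityʳ _ ⟩
    (f 0 R.+ g 0) R.* h 0                              ≈⟨ R.distribʳ _ _ _ ⟩
    f 0 R.* h 0 R.+ g 0 R.* h 0                        ≈⟨ R.+-cong (R.+-identityʳ _) (R.+-identityʳ _) ⟨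
    (f 0 R.* h 0 R.+ R.0#) R.+ (g 0 R.* h 0 R.+ R.0#)  ∎
  *-coeff-distribʳ f g h (suc n) = begin
    (f 0 R.+ g 0) R.* h (suc n) R.+ ((f /T + g /T) * h) n
      ≈⟨ R.+-cong (R.distribʳ _ _ _) (*-coeff-distribʳ (f /T) (g /T) h n) ⟩
    (f 0 R.* h (suc n) R.+ g 0 R.* h (suc n)) R.+ ((f /T * h) n R.+ (g /T * h) n)
      ≈⟨ interchange _ _ _ _ ⟩
    (f * h + g * h) (suc n) ∎

  •-*-coeff : ∀ a f g n → ((a • f) * g) n R.≈ a R.* (f * g) n
  •-*-coeff a f g zero = begin
    a R.* f 0 R.* g 0 R.+ R.0#    ≈⟨ R.+-identityʳ _ ⟩
    a R.* f 0 R.* g 0             ≈⟨ R.*-assoc _ _ _ ⟩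
    a R.* (f 0 R.* g 0)           ≈⟨ R.*-congˡ (R.+-identityʳ _) ⟨
    a R.* (f 0 R.* g 0 R.+ R.0#)  ∎
  •-*-coeff a f g (suc n) = begin
    a R.* f 0 R.* g (suc n) R.+ ((a • (f /T)) * g) n       ≈⟨ R.+-cong (R.*-assoc _ _ _) (•-*-coeff a (f /T) g n) ⟩
    a R.* (f 0 R.* g (suc n)) R.+ a R.* (f /T * g) n     ≈⟨ R.distribˡ _ _ _ ⟨
    a R.* (f * g) (suc n)                                ∎

  *-coeff-assoc : ∀ f g h n → ((f * g) * h) n R.≈ (f * (g * h)) n
  *-coeff-assoc f g h zero = R.+-congʳ (begin
    (f 0 R.* g 0 R.+ R.0#) R.* h 0  ≈⟨ R.*-congʳ (R.+-identityʳ _) ⟩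
    f 0 R.* g 0 R.* h 0             ≈⟨ R.*-assoc _ _ _ ⟩
    f 0 R.* (g 0 R.* h 0)           ≈⟨ R.*-congˡ (R.+-identityʳ _) ⟨
    f 0 R.* (g 0 R.* h 0 R.+ R.0#)  ∎)
  *-coeff-assoc f g h (suc n) = begin
    (f 0 R.* g 0 R.+ R.0#) R.* h (suc n) R.+ ((f 0 • (g /T) + f /T * g) * h) n
      ≈⟨ R.+-cong (R.*-congʳ (R.+-identityʳ _)) (*-coeff-distribʳ (f 0 • (g /T)) (f /T * g) h n) ⟩
    f 0 R.* g 0 R.* h (suc n) R.+ (((f 0 • (g /T)) * h) n R.+ ((f /T * g) * h) n)
      ≈⟨ R.+-cong (R.*-assoc _ _ _) (R.+-cong (•-*-coeff (f 0) (g /T) h n) (*-coeff-assoc (f /T) g h n)) ⟩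
    f 0 R.* (g 0 R.* h (suc n)) R.+ (f 0 R.* (g /T * h) n R.+ (f /T * (g * h)) n)
      ≈⟨ R.+-assoc _ _ _ ⟨
    f 0 R.* (g 0 R.* h (suc n)) R.+ f 0 R.* (g /T * h) n R.+ (f /T * (g * h)) n
      ≈⟨ R.+-congʳ (R.distribˡ _ _ _) ⟨
    (f * (g * h)) (suc n) ∎

  -- Computation peels a product on the left only; commutativity needs this mirror image, which
  -- peels the right factor.
  *-coeff-sucʳ : ∀ f g n → (f * g) (suc n) R.≈ f (suc n) R.* g 0 R.+ (f * g /T) n
  *-coeff-sucʳ f g zero    = begin
    f 0 R.* g 1 R.+ (f 1 R.* g 0 R.+ R.0#)  ≈⟨ x∙yz≈y∙xz _ _ _ ⟩
    f 1 R.* g 0 R.+ (f 0 R.* g 1 R.+ R.0#)  ∎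
  *-coeff-sucʳ f g (suc n) = begin
    f 0 R.* g (2 ℕ.+ n) R.+ (f /T * g) (suc n)
      ≈⟨ R.+-congˡ (*-coeff-sucʳ (f /T) g n) ⟩
    f 0 R.* g (2 ℕ.+ n) R.+ (f (2 ℕ.+ n) R.* g 0 R.+ (f /T * g /T) n)
      ≈⟨ x∙yz≈y∙xz _ _ _ ⟩
    f (2 ℕ.+ n) R.* g 0 R.+ (f * g /T) (suc n) ∎

  *-coeff-comm : ∀ f g n → (f * g) n R.≈ (g * f) n
  *-coeff-comm f g zero    = R.+-congʳ (R.*-comm _ _)
  *-coeff-comm f g (suc n) = begin
    f 0 R.* g (suc n) R.+ (f /T * g) n  ≈⟨ R.+-cong (R.*-comm _ _) (*-coeff-comm (f /T) g n) ⟩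
    g (suc n) R.* f 0 R.+ (g * f /T) n  ≈⟨ *-coeff-sucʳ g f n ⟨
    (g * f) (suc n)                     ∎

  *-coeff-zeroˡ : ∀ f n → (0# * f) n R.≈ R.0#
  *-coeff-zeroˡ f n = R.trans (*-coeff-cong {0#} {R.0# • 0#} {f} {f} n
      (λ k _ → R.trans (R.reflexive (const-0 k)) (R.sym (R.zeroˡ _))) (λ _ _ → R.refl))
                              (R.trans (•-*-coeff R.0# 0# f n) (R.zeroˡ _))

  const-*-coeff : ∀ a f n → (const a * f) n R.≈ a R.* f n
  const-*-coeff a f zero    = R.+-identityʳ _
  const-*-coeff a f (suc n) = R.trans (R.+-congˡ (R.trans (*-coeff-cong {const a /T} {0#} {f} {f} n
     (λ { zero _ → R.refl ; (suc k) _ → R.refl }) (λ _ _ → R.refl)) (*-coeff-zeroˡ f n))) (R.+-identityʳ _)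

  isEquivalence : IsEquivalence _≋_
  isEquivalence = record
    { refl  = coeffwise λ _ → R.refl
    ; sym   = λ p → coeffwise λ n → R.sym (at p n)
    ; trans = λ p q → coeffwise λ n → R.trans (at p n) (at q n)
    }

  *-coeff-distribˡ : ∀ f g h n → (f * (g + h)) n R.≈ (f * g + f * h) n
  *-coeff-distribˡ f g h n = R.trans (*-coeff-comm f (g + h) n) (R.trans (*-coeff-distribʳ g h f n)
    (R.+-cong (*-coeff-comm g f n) (*-coeff-comm h f n)))

  *-coeff-identityˡ : ∀ f n → (1# * f) n R.≈ f n
  *-coeff-identityˡ f n = R.trans (const-*-coeff R.1# f n) (R.*-identityˡ _)

  +-coeff-identityˡ : ∀ f n → (0# + f) n R.≈ f n
  +-coeff-identityˡ f n rewrite const-0 n = R.+-identityˡ _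

  +-coeff-identityʳ : ∀ f n → (f + 0#) n R.≈ f n
  +-coeff-identityʳ f n rewrite const-0 n = R.+-identityʳ _

  -‿coeff-inverseˡ : ∀ f n → ((- f) + f) n R.≈ 0# n
  -‿coeff-inverseˡ f n rewrite const-0 n = R.-‿inverseˡ _

  -‿coeff-inverseʳ : ∀ f n → (f - f) n R.≈ 0# n
  -‿coeff-inverseʳ f n rewrite const-0 n = R.-‿inverseʳ _

  isCommutativeRing : IsCommutativeRing _≋_ _+_ _*_ -_ 0# 1#
  isCommutativeRing = record
    { isRing = record
      { +-isAbelianGroup = record
        { isGroup = record
          { isMonoid = record
            { isSemigroup = record
              { isMagma = record
                { isEquivalence = isEquivalence
                ; ∙-cong = λ p q → coeffwise λ n → R.+-cong (at p n) (at q n)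
                }
              ; assoc = λ f g h → coeffwise λ n → R.+-assoc _ _ _
              }
            ; identity = (λ f → coeffwise (+-coeff-identityˡ f)) , (λ f → coeffwise (+-coeff-identityʳ f))
            }
          ; inverse = (λ f → coeffwise (-‿coeff-inverseˡ f)) , (λ f → coeffwise (-‿coeff-inverseʳ f))
          ; ⁻¹-cong = λ p → coeffwise λ n → R.-‿cong (at p n)
          }
        ; comm = λ f g → coeffwise λ n → R.+-comm _ _
        }
      ; *-cong = λ p q → coeffwise λ n → *-coeff-cong n (λ k _ → at p k) (λ k _ → at q k)
      ; *-assoc = λ f g h → coeffwise (*-coeff-assoc f g h)
      ; *-identity = (λ f → coeffwise (*-coeff-identityˡ f))
                   , (λ f → coeffwise λ n → R.trans (*-coeff-comm f 1# n) (*-coeff-identityˡ f n))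
      ; distrib = (λ f g h → coeffwise (*-coeff-distribˡ f g h)) , (λ h f g → coeffwise (*-coeff-distribʳ f g h))
      }
    ; *-comm = λ f g → coeffwise (*-coeff-comm f g)
    }

  commutativeRing : CommutativeRing c ℓ
  commutativeRing = record { isCommutativeRing = isCommutativeRing }

  open CommutativeRing commutativeRing public
    hiding (_≈_; _+_; _*_; -_; _-_; 0#; 1#; Carrier; rawRing; isCommutativeRing; isEquivalence)

  reduce : ∀ {f g} n → f ≋ g → f ≈[ n ] g
  reduce n p = below λ {k} _ → at p k

  lift : ∀ {f g} → (∀ n → f ≈[ n ] g) → f ≋ g
  lift p = coeffwise λ n → at[ p (suc n) ]< ℕ.≤-refl

  -- The quotient R⟦T⟧/(Tᵐ), realised by a coarser equality on the same carrier, so that no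
  -- projection has to be carried through later formulas.
  truncatedRing : ℕ → CommutativeRing c ℓ
  truncatedRing m = record { isCommutativeRing = record
    { isRing = record
      { +-isAbelianGroup = record
        { isGroup = record
          { isMonoid = record
            { isSemigroup = record
              { isMagma = record
                { isEquivalence = record
                  { refl  = below λ _ → R.refl
                  ; sym   = λ p → below λ k<m → R.sym (at[ p ]< k<m)
                  ; trans = λ p q → below λ k<m → R.trans (at[ p ]< k<m) (at[ q ]< k<m)
                  }
                ; ∙-cong = λ p q → below λ k<m → R.+-cong (at[ p ]< k<m) (at[ q ]< k<m)
                }
              ; assoc = λ f g h → reduce m (+-assoc f g h)
              }
            ; identity = (λ f → reduce m (+-identityˡ f)) , (λ f → reduce m (+-identityʳ f))
            }
          ; inverse = (λ f → reduce m (-‿inverseˡ f)) , (λ f → reduce m (-‿inverseʳ f))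
          ; ⁻¹-cong = λ p → below λ k<m → R.-‿cong (at[ p ]< k<m)
          }
        ; comm = λ f g → reduce m (+-comm f g)
        }
      ; *-cong = λ p q → below λ {k} k<m → *-coeff-cong k (λ i i≤k → at[ p ]< (ℕ.≤-<-trans i≤k k<m))
                                                           (λ i i≤k → at[ q ]< (ℕ.≤-<-trans i≤k k<m))
      ; *-assoc = λ f g h → reduce m (*-assoc f g h)
      ; *-identity = (λ f → reduce m (*-identityˡ f)) , (λ f → reduce m (*-identityʳ f))
      ; distrib = (λ f g h → reduce m (distribˡ f g h)) , (λ h f g → reduce m (distribʳ h f g))
      }
    ; *-comm = λ f g → reduce m (*-comm f g)
    } }

module SeriesAlgebra {c ℓ} (A : ℚ-Algebra c ℓ) where
  private
    module A = ℚ-Algebra A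
  open SeriesRing A.commutativeRing public

  const-cong : ∀ {a b} → a A.≈ b → const a ≋ const b
  const-cong p = coeffwise λ { zero → p ; (suc n) → A.refl }

  const-+ : ∀ a b → const (a A.+ b) ≋ const a + const b
  const-+ a b = coeffwise λ { zero → A.refl ; (suc n) → A.sym (A.+-identityˡ _) }

  const-neg : ∀ a → const (A.- a) ≋ - const a
  const-neg a = coeffwise λ
    { zero    → A.refl
    ; (suc n) → A.trans (A.sym (A.-‿inverseʳ _)) (A.+-identityˡ _) }

  const-•≋* : ∀ a f → a • f ≋ const a * f
  const-•≋* a f = coeffwise λ n → A.sym (const-*-coeff a f n)

  const-* : ∀ a b → const (a A.* b) ≋ const a * const b
  const-* a b = trans (coeffwise λ { zero → A.refl ; (suc n) → A.sym (A.zeroʳ _) }) (const-•≋* a (const b))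

  algebra : ℚ-Algebra c ℓ
  algebra = record
    { commutativeRing = commutativeRing
    ; φ = const ∘ A.φ
    ; φ-isRingHomomorphism = record
      { isSemiringHomomorphism = record
        { isNearSemiringHomomorphism = record
          { +-isMonoidHomomorphism = record
            { isMagmaHomomorphism = record
              { isRelHomomorphism = record { cong = λ { ≡.refl → refl } }
              ; homo = λ x y → trans (const-cong (A.φ-+ x y)) (const-+ _ _)
              }
            ; ε-homo = const-cong A.φ-0
            }
          ; *-homo = λ x y → trans (const-cong (A.φ-* x y)) (const-* _ _)
          }
        ; 1#-homo = const-cong A.φ-1
        }
      ; -‿homo = λ x → trans (const-cong (A.φ-neg x)) (const-neg _)
      }
    }

  module Mod (n : ℕ) = CommutativeRing (truncatedRing n)
  module S = ℚ-Algebra algebra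

  truncated : ℕ → ℚ-Algebra c ℓ
  truncated m = record
    { commutativeRing = truncatedRing m
    ; φ = S.φ
    ; φ-isRingHomomorphism = record
      { isSemiringHomomorphism = record
        { isNearSemiringHomomorphism = record
          { +-isMonoidHomomorphism = record
            { isMagmaHomomorphism = record
              { isRelHomomorphism = record { cong = λ { ≡.refl → Mod.refl m } }
              ; homo = λ x y → reduce m (S.φ-+ x y)
              }
            ; ε-homo = reduce m S.φ-0
            }
          ; *-homo = λ x y → reduce m (S.φ-* x y)
          }
        ; 1#-homo = reduce m S.φ-1
        }
      ; -‿homo = λ x → reduce m (S.φ-neg x)
      }
    }

  open RingSolver algebra public
  module ≋-Reasoning = SetoidReasoning setoid
  module Mod-Reasoning (n : ℕ) = SetoidReasoning (Mod.setoid n)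

  infix 8 _*ˡ_ _*ʳ_

  -- Congruence with the fixed factor explicit, as Agda cannot infer factors of a convolution.
  _*ˡ_ : ∀ h {f g} → f ≋ g → h * f ≋ h * g
  h *ˡ p = *-cong {h} {h} refl p

  _*ʳ_ : ∀ {f g} → f ≋ g → ∀ h → f * h ≋ g * h
  _*ʳ_ {f} {g} p h = *-cong {f} {g} {h} {h} p refl

  *-cong-mod : ∀ {f f′ g g′ n} → f ≈[ n ] f′ → g ≈[ n ] g′ → f * g ≈[ n ] f′ * g′
  *-cong-mod {f} {f′} {g} {g′} {n} = Mod.*-cong n {f} {f′} {g} {g′}

  private
    open module Sum = RawSemiringDefs (RawRing.rawSemiring rawRing) using (sum)

  zero-trunc : ∀ {f g} → f ≈[ 0 ] g
  zero-trunc = below λ ()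

  var-*-suc : ∀ f n → (var * f) (suc n) A.≈ f n
  var-*-suc f n = A.trans (A.+-congʳ (A.zeroˡ _)) (A.trans (A.+-identityˡ _) (*-coeff-identityˡ f n))

  *-zeroth : ∀ f g → (f * g) 0 A.≈ f 0 A.* g 0
  *-zeroth f g = A.+-identityʳ _

  *-zerothˡ : ∀ {f} g → f 0 A.≈ A.0# → (f * g) 0 A.≈ A.0#
  *-zerothˡ {f} g f0 = A.trans (*-zeroth f g) (A.trans (A.*-congʳ f0) (A.zeroˡ _))

  split : ∀ f → f ≋ const (f 0) + var * f /T
  split f = coeffwise λ
    { zero    → A.sym (A.trans (A.+-congˡ (*-zerothˡ {var} (f /T) A.refl)) (A.+-identityʳ _))
    ; (suc n) → A.sym (A.trans (A.+-identityˡ _) (var-*-suc (f /T) n)) }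

  var*-cancel : ∀ {f g} → var * f ≋ var * g → f ≋ g
  var*-cancel {f} {g} p = coeffwise λ n → A.trans (A.sym (var-*-suc f n)) (A.trans (at p (suc n)) (var-*-suc g n))

  -- A factor without constant term gains one order of precision. This is what lets the inductions
  -- on the truncation level advance.
  raise : ∀ {g x y n} → g 0 A.≈ A.0# → x ≈[ n ] y → g * x ≈[ suc n ] g * y
  raise {g} {x} {y} {n} g0 p = below λ
    { {zero}  _         → A.trans (*-zerothˡ {g} x g0) (A.sym (*-zerothˡ {g} y g0))
    ; {suc k} (s≤s k<n) → A.+-cong (A.trans (A.*-congʳ g0) (A.trans (A.zeroˡ _) (A.sym (A.trans (A.*-congʳ g0) (A.zeroˡ _)))))
                                   (*-coeff-cong {g /T} {g /T} {x} {y} k (λ _ _ → A.refl) (λ i i≤k → at[ p ]< (ℕ.≤-<-trans i≤k k<n))) }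

  partialSum : (ℕ → Series) → ℕ → Series
  partialSum f n = sum {n} λ i → f (toℕ i)

  partialSum-suc : ∀ f n → partialSum f (suc n) ≋ partialSum f n + f n
  partialSum-suc f zero    = +-comm _ _
  partialSum-suc f (suc n) = trans (+-congˡ (partialSum-suc (f ∘ suc) n)) (sym (+-assoc _ _ _))

  partialSum-cong : ∀ {f g} n → (∀ i → f i ≋ g i) → partialSum f n ≋ partialSum g n
  partialSum-cong zero    p = refl
  partialSum-cong (suc n) p = +-cong (p 0) (partialSum-cong n (p ∘ suc))

  partialSum-* : ∀ h f n → partialSum (λ i → h * f i) n ≋ h * partialSum f n
  partialSum-* h f zero    = sym (zeroʳ h)
  partialSum-* h f (suc n) = trans (+-congˡ (partialSum-* h (f ∘ suc) n)) (sym (distribˡ h _ _))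

  -- `Σ≥0` reads coefficient k off the partial sum of k + 1 terms. The hypothesis says that the
  -- later terms do not reach that coefficient, so every longer partial sum agrees.
  Σ≥0≈partialSum : ∀ {f} → (∀ i → f i ≈[ i ] 0#) → ∀ n → Σ≥0 f ≈[ n ] partialSum f n
  Σ≥0≈partialSum {f} p n = below λ {k} k<n → A.sym (stable (ℕ.≤⇒≤′ k<n))
    where
    stable : ∀ {k n} → suc k ℕ.≤′ n → partialSum f n k A.≈ partialSum f (suc k) k
    stable             (ℕ.≤′-reflexive ≡.refl) = A.refl
    stable {k} {suc n} (ℕ.≤′-step k<n)       = begin
      partialSum f (suc n) k         ≈⟨ at (partialSum-suc f n) k ⟩
      partialSum f n k A.+ f n k     ≈⟨ A.+-cong (stable k<n) (A.trans (at[ p n ]< (ℕ.≤′⇒≤ k<n)) (A.reflexive (const-0 k))) ⟩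
      partialSum f (suc k) k A.+ A.0# ≈⟨ A.+-identityʳ _ ⟩
      partialSum f (suc k) k         ∎
      where open SetoidReasoning A.setoid

  ^-trunc : ∀ {g} → g 0 A.≈ A.0# → ∀ n → g ^ n ≈[ n ] 0#
  ^-trunc g0 zero    = zero-trunc
  ^-trunc {g} g0 (suc n) = Mod.trans (suc n) (raise {g} g0 (^-trunc {g} g0 n)) (reduce (suc n) (zeroʳ g))

  •-zeroʳ : ∀ a → a • 0# ≋ 0#
  •-zeroʳ a = trans (const-•≋* a 0#) (zeroʳ (const a))

  •-trunc : ∀ a {f g n} → f ≈[ n ] g → a • f ≈[ n ] a • g
  •-trunc a p = below λ k<n → A.*-congˡ (at[ p ]< k<n)

  •-cong : ∀ {a b f g} → a A.≈ b → f ≋ g → a • f ≋ b • g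
  •-cong p q = coeffwise λ n → A.*-cong p (at q n)

  const≋•1 : ∀ a → a • 1# ≋ const a
  const≋•1 a = trans (const-•≋* a 1#) (*-identityʳ (const a))

  *-•-swap : ∀ g a f → a • (g * f) ≋ g * (a • f)
  *-•-swap g a f = begin
    a • (g * f)        ≈⟨ const-•≋* a (g * f) ⟩
    const a * (g * f)  ≈⟨ solve 3 (λ a g f → a :* (g :* f) := g :* (a :* f)) refl (const a) g f ⟩
    g * (const a * f)  ≈⟨ g *ˡ const-•≋* a f ⟨
    g * (a • f)        ∎
    where open ≋-Reasoning

  -- Horner's rule, from f = f(0) + T (f /T). The laws of composition follow from it modulo Tⁿ by
  -- induction on n, uniformly in `f`: the tail is multiplied by `g` and is thus needed to one order
  -- less.
  ⟪⟫-unfold : ∀ {g} f → g 0 A.≈ A.0# → f ⟪ g ⟫ ≋ const (f 0) + g * f /T ⟪ g ⟫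
  ⟪⟫-unfold {g} f g0 = lift λ { zero → zero-trunc ; (suc n) → step n }
    where
    terms : ∀ f i → f i • g ^ i ≈[ i ] 0#
    terms f i = Mod.trans i (•-trunc (f i) (^-trunc {g} g0 i)) (reduce i (•-zeroʳ (f i)))
    step : ∀ n → f ⟪ g ⟫ ≈[ suc n ] const (f 0) + g * f /T ⟪ g ⟫
    step n = begin
      f ⟪ g ⟫
        ≈⟨ Σ≥0≈partialSum (terms f) (suc n) ⟩
      f 0 • 1# + partialSum (λ i → f (suc i) • (g * g ^ i)) n
        ≈⟨ reduce (suc n) (+-cong (const≋•1 (f 0)) (partialSum-cong n (λ i → *-•-swap g (f (suc i)) (g ^ i)))) ⟩
      const (f 0) + partialSum (λ i → g * (f (suc i) • g ^ i)) n
        ≈⟨ reduce (suc n) (+-congˡ (partialSum-* g (λ i → f (suc i) • g ^ i) n)) ⟩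
      const (f 0) + g * partialSum (λ i → f (suc i) • g ^ i) n
        ≈⟨ Mod.+-congˡ (suc n) (raise {g} g0 (Σ≥0≈partialSum (terms (f /T)) n)) ⟨
      const (f 0) + g * f /T ⟪ g ⟫ ∎
      where open Mod-Reasoning (suc n)

-- Powers and composition of series

module Calculus {c ℓ} (A : ℚ-Algebra c ℓ) where
  private
    module A = ℚ-Algebra A
  open SeriesAlgebra A public

  ^-cong : ∀ {f g} → f ≋ g → ∀ n → f ^ n ≋ g ^ n
  ^-cong p zero    = refl
  ^-cong {f} {g} p (suc n) = *-cong {f} {g} {f ^ n} {g ^ n} p (^-cong p n)

  ^-homo-* : ∀ f m n → f ^ (m ℕ.+ n) ≋ f ^ m * f ^ n
  ^-homo-* f zero    n = sym (*-identityˡ (f ^ n))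
  ^-homo-* f (suc m) n = trans (f *ˡ ^-homo-* f m n) (sym (*-assoc f (f ^ m) (f ^ n)))

  ^-assocʳ : ∀ f m n → (f ^ m) ^ n ≋ f ^ (m ℕ.* n)
  ^-assocʳ f m zero    = reflexive (≡.cong (f ^_) (≡.sym (ℕ.*-zeroʳ m)))
  ^-assocʳ f m (suc n) = trans ((f ^ m) *ˡ ^-assocʳ f m n)
    (trans (sym (^-homo-* f m (m ℕ.* n))) (reflexive (≡.cong (f ^_) (≡.sym (ℕ.*-suc m n)))))

  unfold-step : ∀ {g a b x y n} → g 0 A.≈ A.0# → a A.≈ b → x ≈[ n ] y →
                const a + g * x ≈[ suc n ] const b + g * y
  unfold-step {g} {a} {b} {n = n} g0 p q = Mod.+-cong (suc n) (reduce (suc n) (const-cong {a} {b} p)) (raise {g} g0 q)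

  ⟪⟫-cong : ∀ {f f′ g g′} → g 0 A.≈ A.0# → f ≋ f′ → g ≋ g′ → f ⟪ g ⟫ ≋ f′ ⟪ g′ ⟫
  ⟪⟫-cong {g = g} {g′} g0 p q = lift λ n → go n p
    where
    go : ∀ {f f′} n → f ≋ f′ → f ⟪ g ⟫ ≈[ n ] f′ ⟪ g′ ⟫
    go zero    p = zero-trunc
    go {f} {f′} (suc n) p = begin
      f ⟪ g ⟫                        ≈⟨ reduce (suc n) (⟪⟫-unfold {g} f g0) ⟩
      const (f 0) + g * f /T ⟪ g ⟫    ≈⟨ unfold-step {g} g0 (at p 0) (go n (coeffwise λ k → at p (suc k))) ⟩
      const (f′ 0) + g * f′ /T ⟪ g′ ⟫   ≈⟨ reduce (suc n) (+-congˡ (q *ʳ (f′ /T ⟪ g′ ⟫))) ⟩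
      const (f′ 0) + g′ * f′ /T ⟪ g′ ⟫  ≈⟨ reduce (suc n) (⟪⟫-unfold {g′} f′ (A.trans (A.sym (at q 0)) g0)) ⟨
      f′ ⟪ g′ ⟫                        ∎
      where open Mod-Reasoning (suc n)

  module Composition {g : Series} (g0 : g 0 A.≈ A.0#) where

    unfold : ∀ f → f ⟪ g ⟫ ≋ const (f 0) + g * f /T ⟪ g ⟫
    unfold f = ⟪⟫-unfold {g} f g0

    ⟪⟫-congˡ : ∀ {f f′} → f ≋ f′ → f ⟪ g ⟫ ≋ f′ ⟪ g ⟫
    ⟪⟫-congˡ p = ⟪⟫-cong {g = g} {g} g0 p refl

    ⟪⟫-cong-mod : ∀ n {f f′} → f ≈[ n ] f′ → f ⟪ g ⟫ ≈[ n ] f′ ⟪ g ⟫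
    ⟪⟫-cong-mod zero    p = zero-trunc
    ⟪⟫-cong-mod (suc n) {f} {f′} p = begin
      f ⟪ g ⟫                       ≈⟨ reduce (suc n) (unfold f) ⟩
      const (f 0) + g * f /T ⟪ g ⟫   ≈⟨ unfold-step {g} g0 (at[ p ]< (s≤s z≤n))
                                         (⟪⟫-cong-mod n (below λ k<n → at[ p ]< (s≤s k<n))) ⟩
      const (f′ 0) + g * f′ /T ⟪ g ⟫  ≈⟨ reduce (suc n) (unfold f′) ⟨
      f′ ⟪ g ⟫                      ∎
      where open Mod-Reasoning (suc n)

    ⟪⟫-zeroth : ∀ f → (f ⟪ g ⟫) 0 A.≈ f 0
    ⟪⟫-zeroth f = A.trans (at (unfold f) 0) (A.trans (A.+-congˡ (*-zerothˡ {g} (f /T ⟪ g ⟫) g0)) (A.+-identityʳ _))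

    ⟪⟫-+ : ∀ f f′ → (f + f′) ⟪ g ⟫ ≋ f ⟪ g ⟫ + f′ ⟪ g ⟫
    ⟪⟫-+ f f′ = lift λ n → go n f f′
      where
      go : ∀ n f f′ → (f + f′) ⟪ g ⟫ ≈[ n ] f ⟪ g ⟫ + f′ ⟪ g ⟫
      go zero    f f′ = zero-trunc
      go (suc n) f f′ = begin
        (f + f′) ⟪ g ⟫
          ≈⟨ reduce (suc n) (unfold (f + f′)) ⟩
        const (f 0 A.+ f′ 0) + g * (f /T + f′ /T) ⟪ g ⟫
          ≈⟨ unfold-step {g} g0 A.refl (go n (f /T) (f′ /T)) ⟩
        const (f 0 A.+ f′ 0) + g * (f /T ⟪ g ⟫ + f′ /T ⟪ g ⟫)
          ≈⟨ reduce (suc n) (+-congʳ (const-+ _ _)) ⟩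
        const (f 0) + const (f′ 0) + g * (f /T ⟪ g ⟫ + f′ /T ⟪ g ⟫)
          ≈⟨ reduce (suc n) (solve 5 (λ a b g x y → a :+ b :+ g :* (x :+ y) := (a :+ g :* x) :+ (b :+ g :* y)) refl
               (const (f 0)) (const (f′ 0)) g (f /T ⟪ g ⟫) (f′ /T ⟪ g ⟫)) ⟩
        (const (f 0) + g * f /T ⟪ g ⟫) + (const (f′ 0) + g * f′ /T ⟪ g ⟫)
          ≈⟨ reduce (suc n) (+-cong (unfold f) (unfold f′)) ⟨
        f ⟪ g ⟫ + f′ ⟪ g ⟫ ∎
        where open Mod-Reasoning (suc n)

    ⟪⟫-• : ∀ a f → (a • f) ⟪ g ⟫ ≋ const a * f ⟪ g ⟫
    ⟪⟫-• a f = lift λ n → go n f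
      where
      go : ∀ n f → (a • f) ⟪ g ⟫ ≈[ n ] const a * f ⟪ g ⟫
      go zero    f = zero-trunc
      go (suc n) f = begin
        (a • f) ⟪ g ⟫
          ≈⟨ reduce (suc n) (unfold (a • f)) ⟩
        const (a A.* f 0) + g * (a • (f /T)) ⟪ g ⟫
          ≈⟨ unfold-step {g} g0 A.refl (go n (f /T)) ⟩
        const (a A.* f 0) + g * (const a * f /T ⟪ g ⟫)
          ≈⟨ reduce (suc n) (+-congʳ (const-* _ _)) ⟩
        const a * const (f 0) + g * (const a * f /T ⟪ g ⟫)
          ≈⟨ reduce (suc n) (solve 4 (λ a b g x → a :* b :+ g :* (a :* x) := a :* (b :+ g :* x)) refl
               (const a) (const (f 0)) g (f /T ⟪ g ⟫)) ⟩
        const a * (const (f 0) + g * f /T ⟪ g ⟫)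
          ≈⟨ reduce (suc n) (const a *ˡ unfold f) ⟨
        const a * f ⟪ g ⟫ ∎
        where open Mod-Reasoning (suc n)

    ⟪⟫-0 : 0# ⟪ g ⟫ ≋ 0#
    ⟪⟫-0 = begin
      0# ⟪ g ⟫              ≈⟨ ⟪⟫-congˡ {0#} {A.0# • 0#} (sym (•-zeroʳ A.0#)) ⟩
      (A.0# • 0#) ⟪ g ⟫     ≈⟨ ⟪⟫-• A.0# 0# ⟩
      0# * 0# ⟪ g ⟫         ≈⟨ zeroˡ (0# ⟪ g ⟫) ⟩
      0#                    ∎
      where open ≋-Reasoning

    ⟪⟫-const : ∀ a → const a ⟪ g ⟫ ≋ const a
    ⟪⟫-const a = begin
      const a ⟪ g ⟫             ≈⟨ unfold (const a) ⟩
      const a + g * const a /T ⟪ g ⟫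
        ≈⟨ +-congˡ (g *ˡ trans (⟪⟫-congˡ {const a /T} {0#} (coeffwise λ n → A.reflexive (≡.sym (const-0 n)))) ⟪⟫-0) ⟩
      const a + g * 0#          ≈⟨ solve 2 (λ a g → a :+ g :* con 0ℚ := a) refl (const a) g ⟩
      const a                   ∎
      where open ≋-Reasoning

    ⟪⟫-var : var ⟪ g ⟫ ≋ g
    ⟪⟫-var = begin
      var ⟪ g ⟫             ≈⟨ unfold var ⟩
      0# + g * 1# ⟪ g ⟫     ≈⟨ +-congˡ (g *ˡ ⟪⟫-const A.1#) ⟩
      0# + g * 1#           ≈⟨ solve 1 (λ g → con 0ℚ :+ g :* con 1ℚ := g) refl g ⟩
      g                     ∎
      where open ≋-Reasoning

    ⟪⟫-* : ∀ f f′ → (f * f′) ⟪ g ⟫ ≋ f ⟪ g ⟫ * f′ ⟪ g ⟫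
    ⟪⟫-* f f′ = lift λ n → go n f f′
      where
      go : ∀ n f f′ → (f * f′) ⟪ g ⟫ ≈[ n ] f ⟪ g ⟫ * f′ ⟪ g ⟫
      go zero    f f′ = zero-trunc
      go (suc n) f f′ = begin
        (f * f′) ⟪ g ⟫
          ≈⟨ reduce (suc n) (unfold (f * f′)) ⟩
        const ((f * f′) 0) + g * (f 0 • (f′ /T) + f /T * f′) ⟪ g ⟫
          ≈⟨ reduce (suc n) (+-cong (trans (const-cong (*-zeroth f f′)) (const-* _ _))
               (g *ˡ trans (⟪⟫-+ (f 0 • (f′ /T)) (f /T * f′)) (+-congʳ (⟪⟫-• (f 0) (f′ /T))))) ⟩
        a * b + g * (a * y + (f /T * f′) ⟪ g ⟫)
          ≈⟨ Mod.+-congˡ (suc n) (raise {g} g0 (Mod.+-congˡ n (go n (f /T) f′))) ⟩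
        a * b + g * (a * y + x * f′ ⟪ g ⟫)
          ≈⟨ reduce (suc n) (solve 6 (λ a b g x y z → a :* b :+ g :* (a :* y :+ x :* z) := a :* (b :+ g :* y) :+ g :* x :* z) refl
               a b g x y (f′ ⟪ g ⟫)) ⟩
        a * (b + g * y) + g * x * f′ ⟪ g ⟫
          ≈⟨ reduce (suc n) (+-congʳ (a *ˡ unfold f′)) ⟨
        a * f′ ⟪ g ⟫ + g * x * f′ ⟪ g ⟫
          ≈⟨ reduce (suc n) (distribʳ (f′ ⟪ g ⟫) a (g * x)) ⟨
        (a + g * x) * f′ ⟪ g ⟫
          ≈⟨ reduce (suc n) (unfold f *ʳ (f′ ⟪ g ⟫)) ⟨
        f ⟪ g ⟫ * f′ ⟪ g ⟫ ∎
        where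
        open Mod-Reasoning (suc n)
        a b x y : Series
        a = const (f 0)
        b = const (f′ 0)
        x = f /T ⟪ g ⟫
        y = f′ /T ⟪ g ⟫

    ⟪⟫-^ : ∀ f n → (f ^ n) ⟪ g ⟫ ≋ (f ⟪ g ⟫) ^ n
    ⟪⟫-^ f zero    = ⟪⟫-const A.1#
    ⟪⟫-^ f (suc n) = trans (⟪⟫-* f (f ^ n)) ((f ⟪ g ⟫) *ˡ ⟪⟫-^ f n)

    ⟪⟫-- : ∀ f f′ → (f - f′) ⟪ g ⟫ ≋ f ⟪ g ⟫ - f′ ⟪ g ⟫
    ⟪⟫-- f f′ = begin
      (f - f′) ⟪ g ⟫
        ≈⟨ solve 2 (λ x y → x := (x :+ y) :- y) refl ((f - f′) ⟪ g ⟫) (f′ ⟪ g ⟫) ⟩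
      ((f - f′) ⟪ g ⟫ + f′ ⟪ g ⟫) - f′ ⟪ g ⟫
        ≈⟨ +-congʳ (⟪⟫-+ (f - f′) f′) ⟨
      ((f - f′) + f′) ⟪ g ⟫ - f′ ⟪ g ⟫
        ≈⟨ +-congʳ (⟪⟫-congˡ (solve 2 (λ x y → (x :- y) :+ y := x) refl f f′)) ⟩
      f ⟪ g ⟫ - f′ ⟪ g ⟫ ∎
      where open ≋-Reasoning

-- Formal derivatives and uniqueness for differential equations

module Derivative {c ℓ} (A : ℚ-Algebra c ℓ) where
  private
    module A = ℚ-Algebra A
  open Calculus A public
  open Rationals

  nat : ℕ → A.Carrier
  nat n = A.φ (fromℕ n)

  nat-suc : ∀ n → nat (suc n) A.≈ A.1# A.+ nat n
  nat-suc n = A.trans (A.reflexive (≡.cong A.φ (fromℕ-suc n))) (A.trans (A.φ-+ _ _) (A.+-congʳ A.φ-1))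

  nat-1 : nat 1 A.≈ A.1#
  nat-1 = A.φ-1

  nat-suc-* : ∀ n x → nat (suc n) A.* x A.≈ x A.+ nat n A.* x
  nat-suc-* n x = A.trans (A.*-congʳ (nat-suc n)) (A.trans (A.distribʳ _ _ _) (A.+-congʳ (A.*-identityˡ x)))

  nat-cancelˡ : ∀ n {x y} → nat (suc n) A.* x A.≈ nat (suc n) A.* y → x A.≈ y
  nat-cancelˡ n {x} {y} p = A.trans (recip x) (A.trans (A.*-congˡ p) (A.sym (recip y)))
    where
    recip : ∀ z → z A.≈ A.φ (+ 1 / suc n) A.* (nat (suc n) A.* z)
    recip z = A.sym (A.trans (A.sym (A.*-assoc _ _ _)) (A.trans (A.*-congʳ
      (A.trans (A.sym (A.φ-* _ _)) (A.trans (A.reflexive (≡.cong A.φ (/-*-fromℕ (+ 1) (suc n)))) A.φ-1))) (A.*-identityˡ z)))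

  D : Series → Series
  D f n = nat (suc n) A.* f (suc n)

  D-cong : ∀ {f g} → f ≋ g → D f ≋ D g
  D-cong p = coeffwise λ n → A.*-congˡ (at p (suc n))

  D-+ : ∀ f g → D (f + g) ≋ D f + D g
  D-+ f g = coeffwise λ n → A.distribˡ _ _ _

  D-neg : ∀ f → D (- f) ≋ - D f
  D-neg f = coeffwise λ n → A.sym (-‿distribʳ-* _ _)
    where open import Algebra.Properties.Ring A.ring using (-‿distribʳ-*)

  D-- : ∀ f g → D (f - g) ≋ D f - D g
  D-- f g = trans (D-+ f (- g)) (+-congˡ (D-neg g))

  D-const : ∀ a → D (const a) ≋ 0#
  D-const a = coeffwise λ n → A.trans (A.zeroʳ _) (A.reflexive (≡.sym (const-0 n)))

  D-1 : D 1# ≋ 0#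
  D-1 = D-const A.1#

  D-• : ∀ a f → D (a • f) ≋ const a * D f
  D-• a f = trans (coeffwise λ n → A.trans (A.sym (A.*-assoc _ _ _)) (A.trans (A.*-congʳ (A.*-comm _ _)) (A.*-assoc _ _ _)))
    (const-•≋* a (D f))

  D-var : D var ≋ 1#
  D-var = coeffwise λ { zero → A.trans (A.*-identityʳ _) nat-1 ; (suc n) → A.zeroʳ _ }

  D-split : ∀ f → D f ≋ f /T + var * D (f /T)
  D-split f = coeffwise λ
    { zero    → A.trans (A.*-congʳ nat-1) (A.trans (A.*-identityˡ _) (A.sym (A.trans (A.+-congˡ (*-zerothˡ {var} (D (f /T)) A.refl)) (A.+-identityʳ _))))
    ; (suc n) → A.trans (nat-suc-* (suc n) _) (A.+-congˡ (A.sym (var-*-suc (D (f /T)) n))) }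

  -- Splitting off the constant term of `f` reduces the claim to `f /T` and `g`, where the factor T
  -- makes one order less sufficient.
  D-* : ∀ f g → D (f * g) ≋ D f * g + f * D g
  D-* f g = lift λ n → go n f g
    where
    go : ∀ n f g → D (f * g) ≈[ n ] D f * g + f * D g
    go zero    f g = zero-trunc
    go (suc n) f g = begin
      D (f * g)
        ≈⟨ reduce (suc n) (D-split (f * g)) ⟩
      (a • ĝ + f̂ * g) + var * D (a • ĝ + f̂ * g)
        ≈⟨ Mod.+-cong (suc n) (reduce (suc n) (+-congʳ (const-•≋* a ĝ)))
             (raise {var} A.refl (Mod.trans n (reduce n (trans (D-+ (a • ĝ) (f̂ * g)) (+-congʳ (D-• a ĝ))))
               (Mod.+-congˡ n (go n f̂ g)))) ⟩
      (const a * ĝ + f̂ * g) + var * (const a * D ĝ + (D f̂ * g + f̂ * D g))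
        ≈⟨ reduce (suc n) (solve 8 (λ a ĝ f̂ g v dĝ df̂ dg →
             (a :* ĝ :+ f̂ :* g) :+ v :* (a :* dĝ :+ (df̂ :* g :+ f̂ :* dg)) :=
             (f̂ :+ v :* df̂) :* g :+ (a :* (ĝ :+ v :* dĝ) :+ v :* f̂ :* dg)) refl
             (const a) ĝ f̂ g var (D ĝ) (D f̂) (D g)) ⟩
      (f̂ + var * D f̂) * g + (const a * (ĝ + var * D ĝ) + var * f̂ * D g)
        ≈⟨ reduce (suc n) (+-cong (D-split f *ʳ g) (+-congʳ (const a *ˡ D-split g))) ⟨
      D f * g + (const a * D g + var * f̂ * D g)
        ≈⟨ reduce (suc n) (+-congˡ (trans (sym (distribʳ (D g) (const a) (var * f̂))) (sym (split f) *ʳ D g))) ⟩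
      D f * g + f * D g ∎
      where
      open Mod-Reasoning (suc n)
      a : A.Carrier
      a = f 0
      f̂ ĝ : Series
      f̂ = f /T
      ĝ = g /T

  D-⟪⟫ : ∀ {g} → g 0 A.≈ A.0# → ∀ f → D (f ⟪ g ⟫) ≋ D g * D f ⟪ g ⟫
  D-⟪⟫ {g} g0 f = lift λ n → go n f
    where
    open Composition {g} g0
    go : ∀ n f → D (f ⟪ g ⟫) ≈[ n ] D g * D f ⟪ g ⟫
    go zero    f = zero-trunc
    go (suc n) f = begin
      D (f ⟪ g ⟫)
        ≈⟨ reduce (suc n) (D-cong (unfold f)) ⟩
      D (const (f 0) + g * x)
        ≈⟨ reduce (suc n) (trans (D-+ (const (f 0)) (g * x)) (+-cong (D-const (f 0)) (D-* g x))) ⟩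
      0# + (D g * x + g * D x)
        ≈⟨ Mod.+-congˡ (suc n) (Mod.+-congˡ (suc n) (raise {g} g0 (go n (f /T)))) ⟩
      0# + (D g * x + g * (D g * y))
        ≈⟨ reduce (suc n) (solve 4 (λ g x y d → con 0ℚ :+ (d :* x :+ g :* (d :* y)) := d :* (x :+ g :* y)) refl g x y (D g)) ⟩
      D g * (x + g * y)
        ≈⟨ reduce (suc n) (D g *ˡ +-congˡ (⟪⟫-var *ʳ y)) ⟨
      D g * (x + var ⟪ g ⟫ * y)
        ≈⟨ reduce (suc n) (D g *ˡ +-congˡ (⟪⟫-* var (D (f /T)))) ⟨
      D g * (x + (var * D (f /T)) ⟪ g ⟫)
        ≈⟨ reduce (suc n) (D g *ˡ trans (⟪⟫-congˡ (D-split f)) (⟪⟫-+ (f /T) (var * D (f /T)))) ⟨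
      D g * D f ⟪ g ⟫ ∎
      where
      open Mod-Reasoning (suc n)
      x y : Series
      x = f /T ⟪ g ⟫
      y = D (f /T) ⟪ g ⟫

  integrate-mod : ∀ {f g n} → f 0 A.≈ g 0 → D f ≈[ n ] D g → f ≈[ suc n ] g
  integrate-mod p q = below λ
    { {zero}  _         → p
    ; {suc k} (s≤s k<n) → nat-cancelˡ k (at[ q ]< k<n) }

  D-unique : ∀ {f g} → f 0 A.≈ g 0 → D f ≋ D g → f ≋ g
  D-unique p q = lift λ { zero → zero-trunc ; (suc n) → integrate-mod p (reduce n q) }

  -- Through the equation, agreement of the solutions modulo Tⁿ passes to their derivatives, and
  -- integration gains one order.
  linear-ODE-unique : ∀ h {f g} → f 0 A.≈ g 0 → D f ≋ h * f → D g ≋ h * g → f ≋ g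
  linear-ODE-unique h {f} {g} f0≈g0 f′ g′ = lift go
    where
    go : ∀ n → f ≈[ n ] g
    go zero    = zero-trunc
    go (suc n) = integrate-mod f0≈g0 (Mod.trans n (reduce n f′)
      (Mod.trans n (*-cong-mod {h} {h} (Mod.refl n) (go n)) (reduce n (sym g′))))

  -- The next order of s comes from c and conversely, so both congruences are carried in one
  -- induction. This single uniqueness statement supplies both the values of sin u and cos u and the
  -- addition theorems.
  rotation-ODE-unique : ∀ h {s c s′ c′} → s 0 A.≈ s′ 0 → c 0 A.≈ c′ 0 →
    D s ≋ h * c → D c ≋ - (h * s) → D s′ ≋ h * c′ → D c′ ≋ - (h * s′) → ∀ n → (s ≈[ n ] s′) P.× (c ≈[ n ] c′)
  rotation-ODE-unique h p q ds dc ds′ dc′ zero    = zero-trunc P., zero-trunc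
  rotation-ODE-unique h {s} {c} {s′} {c′} p q ds dc ds′ dc′ (suc n) with rotation-ODE-unique h {s} {c} {s′} {c′} p q ds dc ds′ dc′ n
  ... | s≈s′ P., c≈c′ =
    integrate-mod p (Mod.trans n (reduce n ds) (Mod.trans n (*-cong-mod {h} {h} (Mod.refl n) c≈c′) (reduce n (sym ds′)))) P.,
    integrate-mod q (Mod.trans n (reduce n dc) (Mod.trans n (Mod.-‿cong n (*-cong-mod {h} {h} (Mod.refl n) s≈s′)) (reduce n (sym dc′))))

  Σ≥1≋⟪⟫ : ∀ {t} f {g} → g 0 A.≈ A.0# → (∀ i → t i ≋ f (suc i) • g ^ suc i) → const (f 0) + Σ≥0 t ≋ f ⟪ g ⟫
  Σ≥1≋⟪⟫ {t} f {g} g0 p = lift λ n → begin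
    const (f 0) + Σ≥0 t
      ≈⟨ Mod.+-cong n (reduce n (sym (const≋•1 (f 0)))) (Σ≥0≈partialSum (λ i → t-trunc i) n) ⟩
    f 0 • 1# + partialSum t n
      ≈⟨ reduce n (+-congˡ (partialSum-cong n p)) ⟩
    partialSum (λ i → f i • g ^ i) (suc n)
      ≈⟨ reduce n (partialSum-suc (λ i → f i • g ^ i) n) ⟩
    partialSum (λ i → f i • g ^ i) n + f n • g ^ n
      -- Together with the constant term, n shifted summands are n + 1 terms of the composition; the
      -- surplus last one is divisible by Tⁿ.
      ≈⟨ Mod.+-congˡ n (term-trunc n) ⟩
    partialSum (λ i → f i • g ^ i) n + 0#
      ≈⟨ reduce n (+-identityʳ _) ⟩
    partialSum (λ i → f i • g ^ i) n
      ≈⟨ Σ≥0≈partialSum term-trunc n ⟨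
    f ⟪ g ⟫ ∎
    where
    open module R {n} = Mod-Reasoning n
    term-trunc : ∀ i → f i • g ^ i ≈[ i ] 0#
    term-trunc i = Mod.trans i (•-trunc (f i) (^-trunc {g} g0 i)) (reduce i (•-zeroʳ (f i)))
    t-trunc : ∀ i → t i ≈[ i ] 0#
    t-trunc i = Mod.trans i (reduce i (p i)) (below λ k<i → at[ term-trunc (suc i) ]< (ℕ.m≤n⇒m≤1+n k<i))

module Inverse {c ℓ} (A : ℚ-Algebra c ℓ) where
  private
    module A = ℚ-Algebra A
  open Derivative A

  -- The geometric series is the all-ones series composed with 1 - f. Horner's rule then gives the
  -- fixed point equation I = 1 + (1 - f) I, which rearranges to f I = 1.
  inverse-correct : ∀ f → f 0 A.≈ A.1# → f * inverse f ≋ 1#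
  inverse-correct f f0 = begin
    f * I                     ≈⟨ solve 2 (λ f i → f :* i := i :- (con 1ℚ :- f) :* i) refl f I ⟩
    I - (1# - f) * I          ≈⟨ +-congʳ fixpoint ⟩
    (1# + (1# - f) * I) - (1# - f) * I
      ≈⟨ solve 1 (λ x → con 1ℚ :+ x :- x := con 1ℚ) refl ((1# - f) * I) ⟩
    1#                        ∎
    where
    open ≋-Reasoning
    I ones : Series
    I = inverse f
    ones n = A.1#
    1-f₀ : (1# - f) 0 A.≈ A.0#
    1-f₀ = A.trans (A.+-congˡ (A.-‿cong f0)) (A.-‿inverseʳ A.1#)
    geometric : I ≋ ones ⟪ 1# - f ⟫
    geometric = coeffwise λ n → at (partialSum-cong {λ i → (1# - f) ^ i} {λ i → A.1# • (1# - f) ^ i}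
      (suc n) λ i → coeffwise λ k → A.sym (A.*-identityˡ _)) n
    fixpoint : I ≋ 1# + (1# - f) * I
    fixpoint = trans geometric (trans (⟪⟫-unfold {1# - f} ones 1-f₀) (+-congˡ ((1# - f) *ˡ sym geometric)))

  inverse-unique : ∀ {f x} → f 0 A.≈ A.1# → f * x ≋ 1# → inverse f ≋ x
  inverse-unique {f} {x} f0 p = begin
    inverse f            ≈⟨ *-identityˡ (inverse f) ⟨
    1# * inverse f       ≈⟨ p *ʳ inverse f ⟨
    f * x * inverse f    ≈⟨ solve 3 (λ f x i → f :* x :* i := f :* i :* x) refl f x (inverse f) ⟩
    f * inverse f * x    ≈⟨ inverse-correct f f0 *ʳ x ⟩
    1# * x               ≈⟨ *-identityˡ x ⟩
    x                    ∎
    where open ≋-Reasoning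

-- Even and odd parts of a series

module Parity {c ℓ} (A : ℚ-Algebra c ℓ) where
  private
    module A = ℚ-Algebra A
  open Derivative A

  -- f(T) = (even f)(T²) + T (odd f)(T²)
  even odd : Series → Series
  even f zero    = f 0
  even f (suc n) = even (f /T /T) n
  odd f = even (f /T)

  even-coeff : ∀ f n → even f n ≡ f (2 ℕ.* n)
  even-coeff f zero    = ≡.refl
  even-coeff f (suc n) = ≡.trans (even-coeff (f /T /T) n) (≡.cong f (≡.sym (ℕ.*-suc 2 n)))

  even-cong : ∀ {f g} → f ≋ g → even f ≋ even g
  even-cong p = coeffwise (go p)
    where
    go : ∀ {f g} → f ≋ g → ∀ n → even f n A.≈ even g n
    go p zero    = at p 0
    go p (suc n) = go (coeffwise λ k → at p (2 ℕ.+ k)) n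

  odd-cong : ∀ {f g} → f ≋ g → odd f ≋ odd g
  odd-cong p = even-cong (coeffwise λ k → at p (suc k))

  even-split : ∀ f → even f ≋ const (f 0) + var * odd (f /T)
  even-split f = split (even f)

  even-+ : ∀ f g → even (f + g) ≋ even f + even g
  even-+ f g = coeffwise (go f g)
    where
    go : ∀ f g n → even (f + g) n A.≈ (even f + even g) n
    go f g zero    = A.refl
    go f g (suc n) = go (f /T /T) (g /T /T) n

  even-• : ∀ a f → even (a • f) ≋ const a * even f
  even-• a f = trans (coeffwise (go f)) (const-•≋* a (even f))
    where
    go : ∀ f n → even (a • f) n A.≈ (a • even f) n
    go f zero    = A.refl
    go f (suc n) = go (f /T /T) n

  -- Removing the constant term of `f` exchanges its parities, hence the mutual recursion. The odd
  -- case calls the even one at the same level; the even case calls the odd one a level lower,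
  -- thanks to its factor `var`.
  even-*-mod : ∀ n f g → even (f * g) ≈[ n ] even f * even g + var * (odd f * odd g)
  odd-*-mod  : ∀ n f g → odd (f * g) ≈[ n ] odd f * even g + even f * odd g

  odd-*-mod n f g = begin
    odd (f * g)
      ≈⟨ reduce n (trans (even-+ (f 0 • (g /T)) (f /T * g)) (+-congʳ (even-• (f 0) (g /T)))) ⟩
    a * odd g + even (f /T * g)
      ≈⟨ Mod.+-congˡ n (even-*-mod n (f /T) g) ⟩
    a * odd g + (odd f * even g + var * (odd (f /T) * odd g))
      ≈⟨ reduce n (solve 6 (λ a og of eg v o → a :* og :+ (of :* eg :+ v :* (o :* og)) := of :* eg :+ (a :+ v :* o) :* og) refl
           a (odd g) (odd f) (even g) var (odd (f /T))) ⟩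
    odd f * even g + (a + var * odd (f /T)) * odd g
      ≈⟨ reduce n (+-congˡ (even-split f *ʳ odd g)) ⟨
    odd f * even g + even f * odd g ∎
    where
    open Mod-Reasoning n
    a : Series
    a = const (f 0)

  even-*-mod zero    f g = zero-trunc
  even-*-mod (suc n) f g = begin
    even (f * g)
      ≈⟨ reduce (suc n) (even-split (f * g)) ⟩
    const ((f * g) 0) + var * odd (f 0 • (g /T) + f /T * g)
      ≈⟨ reduce (suc n) (+-cong (trans (const-cong (*-zeroth f g)) (const-* _ _))
           (var *ˡ trans (even-+ (f 0 • (g /T /T)) ((f /T * g) /T)) (+-congʳ (even-• (f 0) (g /T /T))))) ⟩
    a * const (g 0) + var * (a * odd (g /T) + odd (f /T * g))
      ≈⟨ Mod.+-congˡ (suc n) (raise {var} A.refl (Mod.+-congˡ n (odd-*-mod n (f /T) g))) ⟩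
    a * const (g 0) + var * (a * odd (g /T) + (odd (f /T) * even g + odd f * odd g))
      ≈⟨ reduce (suc n) (solve 8 (λ a b v o p eg of og →
           a :* b :+ v :* (a :* o :+ (p :* eg :+ of :* og)) := a :* (b :+ v :* o) :+ v :* p :* eg :+ v :* (of :* og)) refl
           a (const (g 0)) var (odd (g /T)) (odd (f /T)) (even g) (odd f) (odd g)) ⟩
    a * (const (g 0) + var * odd (g /T)) + var * odd (f /T) * even g + var * (odd f * odd g)
      ≈⟨ reduce (suc n) (+-congʳ (+-congʳ (a *ˡ even-split g))) ⟨
    a * even g + var * odd (f /T) * even g + var * (odd f * odd g)
      ≈⟨ reduce (suc n) (+-congʳ (distribʳ (even g) a (var * odd (f /T)))) ⟨
    (a + var * odd (f /T)) * even g + var * (odd f * odd g)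
      ≈⟨ reduce (suc n) (+-congʳ (even-split f *ʳ even g)) ⟨
    even f * even g + var * (odd f * odd g) ∎
    where
    open Mod-Reasoning (suc n)
    a : Series
    a = const (f 0)

  even-* : ∀ f g → even (f * g) ≋ even f * even g + var * (odd f * odd g)
  even-* f g = lift λ n → even-*-mod n f g

  odd-* : ∀ f g → odd (f * g) ≋ odd f * even g + even f * odd g
  odd-* f g = lift λ n → odd-*-mod n f g

ℚ-algebra : ℚ-Algebra 0ℓ 0ℓ
ℚ-algebra = record
  { commutativeRing = ℚ.+-*-commutativeRing
  ; φ = id
  ; φ-isRingHomomorphism = record
    { isSemiringHomomorphism = record
      { isNearSemiringHomomorphism = record
        { +-isMonoidHomomorphism = record
          { isMagmaHomomorphism = record
            { isRelHomomorphism = record { cong = id }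
            ; homo = λ x y → ≡.refl
            }
          ; ε-homo = ≡.refl
          }
        ; *-homo = λ x y → ≡.refl
        }
      ; 1#-homo = ≡.refl
      }
    ; -‿homo = λ x → ≡.refl
    }
  }

module Inclusion {c ℓ} (A : ℚ-Algebra c ℓ) where
  private
    module A = ℚ-Algebra A
    module Q = Derivative ℚ-algebra
  open Derivative A

  ι : Q.Series → Series
  ι f n = A.φ (f n)

  ι-cong : ∀ {f g} → f Q.≋ g → ι f ≋ ι g
  ι-cong p = coeffwise λ n → A.reflexive (≡.cong A.φ (Q.at p n))

  ι-+ : ∀ f g → ι (f Q.+ g) ≋ ι f + ι g
  ι-+ f g = coeffwise λ n → A.φ-+ _ _

  ι-* : ∀ f g → ι (f Q.* g) ≋ ι f * ι g
  ι-* f g = coeffwise λ n → go n f g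
    where
    go : ∀ n f g → ι (f Q.* g) n A.≈ (ι f * ι g) n
    go zero    f g = A.trans (A.φ-+ _ _) (A.+-cong (A.φ-* _ _) A.φ-0)
    go (suc n) f g = A.trans (A.φ-+ _ _) (A.+-cong (A.φ-* _ _) (go n (f Q./T) g))

  ι-const : ∀ a → ι (Q.const a) ≋ const (A.φ a)
  ι-const a = coeffwise λ { zero → A.refl ; (suc n) → A.φ-0 }

  ι-1 : ι Q.1# ≋ 1#
  ι-1 = trans (ι-const 1ℚ) (const-cong A.φ-1)

  ι-var : ι Q.var ≋ var
  ι-var = coeffwise λ { zero → A.φ-0 ; (suc zero) → A.φ-1 ; (suc (suc n)) → A.φ-0 }

  ι-• : ∀ a f → ι (a Q.• f) ≋ A.φ a • ι f
  ι-• a f = coeffwise λ n → A.φ-* _ _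

  ι-⟪⟫ : ∀ f {g} → g 0 ≡ 0ℚ → ι (f Q.⟪ g ⟫) ≋ ι f ⟪ ι g ⟫
  ι-⟪⟫ f {g} g0 = lift λ n → go n f
    where
    ιg0 : ι g 0 A.≈ A.0#
    ιg0 = A.trans (A.reflexive (≡.cong A.φ g0)) A.φ-0
    go : ∀ n f → ι (f Q.⟪ g ⟫) ≈[ n ] ι f ⟪ ι g ⟫
    go zero    f = zero-trunc
    go (suc n) f = begin
      ι (f Q.⟪ g ⟫)
        ≈⟨ reduce (suc n) (ι-cong (Q.⟪⟫-unfold {g} f g0)) ⟩
      ι (Q.const (f 0) Q.+ g Q.* f Q./T Q.⟪ g ⟫)
        ≈⟨ reduce (suc n) (trans (ι-+ (Q.const (f 0)) (g Q.* f Q./T Q.⟪ g ⟫)) (+-cong (ι-const (f 0)) (ι-* g (f Q./T Q.⟪ g ⟫)))) ⟩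
      const (ι f 0) + ι g * ι (f Q./T Q.⟪ g ⟫)
        ≈⟨ unfold-step {ι g} ιg0 A.refl (go n (f Q./T)) ⟩
      const (ι f 0) + ι g * ι f /T ⟪ ι g ⟫
        ≈⟨ reduce (suc n) (⟪⟫-unfold {ι g} (ι f) ιg0) ⟨
      ι f ⟪ ι g ⟫ ∎
      where open Mod-Reasoning (suc n)

-- Exponential, sine and cosine

module Factorials where
  open Rationals

  1/!-suc : ∀ n → fromℕ (suc n) ℚ.* 1/[ suc n ]! ≡ 1/[ n ]!
  1/!-suc n = fromℕ-cancelˡ (n !) {{n !≢0}} (begin
    fromℕ (n !) ℚ.* (fromℕ (suc n) ℚ.* 1/[ suc n ]!)  ≡⟨ ℚ.*-assoc (fromℕ (n !)) (fromℕ (suc n)) _ ⟨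
    (fromℕ (n !) ℚ.* fromℕ (suc n)) ℚ.* 1/[ suc n ]!  ≡⟨ ≡.cong (ℚ._* 1/[ suc n ]!) (ℚ.*-comm (fromℕ (n !)) _) ⟩
    (fromℕ (suc n) ℚ.* fromℕ (n !)) ℚ.* 1/[ suc n ]!  ≡⟨ ≡.cong (ℚ._* 1/[ suc n ]!) (fromℕ-* (suc n) (n !)) ⟨
    fromℕ (suc n !) ℚ.* 1/[ suc n ]!                  ≡⟨ recip (suc n) ⟩
    1ℚ                                                ≡⟨ recip n ⟨
    fromℕ (n !) ℚ.* 1/[ n ]!                          ∎)
    where
    open ≡.≡-Reasoning
    recip : ∀ n → fromℕ (n !) ℚ.* 1/[ n ]! ≡ 1ℚ
    recip n = ≡.trans (ℚ.*-comm (fromℕ (n !)) _) (/-*-fromℕ (+ 1) (n !) {{n !≢0}})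

module Trig {c ℓ} (A : ℚ-Algebra c ℓ) where
  open Rationals
  open Factorials
  private
    module A = ℚ-Algebra A
  open Derivative A public
  open Inclusion A public

  nat-φ : ∀ n {x y} → fromℕ n ℚ.* x ≡ y → nat n A.* A.φ x A.≈ A.φ y
  nat-φ n p = A.trans (A.sym (A.φ-* _ _)) (A.reflexive (≡.cong A.φ p))

  D-exp : D (ι expSeries) ≋ ι expSeries
  D-exp = coeffwise λ n → nat-φ (suc n) (1/!-suc n)

  var*D-coeff : ∀ f n → (var * D f) n A.≈ nat n A.* f n
  var*D-coeff f zero    = A.trans (*-zerothˡ {var} (D f) A.refl) (A.sym (A.trans (A.*-congʳ A.φ-0) (A.zeroˡ (f 0))))
  var*D-coeff f (suc n) = var-*-suc (D f) n

  nat-even : ∀ n → nat (2 ℕ.* n) A.≈ nat n A.+ nat n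
  nat-even n = A.trans (A.reflexive (≡.cong A.φ (fromℕ-even n))) (A.φ-+ _ _)

  nat-odd : ∀ n → nat (suc (2 ℕ.* n)) A.≈ A.1# A.+ (nat n A.+ nat n)
  nat-odd n = A.trans (nat-suc (2 ℕ.* n)) (A.+-congˡ (nat-even n))

  -- With θ = T d/dT, the operator 1 + 2θ is the effect on f of differentiating T f(T²). It serves
  -- the sine and the arcsine alike, both being odd series.
  1+2θ-coeff : ∀ f n → (f + (var * D f + var * D f)) n A.≈ nat (suc (2 ℕ.* n)) A.* f n
  1+2θ-coeff f n = begin
    f n A.+ ((var * D f) n A.+ (var * D f) n)
      ≈⟨ A.+-congˡ (A.+-cong (var*D-coeff f n) (var*D-coeff f n)) ⟩
    f n A.+ (nat n A.* f n A.+ nat n A.* f n)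
      ≈⟨ A.+-cong (A.*-identityˡ (f n)) (A.distribʳ (f n) (nat n) (nat n)) ⟨
    A.1# A.* f n A.+ (nat n A.+ nat n) A.* f n
      ≈⟨ A.distribʳ (f n) A.1# (nat n A.+ nat n) ⟨
    (A.1# A.+ (nat n A.+ nat n)) A.* f n
      ≈⟨ A.*-congʳ (nat-odd n) ⟨
    nat (suc (2 ℕ.* n)) A.* f n ∎
    where open SetoidReasoning A.setoid

  -- σ(T²) = sinh T / T and γ(T²) = cosh T
  σ γ : Series
  σ j = A.φ 1/[ suc (2 ℕ.* j) ]!
  γ j = A.φ 1/[ 2 ℕ.* j ]!

  σ-ODE : σ + (var * D σ + var * D σ) ≋ γ
  σ-ODE = coeffwise λ n → A.trans (1+2θ-coeff σ n) (nat-φ (suc (2 ℕ.* n)) (1/!-suc (2 ℕ.* n)))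

  γ-ODE : D γ + D γ ≋ σ
  γ-ODE = coeffwise λ n → begin
    D γ n A.+ D γ n
      ≈⟨ A.distribʳ (γ (suc n)) (nat (suc n)) (nat (suc n)) ⟨
    (nat (suc n) A.+ nat (suc n)) A.* γ (suc n)
      ≈⟨ A.*-congʳ (nat-even (suc n)) ⟨
    nat (2 ℕ.* suc n) A.* A.φ 1/[ 2 ℕ.* suc n ]!
      ≡⟨ ≡.cong (λ k → nat k A.* A.φ 1/[ k ]!) (ℕ.*-suc 2 n) ⟩
    nat (2 ℕ.+ 2 ℕ.* n) A.* A.φ 1/[ 2 ℕ.+ 2 ℕ.* n ]!
      ≈⟨ nat-φ (2 ℕ.+ 2 ℕ.* n) (1/!-suc (suc (2 ℕ.* n))) ⟩
    σ n ∎
    where open SetoidReasoning A.setoid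

  -- The second hypothesis holds when z is a constant multiple of h².
  D-*⟪⟫ : ∀ f {h z} → z 0 A.≈ A.0# → h * D z ≋ (z + z) * D h →
          D (h * f ⟪ z ⟫) ≋ D h * (f + (var * D f + var * D f)) ⟪ z ⟫
  D-*⟪⟫ f {h} {z} z0 p = begin
    D (h * f ⟪ z ⟫)                          ≈⟨ D-* h (f ⟪ z ⟫) ⟩
    D h * x + h * D (f ⟪ z ⟫)                ≈⟨ +-congˡ (h *ˡ D-⟪⟫ {z} z0 f) ⟩
    D h * x + h * (D z * y)                  ≈⟨ +-congˡ (*-assoc h (D z) y) ⟨
    D h * x + h * D z * y                    ≈⟨ +-congˡ (p *ʳ y) ⟩
    D h * x + (z + z) * D h * y              ≈⟨ solve 4 (λ d x y z → d :* x :+ (z :+ z) :* d :* y := d :* (x :+ (z :* y :+ z :* y)))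
                                                  refl (D h) x y z ⟩
    D h * (x + (z * y + z * y))              ≈⟨ D h *ˡ +-congˡ (+-cong zy zy) ⟨
    D h * (x + ((var * D f) ⟪ z ⟫ + (var * D f) ⟪ z ⟫))
      ≈⟨ D h *ˡ trans (⟪⟫-+ f (var * D f + var * D f)) (+-congˡ (⟪⟫-+ (var * D f) (var * D f))) ⟨
    D h * (f + (var * D f + var * D f)) ⟪ z ⟫ ∎
    where
    open ≋-Reasoning
    open Composition {z} z0
    x y : Series
    x = f ⟪ z ⟫
    y = D f ⟪ z ⟫
    zy : (var * D f) ⟪ z ⟫ ≋ z * y
    zy = trans (⟪⟫-* var (D f)) (⟪⟫-var *ʳ y)

  -sq₀ : ∀ {h} → h 0 A.≈ A.0# → (- (h * h)) 0 A.≈ A.0#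
  -sq₀ {h} h0 = A.trans (A.-‿cong (*-zerothˡ {h} h h0)) (A.trans (A.sym (A.+-identityˡ _)) (A.-‿inverseʳ A.0#))

  -- Putting the alternating signs into the argument -h² leaves the hyperbolic coefficients `σ` and
  -- `γ`, which are the ones that the parity parts of the exponential series produce.
  sin cos : Series → Series
  sin h = h * σ ⟪ - (h * h) ⟫
  cos h = γ ⟪ - (h * h) ⟫

  D-neg-sq : ∀ h → D (- (h * h)) ≋ - (D h * h + h * D h)
  D-neg-sq h = trans (D-neg (h * h)) (-‿cong (D-* h h))

  D-sin : ∀ {h} → h 0 A.≈ A.0# → D (sin h) ≋ D h * cos h
  D-sin {h} h0 = trans
    (D-*⟪⟫ σ {h} { - (h * h)} (-sq₀ {h} h0) (trans (h *ˡ D-neg-sq h)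
      (solve 2 (λ h d → h :* (:- (d :* h :+ h :* d)) := (:- (h :* h) :+ :- (h :* h)) :* d) refl h (D h))))
    (D h *ˡ Composition.⟪⟫-congˡ { - (h * h)} (-sq₀ {h} h0) σ-ODE)

  D-cos : ∀ {h} → h 0 A.≈ A.0# → D (cos h) ≋ - (D h * sin h)
  D-cos {h} h0 = begin
    D (cos h)
      ≈⟨ D-⟪⟫ { - (h * h)} z0 γ ⟩
    D (- (h * h)) * y
      ≈⟨ D-neg-sq h *ʳ y ⟩
    - (D h * h + h * D h) * y
      ≈⟨ solve 3 (λ d h y → :- (d :* h :+ h :* d) :* y := :- (d :* (h :* (y :+ y)))) refl (D h) h y ⟩
    - (D h * (h * (y + y)))
      ≈⟨ -‿cong (D h *ˡ (h *ˡ trans (sym (⟪⟫-+ (D γ) (D γ))) (⟪⟫-congˡ γ-ODE))) ⟩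
    - (D h * sin h) ∎
    where
    open ≋-Reasoning
    z0 : (- (h * h)) 0 A.≈ A.0#
    z0 = -sq₀ {h} h0
    open Composition { - (h * h)} z0
    y : Series
    y = D γ ⟪ - (h * h) ⟫

  sin₀ : ∀ {h} → h 0 A.≈ A.0# → sin h 0 A.≈ A.0#
  sin₀ {h} h0 = *-zerothˡ {h} (σ ⟪ - (h * h) ⟫) h0

  cos₀ : ∀ {h} → h 0 A.≈ A.0# → cos h 0 A.≈ A.1#
  cos₀ {h} h0 = A.trans (Composition.⟪⟫-zeroth { - (h * h)} (-sq₀ {h} h0) γ) A.φ-1

-- The arcsine series

module CentralBinomials where
  open Rationals
  open RawSemiringDefs ℚ.+-*-rawSemiring using () renaming (_^_ to _^ℚ_)
  open ≡.≡-Reasoning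

  centralBinomial : ℕ → ℕ
  centralBinomial n = binomial (2 ℕ.* n) n

  centralBinomial-! : ∀ n → centralBinomial n ℕ.* (n ! ℕ.* n !) ≡ (2 ℕ.* n) !
  centralBinomial-! n = begin
    binomial (2 ℕ.* n) n ℕ.* (n ! ℕ.* n !)
      ≡⟨ ≡.cong (λ k → binomial (2 ℕ.* n) n ℕ.* (n ! ℕ.* k !)) 2n∸n≡n ⟨
    binomial (2 ℕ.* n) n ℕ.* d
      ≡⟨ ≡.cong (ℕ._* d) (nCk≡n!/k![n-k]! n≤2n) ⟩
    ((2 ℕ.* n) ! ℕ./ d) ℕ.* d
      ≡⟨ ℕ.m/n*n≡m (k![n∸k]!∣n! n≤2n) ⟩
    (2 ℕ.* n) ! ∎
    where
    d : ℕ
    d = n ! ℕ.* (2 ℕ.* n ℕ.∸ n) !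
    instance
      d≢0 : ℕ.NonZero d
      d≢0 = n !* (2 ℕ.* n ℕ.∸ n) !≢0
    n≤2n : n ℕ.≤ 2 ℕ.* n
    n≤2n = ℕ.m≤m+n n (n ℕ.+ 0)
    2n∸n≡n : 2 ℕ.* n ℕ.∸ n ≡ n
    2n∸n≡n = ≡.trans (ℕ.m+n∸m≡n n (n ℕ.+ 0)) (ℕ.+-identityʳ n)

  -- Multiplied by (n + 1)(n!)², both sides become (2n + 2)!.
  centralBinomial-suc : ∀ n → suc n ℕ.* centralBinomial (suc n) ≡ 2 ℕ.* suc (2 ℕ.* n) ℕ.* centralBinomial n
  centralBinomial-suc n = ℕ.*-cancelʳ-≡ _ _ (suc n ℕ.* (n ! ℕ.* n !)) {{ℕ.m*n≢0 (suc n) _ {{_}} {{n !* n !≢0}}}} (begin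
    suc n ℕ.* B′ ℕ.* (suc n ℕ.* (n ! ℕ.* n !))
      ≡⟨ solve 3 (λ m b f → m :* b :* (m :* (f :* f)) := b :* ((m :* f) :* (m :* f))) ≡.refl (suc n) B′ (n !) ⟩
    B′ ℕ.* (suc n ! ℕ.* suc n !)
      ≡⟨ centralBinomial-! (suc n) ⟩
    (2 ℕ.* suc n) !
      ≡⟨ ≡.cong _! (ℕ.*-suc 2 n) ⟩
    (2 ℕ.+ 2 ℕ.* n) ℕ.* (suc (2 ℕ.* n) ℕ.* (2 ℕ.* n) !)
      ≡⟨ ≡.cong (λ k → (2 ℕ.+ 2 ℕ.* n) ℕ.* (suc (2 ℕ.* n) ℕ.* k)) (centralBinomial-! n) ⟨
    (2 ℕ.+ 2 ℕ.* n) ℕ.* (suc (2 ℕ.* n) ℕ.* (B ℕ.* (n ! ℕ.* n !)))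
      ≡⟨ solve 3 (λ n b f → (con 2 :+ con 2 :* n) :* ((con 1 :+ con 2 :* n) :* (b :* (f :* f)))
           := con 2 :* (con 1 :+ con 2 :* n) :* b :* ((con 1 :+ n) :* (f :* f))) ≡.refl n B (n !) ⟩
    2 ℕ.* suc (2 ℕ.* n) ℕ.* B ℕ.* (suc n ℕ.* (n ! ℕ.* n !)) ∎)
    where
    open +-*-Solver
    B B′ : ℕ
    B  = centralBinomial n
    B′ = centralBinomial (suc n)

  -- (1 - T)^(-½) = Σ β n Tⁿ
  β : ℕ → ℚ
  β n = fromℕ (centralBinomial n) ℚ.* (+ 1 / 4) ^ℚ n

  β-suc : ∀ n → fromℕ (2 ℕ.* suc n) ℚ.* β (suc n) ≡ fromℕ (suc (2 ℕ.* n)) ℚ.* β n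
  β-suc n = begin
    fromℕ (2 ℕ.* suc n) ℚ.* (fromℕ B′ ℚ.* (¼ ℚ.* p))
      ≡⟨ solve 4 (λ m b q p → m :* (b :* (q :* p)) := (m :* b) :* q :* p) ≡.refl (fromℕ (2 ℕ.* suc n)) (fromℕ B′) ¼ p ⟩
    (fromℕ (2 ℕ.* suc n) ℚ.* fromℕ B′) ℚ.* ¼ ℚ.* p
      ≡⟨ ≡.cong (λ x → x ℚ.* ¼ ℚ.* p) (begin
           fromℕ (2 ℕ.* suc n) ℚ.* fromℕ B′               ≡⟨ fromℕ-* (2 ℕ.* suc n) B′ ⟨
           fromℕ (2 ℕ.* suc n ℕ.* B′)                      ≡⟨ ≡.cong fromℕ (ℕ.*-assoc 2 (suc n) B′) ⟩
           fromℕ (2 ℕ.* (suc n ℕ.* B′))                    ≡⟨ ≡.cong (λ k → fromℕ (2 ℕ.* k)) (centralBinomial-suc n) ⟩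
           fromℕ (2 ℕ.* (2 ℕ.* suc (2 ℕ.* n) ℕ.* B))      ≡⟨ ≡.cong (λ k → fromℕ (2 ℕ.* k)) (ℕ.*-assoc 2 (suc (2 ℕ.* n)) B) ⟩
           fromℕ (2 ℕ.* (2 ℕ.* (suc (2 ℕ.* n) ℕ.* B)))    ≡⟨ ≡.cong fromℕ (ℕ.*-assoc 2 2 (suc (2 ℕ.* n) ℕ.* B)) ⟨
           fromℕ (4 ℕ.* (suc (2 ℕ.* n) ℕ.* B))             ≡⟨ fromℕ-* 4 (suc (2 ℕ.* n) ℕ.* B) ⟩
           fromℕ 4 ℚ.* fromℕ (suc (2 ℕ.* n) ℕ.* B)         ≡⟨ ≡.cong (fromℕ 4 ℚ.*_) (fromℕ-* (suc (2 ℕ.* n)) B) ⟩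
           fromℕ 4 ℚ.* (fromℕ (suc (2 ℕ.* n)) ℚ.* fromℕ B) ∎) ⟩
    fromℕ 4 ℚ.* (fromℕ (suc (2 ℕ.* n)) ℚ.* fromℕ B) ℚ.* ¼ ℚ.* p
      ≡⟨ solve 3 (λ m b p → con (fromℕ 4) :* (m :* b) :* con ¼ :* p := m :* (b :* p)) ≡.refl (fromℕ (suc (2 ℕ.* n))) (fromℕ B) p ⟩
    fromℕ (suc (2 ℕ.* n)) ℚ.* (fromℕ B ℚ.* p) ∎
    where
    open RingSolver ℚ-algebra
    ¼ p : ℚ
    ¼ = + 1 / 4
    p = ¼ ^ℚ n
    B B′ : ℕ
    B  = centralBinomial n
    B′ = centralBinomial (suc n)

  arcsinCoeff : ℕ → ℚ
  arcsinCoeff n = (+ binomial (2 ℕ.* n) n / suc (2 ℕ.* n)) ℚ.* (+ 1 / 4) ^ℚ n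

  arcsinCoeff-β : ∀ n → fromℕ (suc (2 ℕ.* n)) ℚ.* arcsinCoeff n ≡ β n
  arcsinCoeff-β n = begin
    m ℚ.* (r ℚ.* p)                                       ≡⟨ solve 3 (λ m r p → m :* (r :* p) := (r :* m) :* p) ≡.refl m r p ⟩
    (r ℚ.* m) ℚ.* p                                       ≡⟨ ≡.cong (ℚ._* p) (/-*-fromℕ (+ centralBinomial n) (suc (2 ℕ.* n))) ⟩
    β n                                                   ∎
    where
    open RingSolver ℚ-algebra
    m r p : ℚ
    m = fromℕ (suc (2 ℕ.* n))
    r = + centralBinomial n / suc (2 ℕ.* n)
    p = (+ 1 / 4) ^ℚ n

module OddSeries {c ℓ} (A : ℚ-Algebra c ℓ) where
  private
    module A = ℚ-Algebra A
  open Derivative A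

  ^-double : ∀ f n → f ^ (2 ℕ.* n) ≋ (f * f) ^ n
  ^-double f zero    = refl
  ^-double f (suc n) = begin
    f ^ (2 ℕ.* suc n)        ≡⟨ ≡.cong (f ^_) (ℕ.*-suc 2 n) ⟩
    f * (f * f ^ (2 ℕ.* n))  ≈⟨ *-assoc f f (f ^ (2 ℕ.* n)) ⟨
    f * f * f ^ (2 ℕ.* n)    ≈⟨ (f * f) *ˡ ^-double f n ⟩
    f * f * (f * f) ^ n      ∎
    where open ≋-Reasoning

  Σ-odd-powers : ∀ a → (Σ≥0 λ n → a n • var ^ suc (2 ℕ.* n)) ≋ var * a ⟪ var * var ⟫
  Σ-odd-powers a = lift λ n → begin
    Σ≥0 (λ n → a n • var ^ suc (2 ℕ.* n))
      ≈⟨ Σ≥0≈partialSum terms-trunc n ⟩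
    partialSum (λ n → a n • var ^ suc (2 ℕ.* n)) n
      ≈⟨ reduce n (trans (partialSum-cong n terms) (partialSum-* var (λ i → a i • (var * var) ^ i) n)) ⟩
    var * partialSum (λ i → a i • (var * var) ^ i) n
      ≈⟨ *-cong-mod {var} {var} (Mod.refl n) (Σ≥0≈partialSum squares-trunc n) ⟨
    var * a ⟪ var * var ⟫ ∎
    where
    open module R {n} = Mod-Reasoning n
    terms : ∀ i → a i • var ^ suc (2 ℕ.* i) ≋ var * (a i • (var * var) ^ i)
    terms i = trans (*-•-swap var (a i) (var ^ (2 ℕ.* i))) (var *ˡ •-cong A.refl (^-double var i))
    squares-trunc : ∀ i → a i • (var * var) ^ i ≈[ i ] 0#
    squares-trunc i = Mod.trans i (•-trunc (a i) (^-trunc {var * var} (*-zerothˡ {var} var A.refl) i)) (reduce i (•-zeroʳ (a i)))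
    terms-trunc : ∀ i → a i • var ^ suc (2 ℕ.* i) ≈[ i ] 0#
    terms-trunc i = Mod.trans i (reduce i (terms i))
      (Mod.trans i (*-cong-mod {var} {var} (Mod.refl i) (squares-trunc i)) (reduce i (zeroʳ var)))

module ArcSine {c ℓ} (A : ℚ-Algebra c ℓ) where
  open Rationals
  private
    module A = ℚ-Algebra A
    module Q = Derivative ℚ-algebra
  module CB = CentralBinomials
  open Trig A public

  β κ : Series
  β n = A.φ (CB.β n)
  κ n = A.φ (CB.arcsinCoeff n)

  κ-ODE : κ + (var * D κ + var * D κ) ≋ β
  κ-ODE = coeffwise λ n → A.trans (1+2θ-coeff κ n) (nat-φ (suc (2 ℕ.* n)) (CB.arcsinCoeff-β n))

  β-ODE : D β + D β ≋ β + (var * D β + var * D β)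
  β-ODE = coeffwise λ n → begin
    D β n A.+ D β n                                       ≈⟨ A.distribʳ (β (suc n)) (nat (suc n)) (nat (suc n)) ⟨
    (nat (suc n) A.+ nat (suc n)) A.* β (suc n)           ≈⟨ A.*-congʳ (nat-even (suc n)) ⟨
    nat (2 ℕ.* suc n) A.* β (suc n)                       ≈⟨ nat-φ (2 ℕ.* suc n) (CB.β-suc n) ⟩
    A.φ (fromℕ (suc (2 ℕ.* n)) ℚ.* CB.β n)                ≈⟨ A.φ-* _ _ ⟩
    nat (suc (2 ℕ.* n)) A.* β n                           ≈⟨ 1+2θ-coeff β n ⟨
    (β + (var * D β + var * D β)) n                       ∎
    where open SetoidReasoning A.setoid

  -- By `β-ODE`, 2(1 - T)β′ = β, so the derivative of β²(1 - T) vanishes. This identifies β as (1 -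
  -- T)^(-½) without the binomial series for a fractional exponent.
  β²[1-T]≋1 : β * β * (1# - var) ≋ 1#
  β²[1-T]≋1 = D-unique
    (A.trans (*-zeroth (β * β) (1# - var)) (A.trans (A.*-cong (A.trans (*-zeroth β β) (A.*-cong A.φ-1 A.φ-1))
      (A.trans (A.+-congˡ -0#≈0#) (A.+-identityʳ _))) (A.trans (A.*-identityʳ _) (A.*-identityʳ _))))
    (begin
      D (β * β * (1# - var))
        ≈⟨ D-* (β * β) (1# - var) ⟩
      D (β * β) * (1# - var) + β * β * D (1# - var)
        ≈⟨ +-cong (D-* β β *ʳ (1# - var)) ((β * β) *ˡ trans (D-- 1# var) (+-cong D-1 (-‿cong D-var))) ⟩
      (D β * β + β * D β) * (1# - var) + β * β * (0# - 1#)
        ≈⟨ solve 3 (λ b d t → (d :* b :+ b :* d) :* (con 1ℚ :- t) :+ b :* b :* (con 0ℚ :- con 1ℚ)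
                         := b :* (d :+ d) :- b :* (b :+ (t :* d :+ t :* d))) refl β (D β) var ⟩
      β * (D β + D β) - β * (β + (var * D β + var * D β))
        ≈⟨ +-congʳ (β *ˡ β-ODE) ⟩
      β * (β + (var * D β + var * D β)) - β * (β + (var * D β + var * D β))
        ≈⟨ -‿inverseʳ (β * (β + (var * D β + var * D β))) ⟩
      0#
        ≈⟨ D-1 ⟨
      D 1# ∎)
    where
    open ≋-Reasoning
    open import Algebra.Properties.Ring A.ring using (-0#≈0#)

  x : Series
  x = const (A.φ ½) * var

  x₀ : x 0 A.≈ A.0#
  x₀ = A.trans (*-zeroth (const (A.φ ½)) var) (A.zeroʳ _)

  x+x≋var : x + x ≋ var
  x+x≋var = solve 1 (λ t → con ½ :* t :+ con ½ :* t := t) refl var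

  D-x : D x ≋ const (A.φ ½)
  D-x = trans (D-* (const (A.φ ½)) var) (trans (+-cong (D-const (A.φ ½) *ʳ var) (const (A.φ ½) *ˡ D-var))
    (solve 2 (λ t h → con 0ℚ :* t :+ h :* con 1ℚ := h) refl var (const (A.φ ½))))

  private
    var² : (var * var) 0 A.≈ A.0#
    var² = *-zerothˡ {var} var A.refl
    module V = Composition {var * var} var²
    module X = Composition {x} x₀

  asn : Series
  asn = var * κ ⟪ var * var ⟫

  D-asn : D asn ≋ β ⟪ var * var ⟫
  D-asn = begin
    D asn
      ≈⟨ D-*⟪⟫ κ {var} {var * var} var² (trans (var *ˡ D-* var var)
           (solve 2 (λ t d → t :* (d :* t :+ t :* d) := (t :* t :+ t :* t) :* d) refl var (D var))) ⟩
    D var * (κ + (var * D κ + var * D κ)) ⟪ var * var ⟫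
      ≈⟨ *-cong {D var} {1#} {(κ + (var * D κ + var * D κ)) ⟪ var * var ⟫} {β ⟪ var * var ⟫} D-var (V.⟪⟫-congˡ κ-ODE) ⟩
    1# * β ⟪ var * var ⟫
      ≈⟨ *-identityˡ (β ⟪ var * var ⟫) ⟩
    β ⟪ var * var ⟫ ∎
    where open ≋-Reasoning

  -- Since x = X/2 = sin(u/2), `w` is du/dX = 1/cos(u/2). The series `v` is cos(u/2) = √(1 - x²):
  -- multiplying w by 1 - x² produces it, because w²(1 - x²) = 1.
  u w v : Series
  u = ι 2arcsin[X/2]
  w = D u
  v = w * (1# - x * x)

  u≋ : u ≋ const (A.φ (+ 2 / 1)) * asn ⟪ x ⟫
  u≋ = begin
    u
      ≈⟨ ι-• (+ 2 / 1) (arcsinSeries Q.⟪ ½ Q.• Q.var ⟫) ⟩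
    A.φ (+ 2 / 1) • ι (arcsinSeries Q.⟪ ½ Q.• Q.var ⟫)
      ≈⟨ const-•≋* (A.φ (+ 2 / 1)) (ι (arcsinSeries Q.⟪ ½ Q.• Q.var ⟫)) ⟩
    const (A.φ (+ 2 / 1)) * ι (arcsinSeries Q.⟪ ½ Q.• Q.var ⟫)
      ≈⟨ const (A.φ (+ 2 / 1)) *ˡ ι-⟪⟫ arcsinSeries {½ Q.• Q.var} ≡.refl ⟩
    const (A.φ (+ 2 / 1)) * ι arcsinSeries ⟪ ι (½ Q.• Q.var) ⟫
      ≈⟨ const (A.φ (+ 2 / 1)) *ˡ ⟪⟫-cong {g = ι (½ Q.• Q.var)} {x} A.φ-0 ιasn
           (trans (ι-• ½ Q.var) (trans (•-cong A.refl ι-var) (const-•≋* (A.φ ½) var))) ⟩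
    const (A.φ (+ 2 / 1)) * asn ⟪ x ⟫ ∎
    where
    open ≋-Reasoning
    ιasn : ι arcsinSeries ≋ asn
    ιasn = begin
      ι arcsinSeries
        ≈⟨ ι-cong (OddSeries.Σ-odd-powers ℚ-algebra CB.arcsinCoeff) ⟩
      ι (Q.var Q.* CB.arcsinCoeff Q.⟪ Q.var Q.* Q.var ⟫)
        ≈⟨ ι-* Q.var (CB.arcsinCoeff Q.⟪ Q.var Q.* Q.var ⟫) ⟩
      ι Q.var * ι (CB.arcsinCoeff Q.⟪ Q.var Q.* Q.var ⟫)
        ≈⟨ *-cong {ι Q.var} {var} {ι (CB.arcsinCoeff Q.⟪ Q.var Q.* Q.var ⟫)} {κ ⟪ var * var ⟫} ι-var
             (trans (ι-⟪⟫ CB.arcsinCoeff {Q.var Q.* Q.var} ≡.refl)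
               (⟪⟫-cong {κ} {κ} {ι (Q.var Q.* Q.var)} {var * var} A.φ-0 refl
                 (trans (ι-* Q.var Q.var) (*-cong {ι Q.var} {var} {ι Q.var} {var} ι-var ι-var)))) ⟩
      asn ∎

  u₀ : u 0 A.≈ A.0#
  u₀ = A.trans (at u≋ 0) (A.trans (*-zeroth (const (A.φ (+ 2 / 1))) (asn ⟪ x ⟫)) (A.trans (A.*-congˡ
    (A.trans (X.⟪⟫-zeroth asn) (*-zerothˡ {var} (κ ⟪ var * var ⟫) A.refl))) (A.zeroʳ _)))

  w≋ : w ≋ β ⟪ var * var ⟫ ⟪ x ⟫
  w≋ = begin
    D u
      ≈⟨ D-cong u≋ ⟩
    D (const (A.φ (+ 2 / 1)) * asn ⟪ x ⟫)
      ≈⟨ D-* (const (A.φ (+ 2 / 1))) (asn ⟪ x ⟫) ⟩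
    D (const (A.φ (+ 2 / 1))) * asn ⟪ x ⟫ + const (A.φ (+ 2 / 1)) * D (asn ⟪ x ⟫)
      ≈⟨ +-cong (D-const (A.φ (+ 2 / 1)) *ʳ (asn ⟪ x ⟫)) (const (A.φ (+ 2 / 1)) *ˡ
           trans (D-⟪⟫ {x} x₀ asn) (*-cong {D x} {const (A.φ ½)} {D asn ⟪ x ⟫} {w₀} D-x (X.⟪⟫-congˡ D-asn))) ⟩
    0# * asn ⟪ x ⟫ + const (A.φ (+ 2 / 1)) * (const (A.φ ½) * w₀)
      ≈⟨ solve 2 (λ a w → con 0ℚ :* a :+ con (+ 2 / 1) :* (con ½ :* w) := w) refl (asn ⟪ x ⟫) w₀ ⟩
    w₀ ∎
    where
    open ≋-Reasoning
    w₀ : Series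
    w₀ = β ⟪ var * var ⟫ ⟪ x ⟫

  w²[1-x²]≋1 : w * w * (1# - x * x) ≋ 1#
  w²[1-x²]≋1 = begin
    w * w * (1# - x * x)
      ≈⟨ *-cong {w * w} {w₀ * w₀} {1# - x * x} {1# - x * x} (*-cong {w} {w₀} {w} {w₀} w≋ w≋) refl ⟩
    w₀ * w₀ * (1# - x * x)
      ≈⟨ *-cong {(b * b) ⟪ x ⟫} {w₀ * w₀} {(1# - var * var) ⟪ x ⟫} {1# - x * x} (X.⟪⟫-* b b) 1-x² ⟨
    (b * b) ⟪ x ⟫ * (1# - var * var) ⟪ x ⟫
      ≈⟨ X.⟪⟫-* (b * b) (1# - var * var) ⟨
    (b * b * (1# - var * var)) ⟪ x ⟫
      ≈⟨ X.⟪⟫-congˡ (begin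
           b * b * (1# - var * var)
             ≈⟨ *-cong {(β * β) ⟪ var * var ⟫} {b * b} {(1# - var) ⟪ var * var ⟫} {1# - var * var} (V.⟪⟫-* β β)
                  (trans (V.⟪⟫-- 1# var) (+-cong (V.⟪⟫-const A.1#) (-‿cong V.⟪⟫-var))) ⟨
           (β * β) ⟪ var * var ⟫ * (1# - var) ⟪ var * var ⟫
             ≈⟨ V.⟪⟫-* (β * β) (1# - var) ⟨
           (β * β * (1# - var)) ⟪ var * var ⟫
             ≈⟨ V.⟪⟫-congˡ β²[1-T]≋1 ⟩
           1# ⟪ var * var ⟫
             ≈⟨ V.⟪⟫-const A.1# ⟩
           1# ∎) ⟩
    1# ⟪ x ⟫
      ≈⟨ X.⟪⟫-const A.1# ⟩
    1# ∎
    where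
    open ≋-Reasoning
    b w₀ : Series
    b = β ⟪ var * var ⟫
    w₀ = b ⟪ x ⟫
    1-x² : (1# - var * var) ⟪ x ⟫ ≋ 1# - x * x
    1-x² = trans (X.⟪⟫-- 1# (var * var)) (+-cong (X.⟪⟫-const A.1#) (-‿cong
      (trans (X.⟪⟫-* var var) (*-cong {var ⟪ x ⟫} {x} {var ⟪ x ⟫} {x} X.⟪⟫-var X.⟪⟫-var))))

  wv≋1 : w * v ≋ 1#
  wv≋1 = trans (sym (*-assoc w w (1# - x * x))) w²[1-x²]≋1

  v²≋1-x² : v * v ≋ 1# - x * x
  v²≋1-x² = begin
    v * v                                            ≈⟨ solve 2 (λ w s → (w :* s) :* (w :* s) := w :* w :* s :* s) refl w (1# - x * x) ⟩
    w * w * (1# - x * x) * (1# - x * x)              ≈⟨ w²[1-x²]≋1 *ʳ (1# - x * x) ⟩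
    1# * (1# - x * x)                                ≈⟨ *-identityˡ (1# - x * x) ⟩
    1# - x * x                                       ∎
    where open ≋-Reasoning

-- Sines and cosines of multiples of u

module MultipleAngles {c ℓ} (A : ℚ-Algebra c ℓ) where
  private
    module A = ℚ-Algebra A
  open ArcSine A public
  open ≋-Reasoning

  D-x² : D (x * x) ≋ x
  D-x² = trans (D-* x x) (trans (+-cong (D-x *ʳ x) (x *ˡ D-x))
    (solve 1 (λ x → con ½ :* x :+ x :* con ½ := x) refl x))

  -- The double angle formula for cos u; correspondingly sin u = 2 sin(u/2) cos(u/2) is `var * v`.
  1-2x² : Series
  1-2x² = 1# - (x * x + x * x)

  D-1-2x² : D 1-2x² ≋ - (w * (var * v))
  D-1-2x² = begin
    D 1-2x²               ≈⟨ trans (D-- 1# (x * x + x * x)) (+-cong D-1 (-‿cong (trans (D-+ (x * x) (x * x)) (+-cong D-x² D-x²)))) ⟩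
    0# - (x + x)          ≈⟨ +-congˡ (-‿cong x+x≋var) ⟩
    0# - var              ≈⟨ solve 1 (λ t → con 0ℚ :- t := :- (con 1ℚ :* t)) refl var ⟩
    - (1# * var)          ≈⟨ -‿cong (wv≋1 *ʳ var) ⟨
    - (w * v * var)       ≈⟨ solve 3 (λ w v t → :- (w :* v :* t) := :- (w :* (t :* v))) refl w v var ⟩
    - (w * (var * v))     ∎

  D-var*v : D (var * v) ≋ w * 1-2x²
  D-var*v = begin
    D (var * v)
      ≈⟨ trans (D-* var v) (+-cong (trans (D-var *ʳ v) (*-identityˡ v)) (sym x+x≋var *ʳ D v)) ⟩
    v + (x + x) * D v
      -- Inserting 1 = w v turns the derivative of v into that of v² = 1 - x², which is known.
      ≈⟨ *-identityˡ (v + (x + x) * D v) ⟨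
    1# * (v + (x + x) * D v)
      ≈⟨ wv≋1 *ʳ (v + (x + x) * D v) ⟨
    w * v * (v + (x + x) * D v)
      ≈⟨ solve 4 (λ w v x d → w :* v :* (v :+ (x :+ x) :* d) := w :* (v :* v :+ x :* (d :* v :+ v :* d))) refl w v x (D v) ⟩
    w * (v * v + x * (D v * v + v * D v))
      ≈⟨ w *ˡ +-cong v²≋1-x² (x *ˡ trans (sym (D-* v v)) (trans (D-cong v²≋1-x²)
           (trans (D-- 1# (x * x)) (+-cong D-1 (-‿cong D-x²))))) ⟩
    w * ((1# - x * x) + x * (0# - x))
      ≈⟨ w *ˡ solve 1 (λ x → (con 1ℚ :- x :* x) :+ x :* (con 0ℚ :- x) := con 1ℚ :- (x :* x :+ x :* x)) refl x ⟩
    w * 1-2x² ∎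

  private
    var*v₀ : (var * v) 0 A.≈ A.0#
    var*v₀ = *-zerothˡ {var} v A.refl

    1-2x²₀ : 1-2x² 0 A.≈ A.1#
    1-2x²₀ = A.trans (A.+-congˡ (A.-‿cong (A.+-cong (*-zerothˡ {x} x x₀) (*-zerothˡ {x} x x₀))))
      (R.solve 0 (R.con 1ℚ R.:- (R.con 0ℚ R.:+ R.con 0ℚ) R.:= R.con 1ℚ) A.refl)
      where module R = RingSolver A

  -- Both pairs start at (0, 1) and satisfy s′ = w c and c′ = -w s.
  sin-cos-u : ∀ n → (sin u ≈[ n ] var * v) P.× (cos u ≈[ n ] 1-2x²)
  sin-cos-u = rotation-ODE-unique w {sin u} {cos u} {var * v} {1-2x²}
    (A.trans (sin₀ {u} u₀) (A.sym var*v₀)) (A.trans (cos₀ {u} u₀) (A.sym 1-2x²₀))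
    (D-sin {u} u₀) (D-cos {u} u₀) D-var*v D-1-2x²

  sin-u : sin u ≋ var * v
  sin-u = lift λ n → P.proj₁ (sin-cos-u n)

  cos-u : cos u ≋ 1-2x²
  cos-u = lift λ n → P.proj₂ (sin-cos-u n)

  nu : ℕ → Series
  nu n = const (nat n) * u

  nu₀ : ∀ n → nu n 0 A.≈ A.0#
  nu₀ n = A.trans (*-zeroth (const (nat n)) u) (A.trans (A.*-congˡ u₀) (A.zeroʳ _))

  D-nu : ∀ n → D (nu n) ≋ const (nat n) * w
  D-nu n = trans (D-* (const (nat n)) u) (trans (+-congʳ (D-const (nat n) *ʳ u))
    (solve 2 (λ u y → con 0ℚ :* u :+ y := y) refl u (const (nat n) * w)))

  S C : ℕ → Series
  S n = sin (nu n)
  C n = cos (nu n)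

  D-S : ∀ n → D (S n) ≋ const (nat n) * w * C n
  D-S n = trans (D-sin {nu n} (nu₀ n)) (D-nu n *ʳ C n)

  D-C : ∀ n → D (C n) ≋ - (const (nat n) * w * S n)
  D-C n = trans (D-cos {nu n} (nu₀ n)) (-‿cong (D-nu n *ʳ S n))

  const-nat-suc : ∀ n → const (nat (suc n)) ≋ 1# + const (nat n)
  const-nat-suc n = trans (const-cong (nat-suc n)) (const-+ _ _)

  -- The expressions on the right satisfy the rotation equations with angular velocity (n + 1) w,
  -- since nu contributes n w and u contributes w.
  angle-addition : ∀ n m → (S (suc n) ≈[ m ] S n * 1-2x² + C n * (var * v)) P.× (C (suc n) ≈[ m ] C n * 1-2x² - S n * (var * v))
  angle-addition n = rotation-ODE-unique (const (nat (suc n)) * w)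
    {S (suc n)} {C (suc n)} {S n * k + C n * s} {C n * k - S n * s}
    (A.trans (sin₀ {nu (suc n)} (nu₀ (suc n))) (A.sym (A.trans (A.+-cong
      (*-zerothˡ {S n} k (sin₀ {nu n} (nu₀ n))) (A.trans (*-zeroth (C n) s) (A.trans (A.*-congˡ var*v₀) (A.zeroʳ _)))) (A.+-identityʳ _))))
    (A.trans (cos₀ {nu (suc n)} (nu₀ (suc n))) (A.sym (A.trans (A.+-cong
      (A.trans (*-zeroth (C n) k) (A.trans (A.*-cong (cos₀ {nu n} (nu₀ n)) 1-2x²₀) (A.*-identityʳ _)))
      (A.-‿cong (*-zerothˡ {S n} s (sin₀ {nu n} (nu₀ n))))) (A.trans (A.+-congˡ -0#≈0#) (A.+-identityʳ _)))))
    (D-S (suc n)) (D-C (suc n))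
    (begin
      D (S n * k + C n * s)
        ≈⟨ trans (D-+ (S n * k) (C n * s)) (+-cong
             (trans (D-* (S n) k) (+-cong (D-S n *ʳ k) (S n *ˡ D-1-2x²)))
             (trans (D-* (C n) s) (+-cong (D-C n *ʳ s) (C n *ˡ D-var*v)))) ⟩
      (N * w * C n * k + S n * - (w * s)) + (- (N * w * S n) * s + C n * (w * k))
        ≈⟨ solve 6 (λ N w k s S C →
             (N :* w :* C :* k :+ S :* :- (w :* s)) :+ (:- (N :* w :* S) :* s :+ C :* (w :* k)) :=
             (con 1ℚ :+ N) :* w :* (C :* k :- S :* s)) refl N w k s (S n) (C n) ⟩
      (1# + N) * w * (C n * k - S n * s)
        ≈⟨ (const-nat-suc n *ʳ w) *ʳ (C n * k - S n * s) ⟨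
      const (nat (suc n)) * w * (C n * k - S n * s) ∎)
    (begin
      D (C n * k - S n * s)
        ≈⟨ trans (D-- (C n * k) (S n * s)) (+-cong
             (trans (D-* (C n) k) (+-cong (D-C n *ʳ k) (C n *ˡ D-1-2x²)))
             (-‿cong (trans (D-* (S n) s) (+-cong (D-S n *ʳ s) (S n *ˡ D-var*v))))) ⟩
      (- (N * w * S n) * k + C n * - (w * s)) - (N * w * C n * s + S n * (w * k))
        ≈⟨ solve 6 (λ N w k s S C →
             (:- (N :* w :* S) :* k :+ C :* :- (w :* s)) :- (N :* w :* C :* s :+ S :* (w :* k)) :=
             :- ((con 1ℚ :+ N) :* w :* (S :* k :+ C :* s))) refl N w k s (S n) (C n) ⟩
      - ((1# + N) * w * (S n * k + C n * s))
        ≈⟨ -‿cong ((const-nat-suc n *ʳ w) *ʳ (S n * k + C n * s)) ⟨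
      - (const (nat (suc n)) * w * (S n * k + C n * s)) ∎)
    where
    open import Algebra.Properties.Ring A.ring using (-0#≈0#)
    N k s : Series
    N = const (nat n)
    k = 1-2x²
    s = var * v

  -- The quotient sin(nu)/cos(u/2). In it the factor `w` cancels the square root in sin u = X v: the
  -- starting values 0 and X and the recurrence below contain no root, so each `t n` is a polynomial
  -- in X.
  t : ℕ → Series
  t n = w * S n

  t-zero : t 0 ≋ 0#
  t-zero = begin
    w * (const (nat 0) * u * y)  ≈⟨ w *ˡ ((const-cong A.φ-0 *ʳ u) *ʳ y) ⟩
    w * (0# * u * y)             ≈⟨ solve 3 (λ w u y → w :* (con 0ℚ :* u :* y) := con 0ℚ) refl w u y ⟩
    0#                           ∎
    where
    y : Series
    y = σ ⟪ - (nu 0 * nu 0) ⟫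

  t-one : t 1 ≋ var
  t-one = begin
    w * S 1            ≈⟨ w *ˡ lift (λ m → P.proj₁ (angle-addition 0 m)) ⟩
    w * (S 0 * 1-2x² + C 0 * (var * v))
      ≈⟨ solve 5 (λ w s k c y → w :* (s :* k :+ c :* y) := w :* s :* k :+ c :* (w :* y)) refl w (S 0) 1-2x² (C 0) (var * v) ⟩
    t 0 * 1-2x² + C 0 * (w * (var * v))
      ≈⟨ +-cong (t-zero *ʳ 1-2x²) (*-cong {C 0} {1#} {w * (var * v)} {var} C-zero
           (trans (solve 3 (λ w t v → w :* (t :* v) := w :* v :* t) refl w var v) (trans (wv≋1 *ʳ var) (*-identityˡ var)))) ⟩
    0# * 1-2x² + 1# * var
      ≈⟨ solve 2 (λ k t → con 0ℚ :* k :+ con 1ℚ :* t := t) refl 1-2x² var ⟩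
    var ∎
    where
    C-zero : C 0 ≋ 1#
    C-zero = D-unique (cos₀ {nu 0} (nu₀ 0)) (begin
      D (C 0)                       ≈⟨ D-C 0 ⟩
      - (const (nat 0) * w * S 0)   ≈⟨ -‿cong ((const-cong A.φ-0 *ʳ w) *ʳ S 0) ⟩
      - (0# * w * S 0)              ≈⟨ solve 2 (λ w s → :- (con 0ℚ :* w :* s) := con 0ℚ) refl w (S 0) ⟩
      0#                            ≈⟨ D-1 ⟨
      D 1#                          ∎)

  -- This is sin((n + 2)u) + sin(nu) = 2 cos(u) sin((n + 1)u) times `w`. Applying the addition
  -- theorem twice leaves 1 - sin²u, to be replaced by cos²u.
  t-recurrence : ∀ n → t (2 ℕ.+ n) + t n ≋ (1-2x² + 1-2x²) * t (suc n)
  t-recurrence n = begin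
    w * S (2 ℕ.+ n) + w * S n
      ≈⟨ +-congʳ (w *ˡ trans (lift (λ m → P.proj₁ (angle-addition (suc n) m)))
           (+-congˡ (lift (λ m → P.proj₂ (angle-addition n m)) *ʳ s))) ⟩
    w * (S (suc n) * k + (C n * k - S n * s) * s) + w * S n
      ≈⟨ solve 6 (λ w S′ S C k s → w :* (S′ :* k :+ (C :* k :- S :* s) :* s) :+ w :* S
           := w :* (S′ :* k :+ (C :* k :* s :+ (con 1ℚ :- s :* s) :* S))) refl w (S (suc n)) (S n) (C n) k s ⟩
    w * (S (suc n) * k + (C n * k * s + (1# - s * s) * S n))
      ≈⟨ w *ˡ +-congˡ (+-congˡ (pythagoras *ʳ S n)) ⟩
    w * (S (suc n) * k + (C n * k * s + k * k * S n))
      ≈⟨ solve 6 (λ w S′ S C k s → w :* (S′ :* k :+ (C :* k :* s :+ k :* k :* S)) := w :* (S′ :* k :+ k :* (S :* k :+ C :* s)))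
           refl w (S (suc n)) (S n) (C n) k s ⟩
    w * (S (suc n) * k + k * (S n * k + C n * s))
      ≈⟨ w *ˡ +-congˡ (k *ˡ lift (λ m → P.proj₁ (angle-addition n m))) ⟨
    w * (S (suc n) * k + k * S (suc n))
      ≈⟨ solve 3 (λ w S k → w :* (S :* k :+ k :* S) := (k :+ k) :* (w :* S)) refl w (S (suc n)) k ⟩
    (k + k) * t (suc n) ∎
    where
    k s : Series
    k = 1-2x²
    s = var * v
    pythagoras : 1# - s * s ≋ k * k
    pythagoras = begin
      1# - s * s                          ≈⟨ +-congˡ (-‿cong (solve 2 (λ t v → (t :* v) :* (t :* v) := t :* t :* (v :* v)) refl var v)) ⟩
      1# - var * var * (v * v)            ≈⟨ +-congˡ (-‿cong (*-cong {var * var} {(x + x) * (x + x)} {v * v} {1# - x * x}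
                                               (*-cong {var} {x + x} {var} {x + x} (sym x+x≋var) (sym x+x≋var)) v²≋1-x²)) ⟩
      1# - (x + x) * (x + x) * (1# - x * x)
        ≈⟨ solve 1 (λ x → con 1ℚ :- (x :+ x) :* (x :+ x) :* (con 1ℚ :- x :* x)
             := (con 1ℚ :- (x :* x :+ x :* x)) :* (con 1ℚ :- (x :* x :+ x :* x))) refl x ⟩
      k * k ∎

-- Bernoulli numbers and the cotangent

module Bernoulli {c ℓ} (A : ℚ-Algebra c ℓ) where
  private
    module A = ℚ-Algebra A
    module Q = Derivative ℚ-algebra
  open MultipleAngles A public
  open Parity A public
  open ≋-Reasoning

  -- b k = B_k / k!
  b : ℕ → ℚ
  b = Q.inverse ((expSeries Q.- Q.1#) Q./T)

  private
    d : Q.Series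
    d = (expSeries Q.- Q.1#) Q./T

    d-coeff : ∀ n → d n ≡ 1/[ suc n ]!
    d-coeff n = ℚ.+-identityʳ 1/[ suc n ]!

    ιd*ιb≋1 : ι d * ι b ≋ 1#
    ιd*ιb≋1 = trans (sym (ι-* d b)) (trans (ι-cong (Inverse.inverse-correct ℚ-algebra d ≡.refl)) ι-1)

    δ : Series
    δ = odd (ι d)

    even-d : even (ι d) ≋ σ
    even-d = coeffwise λ n → A.reflexive (≡.trans (even-coeff (ι d) n) (≡.cong A.φ (d-coeff (2 ℕ.* n))))

    -- The odd part of (e^T - 1)/T is (cosh T - 1)/T, and it equals T δ(T²).
    var*δ : var * δ ≋ γ - 1#
    var*δ = coeffwise λ
      { zero    → A.trans (*-zerothˡ {var} δ A.refl) (A.sym (A.trans (A.+-congʳ A.φ-1) (A.-‿inverseʳ A.1#)))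
      ; (suc n) → A.trans (var-*-suc δ n) (A.trans (A.reflexive (≡.trans (even-coeff (ι d /T) n)
          (≡.cong A.φ (≡.trans (d-coeff (suc (2 ℕ.* n))) (≡.cong 1/[_]! (≡.sym (ℕ.*-suc 2 n)))))))
          (A.sym (A.trans (A.+-congˡ -0#≈0#) (A.+-identityʳ _)))) }
      where open import Algebra.Properties.Ring A.ring using (-0#≈0#)

    even-1 : even 1# ≋ 1#
    even-1 = coeffwise λ { zero → A.refl ; (suc n) → A.reflexive (even-coeff (1# /T /T) n) }

    odd-1 : odd 1# ≋ 0#
    odd-1 = coeffwise λ n → A.reflexive (≡.trans (even-coeff (1# /T) n) (≡.sym (const-0 n)))

  -- e = Σ B₂ⱼ Tʲ / (2j)!
  e o : Series
  e = even (ι b)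
  o = odd (ι b)

  private
    even-eq : σ * e + var * (δ * o) ≋ 1#
    even-eq = trans (+-congʳ (sym even-d *ʳ e)) (trans (sym (even-* (ι d) (ι b))) (trans (even-cong ιd*ιb≋1) even-1))

    odd-eq : δ * e + σ * o ≋ 0#
    odd-eq = trans (+-congˡ (sym even-d *ʳ o)) (trans (sym (odd-* (ι d) (ι b))) (trans (odd-cong ιd*ιb≋1) odd-1))

    z : Series
    z = - (u * u)

    z₀ : z 0 A.≈ A.0#
    z₀ = -sq₀ {u} u₀

    open Composition {z} z₀

  -- K = (u/2) cot(u/2)
  K : Series
  K = e ⟪ - (u * u) ⟫

  -- Since X w = 2 tan(u/2), this says that K = (u/2) cot(u/2). The even and odd parts of `d` times
  -- `b` = 1, evaluated at T² = -u², are two linear equations `I` and `II` in K and O. Eliminating O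
  -- after multiplication by suitable factors gives K without a division by sin u.
  K-u : K * var * w ≋ u
  K-u = begin
    K * var * w           ≈⟨ Kvar≋uv *ʳ w ⟩
    u * v * w             ≈⟨ solve 3 (λ u v w → u :* v :* w := w :* v :* u) refl u v w ⟩
    w * v * u             ≈⟨ wv≋1 *ʳ u ⟩
    1# * u                ≈⟨ *-identityˡ u ⟩
    u                     ∎
    where
    O Δ Σ : Series
    O = o ⟪ z ⟫
    Δ = δ ⟪ z ⟫
    Σ = σ ⟪ z ⟫
    x² : Series
    x² = x * x
    zΔ : z * Δ ≋ - (x² + x²)
    zΔ = begin
      z * Δ                 ≈⟨ ⟪⟫-var *ʳ Δ ⟨
      var ⟪ z ⟫ * Δ         ≈⟨ ⟪⟫-* var δ ⟨
      (var * δ) ⟪ z ⟫       ≈⟨ ⟪⟫-congˡ var*δ ⟩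
      (γ - 1#) ⟪ z ⟫        ≈⟨ trans (⟪⟫-- γ 1#) (+-cong cos-u (-‿cong (⟪⟫-const A.1#))) ⟩
      1-2x² - 1#            ≈⟨ solve 1 (λ y → con 1ℚ :- y :- con 1ℚ := :- y) refl (x² + x²) ⟩
      - (x² + x²)           ∎
    I : Σ * K + z * (Δ * O) ≋ 1#
    I = begin
      Σ * K + z * (Δ * O)
        ≈⟨ +-cong (⟪⟫-* σ e) (trans (⟪⟫-* var (δ * o)) (*-cong {var ⟪ z ⟫} {z} {(δ * o) ⟪ z ⟫} {Δ * O} ⟪⟫-var (⟪⟫-* δ o))) ⟨
      (σ * e) ⟪ z ⟫ + (var * (δ * o)) ⟪ z ⟫
        ≈⟨ ⟪⟫-+ (σ * e) (var * (δ * o)) ⟨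
      (σ * e + var * (δ * o)) ⟪ z ⟫
        ≈⟨ trans (⟪⟫-congˡ even-eq) (⟪⟫-const A.1#) ⟩
      1# ∎
    II : Δ * K + Σ * O ≋ 0#
    II = begin
      Δ * K + Σ * O                   ≈⟨ +-cong (⟪⟫-* δ e) (⟪⟫-* σ o) ⟨
      (δ * e) ⟪ z ⟫ + (σ * o) ⟪ z ⟫   ≈⟨ ⟪⟫-+ (δ * e) (σ * o) ⟨
      (δ * e + σ * o) ⟪ z ⟫           ≈⟨ trans (⟪⟫-congˡ odd-eq) ⟪⟫-0 ⟩
      0#                              ∎
    I′ : var * v * K - (x² + x²) * O * u ≋ u
    I′ = begin
      var * v * K - (x² + x²) * O * u
        ≈⟨ solve 5 (λ s K y O u → s :* K :- y :* O :* u := s :* K :+ :- y :* O :* u) refl (var * v) K (x² + x²) O u ⟩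
      var * v * K + - (x² + x²) * O * u
        ≈⟨ +-cong (sin-u *ʳ K) ((zΔ *ʳ O) *ʳ u) ⟨
      u * Σ * K + z * Δ * O * u
        ≈⟨ solve 6 (λ u Σ K z Δ O → u :* Σ :* K :+ z :* Δ :* O :* u := u :* (Σ :* K :+ z :* (Δ :* O))) refl u Σ K z Δ O ⟩
      u * (Σ * K + z * (Δ * O))
        ≈⟨ trans (u *ˡ I) (*-identityʳ u) ⟩
      u ∎
    II′ : O * u * v ≋ - (x * K)
    II′ = var*-cancel (begin
      var * (O * u * v)
        ≈⟨ solve 4 (λ t O u v → t :* (O :* u :* v) := O :* u :* (t :* v)) refl var O u v ⟩
      O * u * (var * v)
        ≈⟨ (O * u) *ˡ sin-u ⟨
      O * u * (u * Σ)
        -- As z = -u², the left side is z Δ K minus z times the left side of `II`; what remains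
        -- contains Δ only through z Δ = cos u - 1.
        ≈⟨ solve 5 (λ u Σ K Δ O → O :* u :* (u :* Σ) := :- (u :* u) :* Δ :* K :- :- (u :* u) :* (Δ :* K :+ Σ :* O)) refl u Σ K Δ O ⟩
      z * Δ * K - z * (Δ * K + Σ * O)
        ≈⟨ +-cong (zΔ *ʳ K) (-‿cong (z *ˡ II)) ⟩
      - (x² + x²) * K - z * 0#
        ≈⟨ solve 3 (λ x K z → :- (x :* x :+ x :* x) :* K :- z :* con 0ℚ := (x :+ x) :* :- (x :* K)) refl x K z ⟩
      (x + x) * - (x * K)
        ≈⟨ x+x≋var *ʳ (- (x * K)) ⟩
      var * - (x * K) ∎)
    Kvar≋uv : K * var ≋ u * v
    Kvar≋uv = begin
      K * var
        ≈⟨ K *ˡ x+x≋var ⟨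
      K * (x + x)
        -- Writing 1 = (1 - x²) + x² makes the first part a multiple of v², while `II′` turns the
        -- second back into O, so that `I′` applies.
        ≈⟨ solve 2 (λ K x → K :* (x :+ x) := (x :+ x) :* (con 1ℚ :- x :* x) :* K :- (x :* x :+ x :* x) :* :- (x :* K)) refl K x ⟩
      (x + x) * (1# - x²) * K - (x² + x²) * - (x * K)
        ≈⟨ +-cong (*-cong {x + x} {var} {1# - x²} {v * v} x+x≋var (sym v²≋1-x²) *ʳ K) (-‿cong ((x² + x²) *ˡ sym II′)) ⟩
      var * (v * v) * K - (x² + x²) * (O * u * v)
        ≈⟨ solve 6 (λ t v K y O u → t :* (v :* v) :* K :- y :* (O :* u :* v) := (t :* v :* K :- y :* O :* u) :* v) refl var v K (x² + x²) O u ⟩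
      (var * v * K - (x² + x²) * O * u) * v
        ≈⟨ I′ *ʳ v ⟩
      u * v ∎

-- Logarithmic derivatives of the factors

module Core {c ℓ} (A : ℚ-Algebra c ℓ) where
  private
    module A = ℚ-Algebra A
  open RawSemiringDefs (RawRing.rawSemiring A.rawRing) using () renaming (_^_ to _^ᴬ_)
  open Bernoulli A public
  open ≋-Reasoning

  [_]_ : Bool → Series → Series
  [ true  ] f = f
  [ false ] f = 0#

  []-cong : ∀ b {f g} → f ≋ g → [ b ] f ≋ [ b ] g
  []-cong true  p = p
  []-cong false p = refl

  []-* : ∀ b f g → [ b ] (f * g) ≋ f * [ b ] g
  []-* true  f g = refl
  []-* false f g = sym (zeroʳ f)

  product : (ℕ → Series) → ℕ → Series
  product f zero    = 1#
  product f (suc n) = product f n * f n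

  D-product : ∀ {f h} → (∀ i → D (f i) ≋ h i * f i) → ∀ n → D (product f n) ≋ partialSum h n * product f n
  D-product {f} {h} p zero    = trans D-1 (sym (zeroˡ 1#))
  D-product {f} {h} p (suc n) = begin
    D (P * f n)                             ≈⟨ D-* P (f n) ⟩
    D P * f n + P * D (f n)                 ≈⟨ +-cong (D-product {f} {h} p n *ʳ f n) (P *ˡ p n) ⟩
    H * P * f n + P * (h n * f n)           ≈⟨ solve 4 (λ H P f h → H :* P :* f :+ P :* (h :* f) := (H :+ h) :* (P :* f)) refl H P (f n) (h n) ⟩
    (H + h n) * (P * f n)                   ≈⟨ partialSum-suc h n *ʳ (P * f n) ⟨
    partialSum h (suc n) * (P * f n)        ∎
    where
    H P : Series
    H = partialSum h n
    P = product f n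

  k : Series
  k = 1-2x²

  τ : ℕ → Series
  τ n = t n + t n

  lambert : A.Carrier → ℕ → Series
  lambert Q n = partialSum (λ i → const (Q ^ᴬ i) * τ i) n

  -- The generating function of the Chebyshev-type sequence τ, cut off after n + 1 terms.
  lambert-telescope : ∀ Q n → (1# - (k + k) * const Q + const Q * const Q) * lambert Q (suc n)
    ≋ (var + var) * const Q - const Q * const (Q ^ᴬ n) * τ (suc n) + const Q * const Q * const (Q ^ᴬ n) * τ n
  lambert-telescope Q zero = begin
    L * (const A.1# * τ 0 + 0#)
      ≈⟨ L *ˡ +-congʳ (1# *ˡ τ-zero) ⟩
    L * (1# * 0# + 0#)
      ≈⟨ solve 3 (λ L q t → L :* (con 1ℚ :* con 0ℚ :+ con 0ℚ) := (t :+ t) :* q :- q :* con 1ℚ :* (t :+ t) :+ q :* q :* con 1ℚ :* con 0ℚ)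
           refl L q var ⟩
    (var + var) * q - q * 1# * (var + var) + q * q * 1# * 0#
      ≈⟨ +-cong (+-congˡ (-‿cong ((q * 1#) *ˡ +-cong t-one t-one))) ((q * q * 1#) *ˡ τ-zero) ⟨
    (var + var) * q - q * 1# * τ 1 + q * q * 1# * τ 0 ∎
    where
    q L : Series
    q = const Q
    L = 1# - (k + k) * q + q * q
    τ-zero : τ 0 ≋ 0#
    τ-zero = trans (+-cong t-zero t-zero) (+-identityʳ 0#)
  lambert-telescope Q (suc n) = begin
    L * lambert Q (2 ℕ.+ n)
      ≈⟨ trans (L *ˡ partialSum-suc (λ i → const (Q ^ᴬ i) * τ i) (suc n)) (distribˡ L (lambert Q (suc n)) _) ⟩
    L * lambert Q (suc n) + L * (const (Q A.* Q ^ᴬ n) * τ (suc n))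
      ≈⟨ +-cong (lambert-telescope Q n) (L *ˡ (const-* Q (Q ^ᴬ n) *ʳ τ (suc n))) ⟩
    ((var + var) * q - q * p * τ (suc n) + q * q * p * τ n) + L * (q * p * τ (suc n))
      ≈⟨ solve 6 (λ v q p t₁ t₀ k → ((v :+ v) :* q :- q :* p :* t₁ :+ q :* q :* p :* t₀)
             :+ (con 1ℚ :- (k :+ k) :* q :+ q :* q) :* (q :* p :* t₁)
           := (v :+ v) :* q :- q :* (q :* p) :* ((k :+ k) :* t₁ :- t₀) :+ q :* q :* (q :* p) :* t₁)
           refl var q p (τ (suc n)) (τ n) k ⟩
    (var + var) * q - q * (q * p) * ((k + k) * τ (suc n) - τ n) + q * q * (q * p) * τ (suc n)
      ≈⟨ +-cong (+-congˡ (-‿cong ((q * (q * p)) *ˡ τ-recurrence))) refl ⟩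
    (var + var) * q - q * (q * p) * τ (2 ℕ.+ n) + q * q * (q * p) * τ (suc n)
      ≈⟨ +-cong (+-congˡ (-‿cong ((q *ˡ const-* Q (Q ^ᴬ n)) *ʳ τ (2 ℕ.+ n)))) (((q * q) *ˡ const-* Q (Q ^ᴬ n)) *ʳ τ (suc n)) ⟨
    (var + var) * q - q * const (Q ^ᴬ suc n) * τ (2 ℕ.+ n) + q * q * const (Q ^ᴬ suc n) * τ (suc n) ∎
    where
    q p L : Series
    q = const Q
    p = const (Q ^ᴬ n)
    L = 1# - (k + k) * q + q * q
    τ-recurrence : (k + k) * τ (suc n) - τ n ≋ τ (2 ℕ.+ n)
    τ-recurrence = begin
      (k + k) * (t (suc n) + t (suc n)) - (t n + t n)
        ≈⟨ solve 3 (λ k t₁ t₀ → (k :+ k) :* (t₁ :+ t₁) :- (t₀ :+ t₀) := (k :+ k) :* t₁ :- t₀ :+ ((k :+ k) :* t₁ :- t₀)) refl k (t (suc n)) (t n) ⟩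
      (k + k) * t (suc n) - t n + ((k + k) * t (suc n) - t n)
        ≈⟨ +-cong next next ⟩
      t (2 ℕ.+ n) + t (2 ℕ.+ n) ∎
      where
      next : (k + k) * t (suc n) - t n ≋ t (2 ℕ.+ n)
      next = trans (+-congʳ (sym (t-recurrence n))) (solve 2 (λ a b → a :+ b :- b := a) refl (t (2 ℕ.+ n)) (t n))

  factor : A.Carrier → Series
  factor a = 1# + const a * (var * var)

  -- Q ↦ a is x ↦ x/(1-x)², and factor a = (1-2 cos(u) Q + Q²)/(1-Q)².
  D-factor : ∀ {Q a r n} → (A.1# A.- Q) A.* (A.1# A.- Q) A.* r A.≈ A.1# → a A.≈ Q A.* r → Q ^ᴬ n A.≈ A.0# →
             D (factor a) ≋ lambert Q (suc n) * factor a
  D-factor {Q} {a} {r} {n} inv a≈ nil = begin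
    D (factor a)
      ≈⟨ trans (D-+ 1# (const a * (var * var))) (+-cong D-1 (trans (D-* (const a) (var * var))
           (+-cong (D-const a *ʳ (var * var)) (const a *ˡ trans (D-* var var) (+-cong (D-var *ʳ var) (var *ˡ D-var)))))) ⟩
    0# + (0# * (var * var) + const a * (1# * var + var * 1#))
      ≈⟨ solve 2 (λ a v → con 0ℚ :+ (con 0ℚ :* (v :* v) :+ a :* (con 1ℚ :* v :+ v :* con 1ℚ)) := (v :+ v) :* a) refl (const a) var ⟩
    (var + var) * const a
      ≈⟨ (var + var) *ˡ trans (const-cong a≈) (const-* Q r) ⟩
    (var + var) * (q * ρ)
      -- The two zeros make room for the boundary terms of the cut-off sum, which vanish because Qⁿ
      -- = 0.
      ≈⟨ solve 3 (λ v q ρ → (v :+ v) :* (q :* ρ) := ((v :+ v) :* q :- q :* con 0ℚ :+ q :* q :* con 0ℚ) :* ρ) refl var q ρ ⟩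
    ((var + var) * q - q * 0# + q * q * 0#) * ρ
      ≈⟨ +-cong (+-congˡ {(var + var) * q} (-‿cong (vanish q (τ (suc n))))) (vanish (q * q) (τ n)) *ʳ ρ ⟨
    ((var + var) * q - q * const (Q ^ᴬ n) * τ (suc n) + q * q * const (Q ^ᴬ n) * τ n) * ρ
      ≈⟨ lambert-telescope Q n *ʳ ρ ⟨
    (1# - (k + k) * q + q * q) * h * ρ
      -- With cos u = 1 - 2x² and X = 2x, one has 1 - 2 cos(u) q + q² = (1 - q)² + q X²; here ρ
      -- stands for 1/(1 - q)².
      ≈⟨ solve 4 (λ x q h ρ → (con 1ℚ :- ((con 1ℚ :- (x :* x :+ x :* x)) :+ (con 1ℚ :- (x :* x :+ x :* x))) :* q :+ q :* q) :* h :* ρ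
           := h :* ((con 1ℚ :- q) :* (con 1ℚ :- q) :* ρ :+ q :* ρ :* ((x :+ x) :* (x :+ x)))) refl x q h ρ ⟩
    h * ((1# - q) * (1# - q) * ρ + q * ρ * ((x + x) * (x + x)))
      ≈⟨ h *ˡ +-cong unit (*-cong {q * ρ} {const a} {(x + x) * (x + x)} {var * var} (sym (trans (const-cong a≈) (const-* Q r)))
           (*-cong {x + x} {var} {x + x} {var} x+x≋var x+x≋var)) ⟩
    h * factor a ∎
    where
    q ρ h : Series
    q = const Q
    ρ = const r
    h = lambert Q (suc n)
    vanish : ∀ f g → f * const (Q ^ᴬ n) * g ≋ f * 0#
    vanish f g = trans ((f *ˡ const-cong nil) *ʳ g) (solve 2 (λ f g → f :* con 0ℚ :* g := f :* con 0ℚ) refl f g)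
    1-q : 1# - q ≋ const (A.1# A.- Q)
    1-q = sym (trans (const-+ A.1# (A.- Q)) (+-congˡ (const-neg Q)))
    unit : (1# - q) * (1# - q) * ρ ≋ 1#
    unit = begin
      (1# - q) * (1# - q) * ρ
        ≈⟨ *-cong {1# - q} {const (A.1# A.- Q)} {1# - q} {const (A.1# A.- Q)} 1-q 1-q *ʳ ρ ⟩
      const (A.1# A.- Q) * const (A.1# A.- Q) * ρ
        ≈⟨ const-* (A.1# A.- Q) (A.1# A.- Q) *ʳ ρ ⟨
      const ((A.1# A.- Q) A.* (A.1# A.- Q)) * ρ
        ≈⟨ const-* ((A.1# A.- Q) A.* (A.1# A.- Q)) r ⟨
      const ((A.1# A.- Q) A.* (A.1# A.- Q) A.* r)
        ≈⟨ const-cong inv ⟩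
      1# ∎

  -- The series f(aT). Taken with a = i², it brings the power i^(2j) of a divisor sum into the j-th
  -- coefficient.
  scale : A.Carrier → Series → Series
  scale a f n = a ^ᴬ n A.* f n

  scale-⟪⟫ : ∀ a f {g} → g 0 A.≈ A.0# → scale a f ⟪ g ⟫ ≋ f ⟪ const a * g ⟫
  scale-⟪⟫ a f {g} g0 = lift λ n → go n f
    where
    ag0 : (const a * g) 0 A.≈ A.0#
    ag0 = A.trans (*-zeroth (const a) g) (A.trans (A.*-congˡ g0) (A.zeroʳ _))
    module G = Composition {g} g0
    go : ∀ n f → scale a f ⟪ g ⟫ ≈[ n ] f ⟪ const a * g ⟫
    go zero    f = zero-trunc
    go (suc n) f = Mod.trans (suc n) (reduce (suc n) (trans (⟪⟫-unfold {g} (scale a f) g0)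
        (+-congˡ (g *ˡ trans (G.⟪⟫-congˡ (coeffwise λ i → A.*-assoc a (a ^ᴬ i) (f (suc i)))) (G.⟪⟫-• a (scale a (f /T)))))))
      (Mod.trans (suc n) (unfold-step {g} g0 (A.*-identityˡ (f 0)) (*-cong-mod {const a} {const a} (Mod.refl n) (go n (f /T))))
        (reduce (suc n) (trans (+-congˡ (solve 3 (λ g a y → g :* (a :* y) := a :* g :* y) refl g (const a) (f /T ⟪ const a * g ⟫)))
          (sym (⟪⟫-unfold {const a * g} f ag0)))))

module Signs where
  open Rationals
  open ≡.≡-Reasoning

  sign : ℕ → ℚ
  sign i = fromℤ (-1ℤ ^ℤ i)

  sign-suc : ∀ i → sign (suc i) ≡ ℚ.- 1ℚ ℚ.* sign i
  sign-suc i = fromℤ-* -1ℤ (-1ℤ ^ℤ i)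

  sign² : ∀ i → sign i ℚ.* sign i ≡ 1ℚ
  sign² zero    = ≡.refl
  sign² (suc i) = begin
    sign (suc i) ℚ.* sign (suc i)                          ≡⟨ ≡.cong₂ ℚ._*_ (sign-suc i) (sign-suc i) ⟩
    (ℚ.- 1ℚ ℚ.* sign i) ℚ.* (ℚ.- 1ℚ ℚ.* sign i)            ≡⟨ solve 1 (λ s → (:- con 1ℚ :* s) :* (:- con 1ℚ :* s) := s :* s) ≡.refl (sign i) ⟩
    sign i ℚ.* sign i                                      ≡⟨ sign² i ⟩
    1ℚ                                                     ∎
    where open RingSolver ℚ-algebra

  -- Three factors meet when the exponent is differentiated in z = -u²: the given (-1)^i/(i + 1),
  -- the sign (-1)^(i+1) from expressing u^(2i+2) by z, and i + 1 from the derivative. Their product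
  -- does not depend on i.
  sign-/ : ∀ i → fromℕ (suc i) ℚ.* (sign (suc i) ℚ.* (-1ℤ ^ℤ i / suc i)) ≡ ℚ.- 1ℚ
  sign-/ i = begin
    fromℕ (suc i) ℚ.* (sign (suc i) ℚ.* r)      ≡⟨ solve 3 (λ n s r → n :* (s :* r) := s :* (r :* n)) ≡.refl (fromℕ (suc i)) (sign (suc i)) r ⟩
    sign (suc i) ℚ.* (r ℚ.* fromℕ (suc i))      ≡⟨ ≡.cong₂ ℚ._*_ (sign-suc i) (/-*-fromℕ (-1ℤ ^ℤ i) (suc i)) ⟩
    (ℚ.- 1ℚ ℚ.* sign i) ℚ.* sign i              ≡⟨ ℚ.*-assoc (ℚ.- 1ℚ) (sign i) (sign i) ⟩
    ℚ.- 1ℚ ℚ.* (sign i ℚ.* sign i)              ≡⟨ ≡.cong (ℚ.- 1ℚ ℚ.*_) (sign² i) ⟩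
    ℚ.- 1ℚ                                      ∎
    where
    open RingSolver ℚ-algebra
    r : ℚ
    r = -1ℤ ^ℤ i / suc i

-- The exponent as a series in -u²

module Exponent {c ℓ} (A : ℚ-Algebra c ℓ) where
  open Signs
  private
    module A = ℚ-Algebra A
  open RawSemiringDefs (RawRing.rawSemiring A.rawRing) using () renaming (_^_ to _^ᴬ_)
  open Core A public
  open ≋-Reasoning

  z : Series
  z = - (u * u)

  z₀ : z 0 A.≈ A.0#
  z₀ = -sq₀ {u} u₀

  private
    module Z = Composition {z} z₀

  module _ {g : Series} (g0 : g 0 A.≈ A.0#) where
    open Composition {g} g0

    partialSum-⟪⟫ : ∀ f n → partialSum f n ⟪ g ⟫ ≋ partialSum (λ i → f i ⟪ g ⟫) n
    partialSum-⟪⟫ f zero    = ⟪⟫-0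
    partialSum-⟪⟫ f (suc n) = trans (⟪⟫-+ (f 0) (partialSum (f ∘ suc) n)) (+-congˡ (partialSum-⟪⟫ (f ∘ suc) n))

    []-⟪⟫ : ∀ b f → ([ b ] f) ⟪ g ⟫ ≋ [ b ] (f ⟪ g ⟫)
    []-⟪⟫ true  f = refl
    []-⟪⟫ false f = ⟪⟫-0

    product-⟪⟫ : ∀ f n → product f n ⟪ g ⟫ ≋ product (λ i → f i ⟪ g ⟫) n
    product-⟪⟫ f zero    = ⟪⟫-const A.1#
    product-⟪⟫ f (suc n) = trans (⟪⟫-* (product f n) (f n)) (product-⟪⟫ f n *ʳ (f n ⟪ g ⟫))

  product-cong : ∀ {f g} → (∀ i → f i ≋ g i) → ∀ n → product f n ≋ product g n
  product-cong         p zero    = refl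
  product-cong {f} {g} p (suc n) = *-cong {product f n} {product g n} {f n} {g n} (product-cong p n) (p n)

  product-zeroth : ∀ {f} → (∀ i → f i 0 A.≈ A.1#) → ∀ n → product f n 0 A.≈ A.1#
  product-zeroth     p zero    = A.refl
  product-zeroth {f} p (suc n) = A.trans (*-zeroth (product f n) (f n))
    (A.trans (A.*-cong (product-zeroth p n) (p n)) (A.*-identityʳ A.1#))

  -- The part Σ_{i<n} i^(2j+1) Qⁱ / (2j+1)! of the Eisenstein series of weight 2j+2.
  divisorSeries : A.Carrier → ℕ → Series
  divisorSeries Q n = partialSum (λ i → const (Q ^ᴬ i) * (const (nat i) * scale (nat i A.* nat i) σ)) n

  -- The index of the series counts the weights, so substituting z sums over all weights at once:
  -- i^(2j+1) z^j/(2j+1)! adds up to i σ(-(iu)²), and multiplication by u makes this sin(iu).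
  divisorSeries-lambert : ∀ Q n → (u + u) * w * divisorSeries Q n ⟪ z ⟫ ≋ lambert Q n
  divisorSeries-lambert Q n = begin
    m * divisorSeries Q n ⟪ z ⟫
      ≈⟨ m *ˡ partialSum-⟪⟫ {z} z₀ (λ i → const (Q ^ᴬ i) * (const (nat i) * scale (nat i A.* nat i) σ)) n ⟩
    m * partialSum (λ i → (const (Q ^ᴬ i) * (const (nat i) * scale (nat i A.* nat i) σ)) ⟪ z ⟫) n
      ≈⟨ partialSum-* m (λ i → (const (Q ^ᴬ i) * (const (nat i) * scale (nat i A.* nat i) σ)) ⟪ z ⟫) n ⟨
    partialSum (λ i → m * (const (Q ^ᴬ i) * (const (nat i) * scale (nat i A.* nat i) σ)) ⟪ z ⟫) n
      ≈⟨ partialSum-cong n term ⟩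
    lambert Q n ∎
    where
    m : Series
    m = (u + u) * w
    term : ∀ i → m * (const (Q ^ᴬ i) * (const (nat i) * scale (nat i A.* nat i) σ)) ⟪ z ⟫ ≋ const (Q ^ᴬ i) * τ i
    term i = begin
      m * (p * (N * s)) ⟪ z ⟫
        ≈⟨ m *ˡ trans (Z.⟪⟫-* p (N * s)) (*-cong {p ⟪ z ⟫} {p} {(N * s) ⟪ z ⟫} {N * y} (Z.⟪⟫-const (Q ^ᴬ i))
             (trans (Z.⟪⟫-* N s) (*-cong {N ⟪ z ⟫} {N} {s ⟪ z ⟫} {y} (Z.⟪⟫-const (nat i)) s⟪z⟫))) ⟩
      m * (p * (N * y))
        ≈⟨ solve 5 (λ u w p N y → (u :+ u) :* w :* (p :* (N :* y)) := p :* (w :* (N :* u :* y) :+ w :* (N :* u :* y))) refl u w p N y ⟩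
      p * τ i ∎
      where
      p N s y : Series
      p = const (Q ^ᴬ i)
      N = const (nat i)
      s = scale (nat i A.* nat i) σ
      y = σ ⟪ - (nu i * nu i) ⟫
      n²z : const (nat i A.* nat i) * z ≋ - (nu i * nu i)
      n²z = trans (const-* (nat i) (nat i) *ʳ z) (solve 2 (λ N u → N :* N :* :- (u :* u) := :- ((N :* u) :* (N :* u))) refl N u)
      s⟪z⟫ : s ⟪ z ⟫ ≋ y
      s⟪z⟫ = trans (scale-⟪⟫ (nat i A.* nat i) σ {z} z₀) (⟪⟫-cong {σ} {σ} {const (nat i A.* nat i) * z} { - (nu i * nu i)}
        (A.trans (*-zeroth (const (nat i A.* nat i)) z) (A.trans (A.*-congˡ z₀) (A.zeroʳ _))) refl n²z)

  -- Σ_{j≥1} c_j u^(2j) as a power series in -u²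
  module _ {c : ℕ → A.Carrier} {g : Series} (c-g : ∀ i → c i A.≈ A.φ (-1ℤ ^ℤ i / suc i) A.* g i) where

    exponent : Series
    exponent = Σ≥0 λ i → c i • u ^ (2 ℕ.* suc i)

    private
      F : Series
      F zero    = A.0#
      F (suc i) = A.φ (sign (suc i)) A.* c i

      z^ : ∀ i → z ^ i ≋ const (A.φ (sign i)) * (u * u) ^ i
      z^ zero    = sym (trans (const-cong A.φ-1 *ʳ 1#) (*-identityˡ 1#))
      z^ (suc i) = begin
        - (u * u) * z ^ i
          ≈⟨ (- (u * u)) *ˡ z^ i ⟩
        - (u * u) * (s * (u * u) ^ i)
          ≈⟨ solve 3 (λ y s p → :- y :* (s :* p) := con (ℚ.- 1ℚ) :* s :* (y :* p)) refl (u * u) s ((u * u) ^ i) ⟩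
        const (A.φ (ℚ.- 1ℚ)) * s * (u * u * (u * u) ^ i)
          ≈⟨ trans (const-cong (A.trans (A.reflexive (≡.cong A.φ (sign-suc i))) (A.φ-* _ _))) (const-* _ _) *ʳ ((u * u) ^ suc i) ⟨
        const (A.φ (sign (suc i))) * (u * u) ^ suc i ∎
        where
        s : Series
        s = const (A.φ (sign i))

      terms : ∀ i → c i • u ^ (2 ℕ.* suc i) ≋ F (suc i) • z ^ suc i
      terms i = begin
        c i • u ^ (2 ℕ.* suc i)
          ≈⟨ trans (const-•≋* (c i) (u ^ (2 ℕ.* suc i))) (const (c i) *ˡ OddSeries.^-double A u (suc i)) ⟩
        const (c i) * p
          ≈⟨ solve 2 (λ c p → c :* p := con 1ℚ :* c :* p) refl (const (c i)) p ⟩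
        1# * const (c i) * p
          ≈⟨ (s² *ʳ const (c i)) *ʳ p ⟨
        s * s * const (c i) * p
          ≈⟨ solve 3 (λ s c p → s :* s :* c :* p := s :* c :* (s :* p)) refl s (const (c i)) p ⟩
        s * const (c i) * (s * p)
          ≈⟨ *-cong {const (F (suc i))} {s * const (c i)} {z ^ suc i} {s * p} (const-* (A.φ (sign (suc i))) (c i)) (z^ (suc i)) ⟨
        const (F (suc i)) * z ^ suc i
          ≈⟨ const-•≋* (F (suc i)) (z ^ suc i) ⟨
        F (suc i) • z ^ suc i ∎
        where
        s p : Series
        s = const (A.φ (sign (suc i)))
        p = (u * u) ^ suc i
        s² : s * s ≋ 1#
        s² = trans (sym (const-* _ _)) (const-cong (A.trans (A.sym (A.φ-* _ _)) (A.trans (A.reflexive (≡.cong A.φ (sign² (suc i)))) A.φ-1)))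

      exponent≋ : exponent ≋ F ⟪ z ⟫
      exponent≋ = trans (sym (+-identityˡ exponent)) (Σ≥1≋⟪⟫ F {z} z₀ terms)

      D-F : D F ≋ 0# - g
      D-F = coeffwise λ i →
        A.trans (A.*-congˡ (A.*-congˡ (c-g i)))
        (A.trans (A.*-congˡ (A.sym (A.*-assoc _ _ _)))
        (A.trans (A.sym (A.*-assoc _ _ _))
        (A.trans (A.*-congʳ (A.trans (A.*-congˡ (A.sym (A.φ-* _ _))) (nat-φ (suc i) (sign-/ i))))
        (A.trans (R.solve 1 (λ g → R.con (ℚ.- 1ℚ) R.:* g R.:= R.con 0ℚ R.:- g) A.refl (g i))
        (A.+-congʳ (A.reflexive (≡.sym (const-0 i))))))))
        where module R = RingSolver A

    exponent₀ : exponent 0 A.≈ A.0#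
    exponent₀ = A.trans (at exponent≋ 0) (Z.⟪⟫-zeroth F)

    -- The coefficients (-1)^i/(i + 1) are those of an antiderivative: as a series in z, the
    -- exponent is F with F′ = -g, and dz/dX = -2 u w.
    D-exponent : D exponent ≋ (u + u) * w * g ⟪ z ⟫
    D-exponent = begin
      D exponent
        ≈⟨ trans (D-cong exponent≋) (D-⟪⟫ {z} z₀ F) ⟩
      D z * D F ⟪ z ⟫
        ≈⟨ *-cong {D z} { - (w * u + u * w)} {D F ⟪ z ⟫} {0# - g ⟪ z ⟫} (D-neg-sq u)
             (trans (Z.⟪⟫-congˡ D-F) (trans (Z.⟪⟫-- 0# g) (+-congʳ Z.⟪⟫-0))) ⟩
      - (w * u + u * w) * (0# - g ⟪ z ⟫)
        ≈⟨ solve 3 (λ u w y → :- (w :* u :+ u :* w) :* (con 0ℚ :- y) := (u :+ u) :* w :* y) refl u w (g ⟪ z ⟫) ⟩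
      (u + u) * w * g ⟪ z ⟫ ∎

    exp-exponent : Series
    exp-exponent = ι expSeries ⟪ exponent ⟫

    D-exp-exponent : D exp-exponent ≋ (u + u) * w * g ⟪ z ⟫ * exp-exponent
    D-exp-exponent = trans (D-⟪⟫ {exponent} exponent₀ (ι expSeries)) (*-cong {D exponent} {(u + u) * w * g ⟪ z ⟫}
      {D (ι expSeries) ⟪ exponent ⟫} {exp-exponent} D-exponent (Composition.⟪⟫-congˡ {exponent} exponent₀ D-exp))

    exp-exponent₀ : exp-exponent 0 A.≈ A.1#
    exp-exponent₀ = A.trans (Composition.⟪⟫-zeroth {exponent} exponent₀ (ι expSeries)) A.φ-1

-- Both identities over a ring in which q is nilpotent

module Identity {c ℓ} (A : ℚ-Algebra c ℓ) where
  private
    module A = ℚ-Algebra A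
  open RawSemiringDefs (RawRing.rawSemiring A.rawRing) using () renaming (_^_ to _^ᴬ_)
  open Exponent A public
  open ≋-Reasoning

  infix 7 if_factor_
  -- The variable stands for X² here, so that a product of these has the elementary symmetric
  -- polynomials themselves as coefficients. Substituting X² turns it into `factor`.
  if_factor_ : Bool → A.Carrier → Series
  if true  factor a = 1# + const a * var
  if false factor a = 1#

  evenSeries : (ℕ → A.Carrier) → Series
  evenSeries p = 1# + Σ≥0 λ i → p (suc i) • var ^ (2 ℕ.* suc i)

  -- In the application `Q i` is q^(i+1), `r i` is 1/(1 - q^(i+1))² and n is the exponent N of the
  -- truncation. The function `ε` marks the admissible indices, all of them or the odd ones, and M
  -- is the number of indices considered.
  module _ {Q a r : ℕ → A.Carrier} {n : ℕ}
    (inv : ∀ i → (A.1# A.- Q i) A.* (A.1# A.- Q i) A.* r i A.≈ A.1#)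
    (a≈  : ∀ i → a i A.≈ Q i A.* r i)
    (nil : ∀ i → Q i ^ᴬ n A.≈ A.0#)
    (ε : ℕ → Bool) {p : ℕ → A.Carrier} {M : ℕ}
    (p0 : p 0 A.≈ A.1#) (p≋ : p ≋ product (λ i → if ε i factor a i) M) where

    private
      y : Series
      y = var * var
      y₀ : y 0 A.≈ A.0#
      y₀ = *-zerothˡ {var} var A.refl
      open Composition {y} y₀

      H : Series
      H = partialSum (λ i → [ ε i ] lambert (Q i) (suc n)) M

      if-factor-⟪⟫ : ∀ b a → (if b factor a) ⟪ y ⟫ ≋ (if b then factor a else 1#)
      if-factor-⟪⟫ false a = ⟪⟫-const A.1#
      if-factor-⟪⟫ true  a = trans (⟪⟫-+ 1# (const a * var)) (+-cong (⟪⟫-const A.1#)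
        (trans (⟪⟫-* (const a) var) (*-cong {const a ⟪ y ⟫} {const a} {var ⟪ y ⟫} {y} (⟪⟫-const a) ⟪⟫-var)))

      P : Series
      P = product (λ i → if ε i then factor (a i) else 1#) M

      evenSeries≋P : evenSeries p ≋ P
      evenSeries≋P = begin
        1# + Σ≥0 (λ i → p (suc i) • var ^ (2 ℕ.* suc i))
          ≈⟨ +-congʳ (const-cong p0) ⟨
        const (p 0) + Σ≥0 (λ i → p (suc i) • var ^ (2 ℕ.* suc i))
          ≈⟨ Σ≥1≋⟪⟫ p {y} y₀ (λ i → •-cong A.refl (OddSeries.^-double A var (suc i))) ⟩
        p ⟪ y ⟫
          ≈⟨ trans (⟪⟫-congˡ p≋) (product-⟪⟫ {y} y₀ (λ i → if ε i factor a i) M) ⟩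
        product (λ i → (if ε i factor a i) ⟪ y ⟫) M
          ≈⟨ product-cong (λ i → if-factor-⟪⟫ (ε i) (a i)) M ⟩
        P ∎

      D-P : D P ≋ H * P
      D-P = D-product {λ i → if ε i then factor (a i) else 1#} {λ i → [ ε i ] lambert (Q i) (suc n)} (λ i → D-if (ε i) i) M
        where
        D-if : ∀ b i → D (if b then factor (a i) else 1#) ≋ [ b ] lambert (Q i) (suc n) * (if b then factor (a i) else 1#)
        D-if true  i = D-factor {Q i} {a i} {r i} {n} (inv i) (a≈ i) (nil i)
        D-if false i = trans D-1 (sym (zeroˡ 1#))

      P₀ : P 0 A.≈ A.1#
      P₀ = product-zeroth {λ i → if ε i then factor (a i) else 1#} (λ i → if₀ (ε i) i) M
        where
        if₀ : ∀ b i → (if b then factor (a i) else 1#) 0 A.≈ A.1#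
        if₀ true  i = A.trans (A.+-congˡ (A.trans (*-zeroth (const (a i)) y) (A.trans (A.*-congˡ y₀) (A.zeroʳ _)))) (A.+-identityʳ _)
        if₀ false i = A.refl

    module _ {c : ℕ → A.Carrier} {E g : Series} (c-g : ∀ i → c i A.≈ A.φ (-1ℤ ^ℤ i / suc i) A.* g i)
      (g≋ : g ≋ E + partialSum (λ i → [ ε i ] divisorSeries (Q i) (suc n)) M) where

      private
        m : Series
        m = (u + u) * w

        g⟪z⟫ : m * g ⟪ z ⟫ ≋ m * E ⟪ z ⟫ + H
        g⟪z⟫ = begin
          m * g ⟪ z ⟫
            ≈⟨ m *ˡ trans (Z.⟪⟫-congˡ g≋) (trans (Z.⟪⟫-+ E (partialSum d M)) (+-congˡ (partialSum-⟪⟫ {z} z₀ d M))) ⟩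
          m * (E ⟪ z ⟫ + partialSum (λ i → d i ⟪ z ⟫) M)
            ≈⟨ trans (distribˡ m (E ⟪ z ⟫) (partialSum (λ i → d i ⟪ z ⟫) M)) (+-congˡ (sym (partialSum-* m (λ i → d i ⟪ z ⟫) M))) ⟩
          m * E ⟪ z ⟫ + partialSum (λ i → m * d i ⟪ z ⟫) M
            ≈⟨ +-congˡ (partialSum-cong M λ i → trans (m *ˡ []-⟪⟫ {z} z₀ (ε i) (divisorSeries (Q i) (suc n)))
                 (trans (sym ([]-* (ε i) m (divisorSeries (Q i) (suc n) ⟪ z ⟫))) ([]-cong (ε i) (divisorSeries-lambert (Q i) (suc n))))) ⟩
          m * E ⟪ z ⟫ + H ∎
          where
          module Z = Composition {z} z₀
          d : ℕ → Series
          d i = [ ε i ] divisorSeries (Q i) (suc n)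

        Y : Series
        Y = exp-exponent {c} {g} c-g

        D-Y : D Y ≋ (m * E ⟪ z ⟫ + H) * Y
        D-Y = trans (D-exp-exponent {c} {g} c-g) (g⟪z⟫ *ʳ Y)

        Y₀ : Y 0 A.≈ A.1#
        Y₀ = exp-exponent₀ {c} {g} c-g

      identity-without-constant-terms : E ≋ 0# → evenSeries p ≋ Y
      identity-without-constant-terms E≋0 = trans evenSeries≋P (linear-ODE-unique H {P} {Y} (A.trans P₀ (A.sym Y₀)) D-P
        (trans D-Y (trans (+-congʳ (m *ˡ trans (Composition.⟪⟫-congˡ {z} z₀ E≋0) (Composition.⟪⟫-0 {z} z₀)))
          (solve 2 (λ m h → m :* con 0ℚ :+ h := h) refl m H) *ʳ Y)))

      -- The constant terms of the Eisenstein series contribute the factor X/u to the exponential.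
      identity-with-constant-terms : E ≋ const (A.φ (ℚ.- ½)) * e /T → evenSeries p ≋ ι [2/X]arcsin[X/2] * Y
      identity-with-constant-terms E≋ = trans evenSeries≋P (linear-ODE-unique H {P} {U * Y}
        (A.trans P₀ (A.sym (A.trans (*-zeroth U Y) (A.trans (A.*-cong A.φ-1 Y₀) (A.*-identityʳ A.1#))))) D-P (begin
          D (U * Y)
            ≈⟨ trans (D-* U Y) (+-congˡ (U *ˡ D-Y)) ⟩
          D U * Y + U * ((m * E ⟪ z ⟫ + H) * Y)
            ≈⟨ solve 5 (λ d U Y s H → d :* Y :+ U :* ((s :+ H) :* Y) := (d :+ U :* s) :* Y :+ H :* (U :* Y)) refl (D U) U Y (m * E ⟪ z ⟫) H ⟩
          (D U + U * (m * E ⟪ z ⟫)) * Y + H * (U * Y)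
            ≈⟨ +-congʳ (cancellation *ʳ Y) ⟩
          0# * Y + H * (U * Y)
            ≈⟨ solve 2 (λ y h → con 0ℚ :* y :+ h := h) refl Y (H * (U * Y)) ⟩
          H * (U * Y) ∎))
        where
        module Z = Composition {z} z₀
        U : Series
        U = ι [2/X]arcsin[X/2]
        u≋varU : u ≋ var * U
        u≋varU = trans (split u) (trans (+-congʳ (trans (const-cong u₀) refl)) (+-identityˡ (var * U)))
        D-u : U + var * D U ≋ w
        D-u = sym (trans (D-cong u≋varU) (trans (D-* var U) (+-congʳ (trans (D-var *ʳ U) (*-identityˡ U)))))
        K≋ : 1# + z * e /T ⟪ z ⟫ ≋ K
        K≋ = sym (trans (Z.unfold e) (+-congʳ (const-cong A.φ-1)))
        E′ : Series
        E′ = e /T ⟪ z ⟫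
        E⟪z⟫ : E ⟪ z ⟫ ≋ const (A.φ (ℚ.- ½)) * E′
        E⟪z⟫ = trans (Z.⟪⟫-congˡ E≋) (trans (Z.⟪⟫-* (const (A.φ (ℚ.- ½))) (e /T)) (Z.⟪⟫-const (A.φ (ℚ.- ½)) *ʳ E′))
        -- Informally, U = u/X has logarithmic derivative w/u - 1/X, and the constant terms
        -- contribute w(K - 1)/u. The sum K w/u - 1/X vanishes by `K-u`. Multiplying by X² and using
        -- u = X U avoids the denominators.
        cancellation : D U + U * (m * E ⟪ z ⟫) ≋ 0#
        cancellation = var*-cancel (var*-cancel (begin
          var * (var * (D U + U * (m * E ⟪ z ⟫)))
            ≈⟨ var *ˡ (var *ˡ +-congˡ (U *ˡ (m *ˡ E⟪z⟫))) ⟩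
          var * (var * (D U + U * (m * (const (A.φ (ℚ.- ½)) * E′))))
            ≈⟨ solve 6 (λ t d U u w e → t :* (t :* (d :+ U :* ((u :+ u) :* w :* (con (ℚ.- ½) :* e))))
                 := t :* ((U :+ t :* d) :- U :- t :* U :* u :* w :* e)) refl var (D U) U u w E′ ⟩
          var * ((U + var * D U) - U - var * U * u * w * E′)
            ≈⟨ var *ˡ +-cong (+-congʳ D-u) (-‿cong (((sym u≋varU *ʳ u) *ʳ w) *ʳ E′)) ⟩
          var * (w - U - u * u * w * E′)
            ≈⟨ solve 5 (λ t w U u e → t :* (w :- U :- u :* u :* w :* e) := (con 1ℚ :+ :- (u :* u) :* e) :* t :* w :- t :* U)
                 refl var w U u E′ ⟩
          (1# + z * E′) * var * w - var * U
            ≈⟨ +-cong ((K≋ *ʳ var) *ʳ w) (-‿cong (sym u≋varU)) ⟩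
          K * var * w - u
            ≈⟨ +-congʳ K-u ⟩
          u - u
            ≈⟨ solve 2 (λ u t → u :- u := t :* (t :* con 0ℚ)) refl u var ⟩
          var * (var * 0#) ∎))

-- MacMahon's series as elementary symmetric functions

module MacMahon {c ℓ} (A : ℚ-Algebra c ℓ) {P : Pred ℕ 0ℓ} (P? : Decidable P) where
  private
    module A = ℚ-Algebra A
  open Derivative A
  open Inverse A
  open ≋-Reasoning

  denominator : ∀ {r} → Vec ℕ r → Series
  denominator ms = Vec.foldr′ _*_ 1# (Vec.map (λ m → (1# - var ^ m) ^ 2) ms)

  term : ∀ {r} → Vec ℕ r → Series
  term ms = var ^ Vec.sum ms * inverse (denominator ms)

  sumList : List Series → Series
  sumList = List.foldr _+_ 0#

  allowed : ∀ r → ℕ → List (Vec ℕ r)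
  allowed r N = filter (VecAll.all? P?) (decreasing r N)

  -- Elementary symmetric polynomial in the allowed q^m/(1-q^m)² with m ≤ N.
  elementary : ℕ → ℕ → Series
  elementary r N = sumList (map term (allowed r N))

  weight : ℕ → Series
  weight m = var ^ m * inverse ((1# - var ^ m) ^ 2)

  -- The condition under which `inverse` inverts a denominator. It relies on positive entries, so it
  -- has to be carried along the lists of tuples before a term can be factored.
  Unital : ∀ {r} → Vec ℕ r → Set ℓ
  Unital ms = denominator ms 0 A.≈ A.1#

  square₀ : ∀ m → ((1# - var ^ suc m) ^ 2) 0 A.≈ A.1#
  square₀ m = A.trans (*-zeroth (1# - var ^ suc m) ((1# - var ^ suc m) ^ 1)) (A.trans (A.*-cong p (A.trans (*-zeroth (1# - var ^ suc m) 1#)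
    (A.trans (A.*-identityʳ _) p))) (A.*-identityʳ A.1#))
    where
    open import Algebra.Properties.Ring A.ring using (-0#≈0#)
    p : (1# - var ^ suc m) 0 A.≈ A.1#
    p = A.trans (A.+-congˡ (A.trans (A.-‿cong (*-zerothˡ {var} (var ^ m) A.refl)) -0#≈0#)) (A.+-identityʳ A.1#)

  Unital-∷ : ∀ {r} m {ms : Vec ℕ r} → Unital ms → Unital (suc m ∷ ms)
  Unital-∷ m {ms} p = A.trans (*-zeroth ((1# - var ^ suc m) ^ 2) (denominator ms)) (A.trans (A.*-cong (square₀ m) p) (A.*-identityʳ A.1#))

  decreasing-unital : ∀ r N → All Unital (decreasing r N)
  decreasing-unital zero    N = A.refl ∷ []
  decreasing-unital (suc r) N = All.concat⁺ (All.map⁺ (All.applyUpTo⁺₂ _ N λ m →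
    All.map⁺ (All.map (λ {ms} → Unital-∷ m {ms}) (decreasing-unital r m))))

  allowed-unital : ∀ r N → All Unital (allowed r N)
  allowed-unital r N = All.filter⁺ (VecAll.all? P?) (decreasing-unital r N)

  term-∷ : ∀ {r} m {ms : Vec ℕ r} → Unital ms → term (suc m ∷ ms) ≋ weight (suc m) * term ms
  term-∷ m {ms} p = begin
    var ^ (suc m ℕ.+ Vec.sum ms) * inverse (d * denominator ms)
      ≈⟨ *-cong {var ^ (suc m ℕ.+ Vec.sum ms)} {var ^ suc m * x} {inverse (d * denominator ms)} {inverse d * inverse (denominator ms)}
           (^-homo-* var (suc m) (Vec.sum ms)) (inverse-unique {d * denominator ms} (Unital-∷ m {ms} p) split-inverse) ⟩
    var ^ suc m * x * (inverse d * inverse (denominator ms))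
      ≈⟨ solve 4 (λ a x i j → a :* x :* (i :* j) := a :* i :* (x :* j)) refl (var ^ suc m) x (inverse d) (inverse (denominator ms)) ⟩
    weight (suc m) * term ms ∎
    where
    d x : Series
    d = (1# - var ^ suc m) ^ 2
    x = var ^ Vec.sum ms
    split-inverse : d * denominator ms * (inverse d * inverse (denominator ms)) ≋ 1#
    split-inverse = begin
      d * denominator ms * (inverse d * inverse (denominator ms))
        ≈⟨ solve 4 (λ d e i j → d :* e :* (i :* j) := d :* i :* (e :* j)) refl d (denominator ms) (inverse d) (inverse (denominator ms)) ⟩
      d * inverse d * (denominator ms * inverse (denominator ms))
        ≈⟨ *-cong {d * inverse d} {1#} {denominator ms * inverse (denominator ms)} {1#} (inverse-correct d (square₀ m)) (inverse-correct (denominator ms) p) ⟩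
      1# * 1#
        ≈⟨ *-identityˡ 1# ⟩
      1# ∎

  sumList-++ : ∀ xs ys → sumList (xs ++ ys) ≋ sumList xs + sumList ys
  sumList-++ []       ys = sym (+-identityˡ (sumList ys))
  sumList-++ (x ∷ xs) ys = trans (+-congˡ (sumList-++ xs ys)) (sym (+-assoc x (sumList xs) (sumList ys)))

  sumList-∷ : ∀ {r} m {L : List (Vec ℕ r)} → All Unital L → sumList (map term (map (suc m ∷_) L)) ≋ weight (suc m) * sumList (map term L)
  sumList-∷ m []                  = sym (zeroʳ (weight (suc m)))
  sumList-∷ m {ms ∷ L} (p ∷ ps) = trans (+-cong (term-∷ m {ms} p) (sumList-∷ m ps)) (sym (distribˡ (weight (suc m)) (term ms) (sumList (map term L))))

  filter-∷ : ∀ {r} m (L : List (Vec ℕ r)) → filter (VecAll.all? P?) (map (m ∷_) L) ≡ (if does (P? m) then map (m ∷_) (filter (VecAll.all? P?) L) else [])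
  filter-∷ m [] with does (P? m)
  ... | true  = ≡.refl
  ... | false = ≡.refl
  filter-∷ m (ms ∷ L) with filter-∷ m L
  ... | ih with does (P? m) | does (VecAll.all? P? ms)
  ... | true  | true  = ≡.cong ((m ∷ ms) ∷_) ih
  ... | true  | false = ih
  ... | false | _     = ih

  -- The head of a tuple is its largest entry, so raising the bound appends exactly the tuples that
  -- start with N + 1.
  decreasing-suc : ∀ r N → decreasing (suc r) (suc N) ≡ decreasing (suc r) N ++ map (suc N ∷_) (decreasing r N)
  decreasing-suc r N = ≡.trans (≡.cong (List.concatMap f) (≡.sym (upTo-∷ʳ N)))
    (≡.trans (concatMap-++ f (upTo N) (N ∷ [])) (≡.cong (decreasing (suc r) N ++_) (++-identityʳ (f N))))
    where
    f : ℕ → List (Vec ℕ (suc r))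
    f m = map (suc m ∷_) (decreasing r m)

  if_weighted_ : Bool → Series → Series
  if true  weighted f = f
  if false weighted f = 0#

  elementary-zero : ∀ N → elementary 0 N ≋ 1#
  elementary-zero N = trans (+-identityʳ _) (trans (*-identityˡ (inverse 1#))
    (inverse-unique {1#} A.refl (*-identityˡ 1#)))

  -- The Pascal-type recurrence of elementary symmetric polynomials: a tuple either avoids N + 1 or
  -- starts with it, and in the latter case its weight factors out.
  elementary-suc : ∀ r N → elementary (suc r) (suc N) ≋ elementary (suc r) N + (if does (P? (suc N)) weighted (weight (suc N) * elementary r N))
  elementary-suc r N = begin
    sumList (map term (filter ok? (decreasing (suc r) (suc N))))
      ≡⟨ ≡.cong (λ L → sumList (map term (filter ok? L))) (decreasing-suc r N) ⟩
    sumList (map term (filter ok? (decreasing (suc r) N ++ map (suc N ∷_) (decreasing r N))))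
      ≡⟨ ≡.cong (λ L → sumList (map term L)) (filter-++ ok? (decreasing (suc r) N) (map (suc N ∷_) (decreasing r N))) ⟩
    sumList (map term (allowed (suc r) N ++ filter ok? (map (suc N ∷_) (decreasing r N))))
      ≡⟨ ≡.cong sumList (map-++ term (allowed (suc r) N) _) ⟩
    sumList (map term (allowed (suc r) N) ++ map term (filter ok? (map (suc N ∷_) (decreasing r N))))
      ≈⟨ sumList-++ (map term (allowed (suc r) N)) _ ⟩
    elementary (suc r) N + sumList (map term (filter ok? (map (suc N ∷_) (decreasing r N))))
      ≡⟨ ≡.cong (λ L → elementary (suc r) N + sumList (map term L)) (filter-∷ (suc N) (decreasing r N)) ⟩
    elementary (suc r) N + sumList (map term (if does (P? (suc N)) then map (suc N ∷_) (allowed r N) else []))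
      ≈⟨ +-congˡ (last (does (P? (suc N)))) ⟩
    elementary (suc r) N + (if does (P? (suc N)) weighted (weight (suc N) * elementary r N)) ∎
    where
    ok? : Decidable (VecAll.All P)
    ok? = VecAll.all? P?
    last : ∀ b → sumList (map term (if b then map (suc N ∷_) (allowed r N) else [])) ≋ (if b weighted (weight (suc N) * elementary r N))
    last true  = sumList-∷ N (allowed-unital r N)
    last false = refl

  weight-trunc : ∀ m → weight m ≈[ m ] 0#
  weight-trunc m = Mod.trans m (*-cong-mod {var ^ m} {0#} {inverse ((1# - var ^ m) ^ 2)} (^-trunc {var} A.refl m) (Mod.refl m)) (reduce m (zeroˡ _))

  elementary-suc-trunc : ∀ r N → elementary r (suc N) ≈[ suc N ] elementary r N
  elementary-suc-trunc zero    N = reduce (suc N) (trans (elementary-zero (suc N)) (sym (elementary-zero N)))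
  elementary-suc-trunc (suc r) N = Mod.trans (suc N) (reduce (suc N) (elementary-suc r N))
    (Mod.trans (suc N) (Mod.+-congˡ (suc N) (vanish (does (P? (suc N))))) (reduce (suc N) (+-identityʳ _)))
    where
    vanish : ∀ b → (if b weighted (weight (suc N) * elementary r N)) ≈[ suc N ] 0#
    vanish true  = Mod.trans (suc N) (*-cong-mod {weight (suc N)} {0#} {elementary r N} (weight-trunc (suc N)) (Mod.refl (suc N))) (reduce (suc N) (zeroˡ _))
    vanish false = Mod.refl (suc N)

  -- A weight with index above M is divisible by q^(M+1). The bound M therefore already fixes the
  -- coefficients of q⁰ up to q^M, which is why n may be as large as M + 1.
  limit-elementary : ∀ r {n M} → n ℕ.≤ suc M → limit (elementary r) ≈[ n ] elementary r M
  limit-elementary r {n} {M} n≤1+M = below λ {k} k<n → A.sym (stable (ℕ.≤⇒≤′ (ℕ.s≤s⁻¹ (ℕ.≤-trans k<n n≤1+M))))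
    where
    stable : ∀ {k M} → k ℕ.≤′ M → elementary r M k A.≈ elementary r k k
    stable             (ℕ.≤′-reflexive ≡.refl) = A.refl
    stable {k} {suc M} (ℕ.≤′-step k≤M)         =
      A.trans (at[ elementary-suc-trunc r M ]< (s≤s (ℕ.≤′⇒≤ k≤M))) (stable k≤M)

-- Eisenstein series modulo a power of q

module Eisenstein {c ℓ} (A : ℚ-Algebra c ℓ) where
  private
    module A = ℚ-Algebra A
  open Derivative A
  open ≋-Reasoning

  weaken : ∀ {f g m n} → m ℕ.≤ n → f ≈[ n ] g → f ≈[ m ] g
  weaken m≤n p = below λ k<m → at[ p ]< (ℕ.<-≤-trans k<m m≤n)

  partialSum-cong-mod : ∀ {f g N} n → (∀ i → f i ≈[ N ] g i) → partialSum f n ≈[ N ] partialSum g n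
  partialSum-cong-mod {N = N} zero    p = Mod.refl N
  partialSum-cong-mod {N = N} (suc n) p = Mod.+-cong N (p 0) (partialSum-cong-mod n (p ∘ suc))

  partialSum-zero : ∀ {f N} n → (∀ i → f i ≈[ N ] 0#) → partialSum f n ≈[ N ] 0#
  partialSum-zero {N = N} zero    p = Mod.refl N
  partialSum-zero {N = N} (suc n) p = Mod.trans N (Mod.+-cong N (p 0) (partialSum-zero n (p ∘ suc))) (reduce N (+-identityʳ 0#))

  lambertTerm : ℕ → ℕ → ℕ → Series
  lambertTerm k m n = nat (n ℕ.^ k) • var ^ (m ℕ.* n)

  lambertSum : ℕ → ℕ → ℕ → Series
  lambertSum k m N = partialSum (λ n → lambertTerm k m (suc n)) N

  doubleSum : ℕ → Series
  doubleSum k = Σ≥1 λ m → Σ≥1 λ n → lambertTerm k m n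

  lambertTerm-trunc : ∀ k m n N → N ℕ.≤ m ℕ.* n → lambertTerm k m n ≈[ N ] 0#
  lambertTerm-trunc k m n N N≤mn = weaken N≤mn (Mod.trans (m ℕ.* n) (•-trunc (nat (n ℕ.^ k)) (^-trunc {var} A.refl (m ℕ.* n)))
    (reduce (m ℕ.* n) (•-zeroʳ (nat (n ℕ.^ k)))))

  -- As m and n are positive, q^(mn) is divisible by both q^m and q^n, so either sum may stop at N.
  -- The outer bound M is left free since the odd variant takes it to be 2N.
  doubleSum-mod : ∀ k {N M} → N ℕ.≤ M → doubleSum k ≈[ N ] partialSum (λ i → lambertSum k (suc i) N) M
  doubleSum-mod k {N} {M} N≤M = Mod.trans N (weaken N≤M (Σ≥0≈partialSum inner-trunc M)) (partialSum-cong-mod M (λ i → inner≈ i N))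
    where
    inner : ℕ → Series
    inner i = Σ≥1 λ n → lambertTerm k (suc i) n
    inner≈ : ∀ i N → inner i ≈[ N ] lambertSum k (suc i) N
    inner≈ i N = Σ≥0≈partialSum (λ n → lambertTerm-trunc k (suc i) (suc n) n
      (ℕ.≤-trans (ℕ.n≤1+n n) (ℕ.m≤n*m (suc n) (suc i)))) N
    inner-trunc : ∀ i → inner i ≈[ i ] 0#
    inner-trunc i = Mod.trans i (inner≈ i i) (partialSum-zero i λ n → lambertTerm-trunc k (suc i) (suc n) i
      (ℕ.≤-trans (ℕ.n≤1+n i) (ℕ.m≤m*n (suc i) (suc n))))

  constantTerm : ℕ → A.Carrier
  constantTerm k = A.φ (ℚ.- (bernoulli k ℚ.* ½ ℚ.* 1/[ k ]!))

  G Gᵒ : ℕ → Series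
  G k = const (constantTerm k) + A.φ 1/[ k ℕ.∸ 1 ]! • doubleSum (k ℕ.∸ 1)
  Gᵒ k = G k - G k ⟪ var ^ 2 ⟫

  G-mod : ∀ k {N M} → N ℕ.≤ M →
          G k ≈[ N ] const (constantTerm k) + A.φ 1/[ k ℕ.∸ 1 ]! • partialSum (λ i → lambertSum (k ℕ.∸ 1) (suc i) N) M
  G-mod k {N} N≤M = Mod.+-congˡ N (•-trunc (A.φ 1/[ k ℕ.∸ 1 ]!) (doubleSum-mod (k ℕ.∸ 1) N≤M))

  odd-1+2* : ∀ n → does (odd? (suc (2 ℕ.* n))) ≡ true
  odd-1+2* n = dec-true (odd? (suc (2 ℕ.* n))) λ 2∣1+2n →
    2≢1 (∣1⇒≡1 (∣m+n∣m⇒∣n (≡.subst (2 ∣_) (ℕ.+-comm 1 (2 ℕ.* n)) 2∣1+2n) (m∣m*n n)))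
    where
    2≢1 : ¬ 2 ≡ 1
    2≢1 ()

  odd-2* : ∀ n → does (odd? (2 ℕ.* n)) ≡ false
  odd-2* n = dec-false (odd? (2 ℕ.* n)) λ 2∤2n → 2∤2n (m∣m*n n)

  if_include_ : Bool → Series → Series
  if true  include f = f
  if false include f = 0#

  partialSum-odd : ∀ f n → partialSum (λ i → f (suc i)) (2 ℕ.* n) - partialSum (λ i → f (2 ℕ.* suc i)) n
                           ≋ partialSum (λ i → if does (odd? (suc i)) include f (suc i)) (2 ℕ.* n)
  partialSum-odd f zero    = -‿inverseʳ 0#
  partialSum-odd f (suc n) = begin
    partialSum g (2 ℕ.* suc n) - partialSum (λ i → f (2 ℕ.* suc i)) (suc n)
      ≈⟨ +-cong (two-more g) (-‿cong (trans (partialSum-suc (λ i → f (2 ℕ.* suc i)) n) (+-congˡ (reflexive (≡.cong f (ℕ.*-suc 2 n)))))) ⟩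
    (partialSum g (2 ℕ.* n) + f (suc (2 ℕ.* n)) + f (2 ℕ.+ 2 ℕ.* n)) - (partialSum (λ i → f (2 ℕ.* suc i)) n + f (2 ℕ.+ 2 ℕ.* n))
      ≈⟨ solve 4 (λ a b x y → (a :+ x :+ y) :- (b :+ y) := (a :- b) :+ x :+ con 0ℚ) refl
           (partialSum g (2 ℕ.* n)) (partialSum (λ i → f (2 ℕ.* suc i)) n) (f (suc (2 ℕ.* n))) (f (2 ℕ.+ 2 ℕ.* n)) ⟩
    (partialSum g (2 ℕ.* n) - partialSum (λ i → f (2 ℕ.* suc i)) n) + f (suc (2 ℕ.* n)) + 0#
      ≈⟨ +-cong (+-cong (partialSum-odd f n) (reflexive (≡.cong (if_include f (suc (2 ℕ.* n))) (≡.sym (odd-1+2* n)))))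
           (reflexive (≡.cong (if_include f (2 ℕ.+ 2 ℕ.* n)) (≡.sym (≡.trans (≡.cong (does ∘ odd?) (≡.sym (ℕ.*-suc 2 n))) (odd-2* (suc n)))))) ⟩
    partialSum h (2 ℕ.* n) + h (2 ℕ.* n) + h (suc (2 ℕ.* n))
      ≈⟨ two-more h ⟨
    partialSum h (2 ℕ.* suc n) ∎
    where
    g h : ℕ → Series
    g i = f (suc i)
    h i = if does (odd? (suc i)) include f (suc i)
    two-more : ∀ f → partialSum f (2 ℕ.* suc n) ≋ partialSum f (2 ℕ.* n) + f (2 ℕ.* n) + f (suc (2 ℕ.* n))
    two-more f = trans (reflexive (≡.cong (partialSum f) (ℕ.*-suc 2 n)))
      (trans (partialSum-suc f (suc (2 ℕ.* n))) (+-congʳ (partialSum-suc f (2 ℕ.* n))))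

  private
    q² : Series
    q² = var ^ 2
    q²₀ : q² 0 A.≈ A.0#
    q²₀ = *-zerothˡ {var} (var ^ 1) A.refl
    open Composition {q²} q²₀

  partialSum-⟪q²⟫ : ∀ f n → partialSum f n ⟪ q² ⟫ ≋ partialSum (λ i → f i ⟪ q² ⟫) n
  partialSum-⟪q²⟫ f zero    = ⟪⟫-0
  partialSum-⟪q²⟫ f (suc n) = trans (⟪⟫-+ (f 0) (partialSum (f ∘ suc) n)) (+-congˡ (partialSum-⟪q²⟫ (f ∘ suc) n))

  lambertTerm-⟪q²⟫ : ∀ k m n → lambertTerm k m n ⟪ q² ⟫ ≋ lambertTerm k (2 ℕ.* m) n
  lambertTerm-⟪q²⟫ k m n = begin
    lambertTerm k m n ⟪ q² ⟫
      ≈⟨ ⟪⟫-• (nat (n ℕ.^ k)) (var ^ (m ℕ.* n)) ⟩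
    const (nat (n ℕ.^ k)) * (var ^ (m ℕ.* n)) ⟪ q² ⟫
      ≈⟨ const (nat (n ℕ.^ k)) *ˡ trans (⟪⟫-^ var (m ℕ.* n)) (^-cong ⟪⟫-var (m ℕ.* n)) ⟩
    const (nat (n ℕ.^ k)) * q² ^ (m ℕ.* n)
      ≈⟨ const (nat (n ℕ.^ k)) *ˡ trans (^-assocʳ var 2 (m ℕ.* n)) (reflexive (≡.cong (var ^_) (≡.sym (ℕ.*-assoc 2 m n)))) ⟩
    const (nat (n ℕ.^ k)) * var ^ (2 ℕ.* m ℕ.* n)
      ≈⟨ const-•≋* (nat (n ℕ.^ k)) (var ^ (2 ℕ.* m ℕ.* n)) ⟨
    lambertTerm k (2 ℕ.* m) n ∎

  lambertSum-⟪q²⟫ : ∀ k m N → lambertSum k m N ⟪ q² ⟫ ≋ lambertSum k (2 ℕ.* m) N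
  lambertSum-⟪q²⟫ k m N = trans (partialSum-⟪q²⟫ (λ n → lambertTerm k m (suc n)) N)
    (partialSum-cong N (λ n → lambertTerm-⟪q²⟫ k m (suc n)))

  -- Replacing q by q² turns the summand of m into that of 2m. Cutting G(q) off at m = 2N and G(q²)
  -- at m = N makes the even indices match one to one, so they cancel exactly, as do the constant
  -- terms.
  Gᵒ-mod : ∀ k N → Gᵒ k ≈[ N ] A.φ 1/[ k ℕ.∸ 1 ]! • partialSum (λ i → if does (odd? (suc i)) include lambertSum (k ℕ.∸ 1) (suc i) N) (2 ℕ.* N)
  Gᵒ-mod k N = Mod.trans N (Mod.+-cong N (G-mod k {N} {2 ℕ.* N} (ℕ.m≤m+n N (N ℕ.+ 0)))
      (Mod.-‿cong N (⟪⟫-cong-mod N (G-mod k {N} {N} ℕ.≤-refl)))) (reduce N (begin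
    (const γ + d • X) - (const γ + d • Y) ⟪ q² ⟫
      ≈⟨ +-cong (+-congˡ (const-•≋* d X)) (-‿cong (trans (⟪⟫-+ (const γ) (d • Y)) (+-cong (⟪⟫-const γ) (⟪⟫-• d Y)))) ⟩
    (const γ + const d * X) - (const γ + const d * Y ⟪ q² ⟫)
      ≈⟨ solve 4 (λ γ d X Y → (γ :+ d :* X) :- (γ :+ d :* Y) := d :* (X :- Y)) refl (const γ) (const d) X (Y ⟪ q² ⟫) ⟩
    const d * (X - Y ⟪ q² ⟫)
      ≈⟨ const d *ˡ +-congˡ (-‿cong (trans (partialSum-⟪q²⟫ (λ i → lambertSum (k ℕ.∸ 1) (suc i) N) N)
           (partialSum-cong N (λ i → lambertSum-⟪q²⟫ (k ℕ.∸ 1) (suc i) N)))) ⟩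
    const d * (X - partialSum (λ i → lambertSum (k ℕ.∸ 1) (2 ℕ.* suc i) N) N)
      ≈⟨ const d *ˡ partialSum-odd (λ m → lambertSum (k ℕ.∸ 1) m N) N ⟩
    const d * partialSum (λ i → if does (odd? (suc i)) include lambertSum (k ℕ.∸ 1) (suc i) N) (2 ℕ.* N)
      ≈⟨ const-•≋* d (partialSum (λ i → if does (odd? (suc i)) include lambertSum (k ℕ.∸ 1) (suc i) N) (2 ℕ.* N)) ⟨
    d • partialSum (λ i → if does (odd? (suc i)) include lambertSum (k ℕ.∸ 1) (suc i) N) (2 ℕ.* N) ∎))
    where
    γ d : A.Carrier
    γ = constantTerm k
    d = A.φ 1/[ k ℕ.∸ 1 ]!
    X Y : Series
    X = partialSum (λ i → lambertSum (k ℕ.∸ 1) (suc i) N) (2 ℕ.* N)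
    Y = partialSum (λ i → lambertSum (k ℕ.∸ 1) (suc i) N) N

module NatPowers {c ℓ} (A : ℚ-Algebra c ℓ) where
  open Rationals
  open ℚ-Algebra A
  open Derivative A using (nat)
  open RawSemiringDefs (RawRing.rawSemiring rawRing) using (_^_)
  open RingSolver A

  nat-* : ∀ m n → nat (m ℕ.* n) ≈ nat m * nat n
  nat-* m n = trans (reflexive (≡.cong φ (fromℕ-* m n))) (φ-* _ _)

  nat-^-odd : ∀ i j → nat (i ℕ.^ suc (2 ℕ.* j)) ≈ nat i * (nat i * nat i) ^ j
  nat-^-odd i zero    = trans (nat-* i 1) (*-congˡ φ-1)
  nat-^-odd i (suc j) = begin
    nat (i ℕ.^ suc (2 ℕ.* suc j))                  ≡⟨ ≡.cong (λ k → nat (i ℕ.^ suc k)) (ℕ.*-suc 2 j) ⟩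
    nat (i ℕ.* (i ℕ.* i ℕ.^ suc (2 ℕ.* j)))        ≈⟨ trans (nat-* i _) (*-congˡ (trans (nat-* i _) (*-congˡ (nat-^-odd i j)))) ⟩
    nat i * (nat i * (nat i * (nat i * nat i) ^ j))
      ≈⟨ solve 2 (λ n p → n :* (n :* (n :* p)) := n :* (n :* n :* p)) refl (nat i) ((nat i * nat i) ^ j) ⟩
    nat i * (nat i * nat i) ^ suc j                ∎
    where open SetoidReasoning setoid

-- Specialisation to series in q modulo q^N

module Assembly {c ℓ} (A : ℚ-Algebra c ℓ) (N : ℕ) where
  private
    module A = ℚ-Algebra A
    module S = Derivative A
    module E = Eisenstein A

  -- The algebra A⟦q⟧/(q^N), in which each positive power of q is nilpotent. The variable of the
  -- series over it is X, or a stand-in for X² or -u².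
  B : ℚ-Algebra c ℓ
  B = S.truncated N

  private
    module B = ℚ-Algebra B
    module I = Identity B
  open RawSemiringDefs (RawRing.rawSemiring B.rawRing) using () renaming (_^_ to _^ᴮ_)

  ^ᴮ≡^ : ∀ f n → f ^ᴮ n ≡ f S.^ n
  ^ᴮ≡^ f zero    = ≡.refl
  ^ᴮ≡^ f (suc n) = ≡.cong (f S.*_) (^ᴮ≡^ f n)

  partialSum-coeff : ∀ F n j → I.partialSum F n j B.≈ S.partialSum (λ i → F i j) n
  partialSum-coeff F zero    j = B.reflexive (I.const-0 j)
  partialSum-coeff F (suc n) j = B.+-congˡ (partialSum-coeff (F ∘ suc) n j)

  -- This exchanges the order of the two expansions: the j-th coefficient, itself a series in q, is
  -- the part of weight 2j + 2 belonging to m. The left side sums from i = 0 and thus has N + 1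
  -- terms; the one for i = 0 vanishes.
  divisorSeries-coeff : ∀ m j → I.divisorSeries (S.var S.^ m) (suc N) j B.≈ A.φ 1/[ suc (2 ℕ.* j) ]! S.• E.lambertSum (suc (2 ℕ.* j)) m N
  divisorSeries-coeff m j = begin
    I.divisorSeries q (suc N) j
      ≈⟨ partialSum-coeff t (suc N) j ⟩
    t 0 j S.+ S.partialSum (λ i → t (suc i) j) N
      ≈⟨ B.+-cong (t-coeff 0) (E.partialSum-cong-mod N (λ i → t-coeff (suc i))) ⟩
    d S.* E.lambertTerm k m 0 S.+ S.partialSum (λ i → d S.* E.lambertTerm k m (suc i)) N
      ≈⟨ S.reduce N (S.+-cong (d S.*ˡ zeroth) (S.partialSum-* d (λ i → E.lambertTerm k m (suc i)) N)) ⟩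
    d S.* S.0# S.+ d S.* E.lambertSum k m N
      ≈⟨ S.reduce N (S.solve 2 (λ d x → d S.:* S.con 0ℚ S.:+ d S.:* x S.:= d S.:* x) S.refl d (E.lambertSum k m N)) ⟩
    d S.* E.lambertSum k m N
      ≈⟨ S.reduce N (S.const-•≋* (A.φ 1/[ k ]!) (E.lambertSum k m N)) ⟨
    A.φ 1/[ k ]! S.• E.lambertSum k m N ∎
    where
    open SetoidReasoning B.setoid
    k : ℕ
    k = suc (2 ℕ.* j)
    d q : S.Series
    d = S.const (A.φ 1/[ k ]!)
    q = S.var S.^ m
    t : ℕ → I.Series
    t i = I.const (q ^ᴮ i) I.* (I.const (I.nat i) I.* I.scale (I.nat i B.* I.nat i) I.σ)
    zeroth : E.lambertTerm k m 0 S.≋ S.0#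
    zeroth = S.trans (S.const-•≋* (S.nat 0) (S.var S.^ (m ℕ.* 0))) (S.trans (S.const-cong A.φ-0 S.*ʳ (S.var S.^ (m ℕ.* 0)))
      (S.zeroˡ (S.var S.^ (m ℕ.* 0))))
    t-coeff : ∀ i → t i j B.≈ d S.* E.lambertTerm k m i
    t-coeff i = begin
      t i j
        ≈⟨ I.const-*-coeff (q ^ᴮ i) (I.const (I.nat i) I.* I.scale (I.nat i B.* I.nat i) I.σ) j ⟩
      q ^ᴮ i S.* (I.const (I.nat i) I.* I.scale (I.nat i B.* I.nat i) I.σ) j
        ≈⟨ S.*-cong-mod {q ^ᴮ i} {q ^ᴮ i} B.refl (I.const-*-coeff (I.nat i) (I.scale (I.nat i B.* I.nat i) I.σ) j) ⟩
      q ^ᴮ i S.* (I.nat i S.* (n² S.* d))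
        ≈⟨ S.reduce N (S.solve 4 (λ q n p d → q S.:* (n S.:* (p S.:* d)) S.:= d S.:* ((n S.:* p) S.:* q)) S.refl (q ^ᴮ i) (I.nat i) n² d) ⟩
      d S.* ((I.nat i S.* n²) S.* q ^ᴮ i)
        ≈⟨ S.*-cong-mod {d} {d} B.refl (S.*-cong-mod {I.nat i S.* n²} {S.const (S.nat (i ℕ.^ k))} {q ^ᴮ i} {S.var S.^ (m ℕ.* i)}
             (B.sym (NatPowers.nat-^-odd B i j)) (S.reduce N (S.trans (S.reflexive (^ᴮ≡^ q i)) (S.^-assocʳ S.var m i)))) ⟩
      d S.* (S.const (S.nat (i ℕ.^ k)) S.* S.var S.^ (m ℕ.* i))
        ≈⟨ S.reduce N (d S.*ˡ S.const-•≋* (S.nat (i ℕ.^ k)) (S.var S.^ (m ℕ.* i))) ⟨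
      d S.* E.lambertTerm k m i ∎
      where
      n² : S.Series
      n² = (I.nat i B.* I.nat i) ^ᴮ j

  -- Index i belongs to m = i + 1, which keeps every exponent of q positive.
  q r : ℕ → S.Series
  q i = S.var S.^ suc i
  r i = S.inverse ((S.1# S.- q i) S.^ 2)

  module _ {P : Pred ℕ 0ℓ} (P? : Decidable P) where
    private
      module M = MacMahon A P?

      ε : ℕ → Bool
      ε i = does (P? (suc i))

      inv : ∀ i → (B.1# B.- q i) B.* (B.1# B.- q i) B.* r i B.≈ B.1#
      inv i = S.reduce N (S.trans (S.solve 2 (λ f r → f S.:* f S.:* r S.:= f S.:* (f S.:* S.con 1ℚ) S.:* r) S.refl (S.1# S.- q i) (r i))
        (Inverse.inverse-correct A ((S.1# S.- q i) S.^ 2) (M.square₀ i)))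

      nilpotent : ∀ i → q i ^ᴮ N B.≈ B.0#
      nilpotent i = B.trans (B.reflexive (^ᴮ≡^ (q i) N)) (S.^-trunc {q i} (S.*-zerothˡ {S.var} (S.var S.^ i) A.refl) N)

      times-factor-zero : ∀ b a F → (F I.* (I.if b factor a)) 0 B.≈ F 0
      times-factor-zero false a F = I.at (I.*-identityʳ F) 0
      times-factor-zero true  a F = B.trans (I.*-zeroth F (I.1# I.+ I.const a I.* I.var))
        (B.trans (B.*-congˡ {F 0} (B.trans (B.+-congˡ (B.trans (I.*-zeroth (I.const a) I.var) (B.zeroʳ a))) (B.+-identityʳ B.1#))) (B.*-identityʳ (F 0)))

      times-factor-suc : ∀ b a F r → (F I.* (I.if b factor a)) (suc r) B.≈ F (suc r) S.+ (M.if b weighted (a S.* F r))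
      times-factor-suc false a F r = B.trans (I.at (I.*-identityʳ F) (suc r)) (B.sym (B.+-identityʳ (F (suc r))))
      times-factor-suc true  a F r = B.trans (I.at (I.solve 3 (λ F a t → F I.:* (I.con 1ℚ I.:+ a I.:* t) I.:= F I.:+ a I.:* (t I.:* F)) I.refl F (I.const a) I.var) (suc r))
        (B.+-congˡ (B.trans (I.const-*-coeff a (I.var I.* F) (suc r)) (B.*-congˡ {a} (I.var-*-suc F r))))

      -- Multiplication by 1 + a T acts on coefficients as the recurrence `elementary-suc`; at an
      -- index that is not allowed both leave everything unchanged.
      elementary-product : ∀ m r → M.elementary r m B.≈ I.product (λ i → I.if ε i factor M.weight (suc i)) m r
      elementary-product zero    zero    = S.reduce N (M.elementary-zero 0)
      elementary-product zero    (suc r) = B.refl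
      elementary-product (suc m) zero    = B.trans (B.trans (S.reduce N (M.elementary-zero (suc m))) (B.sym (S.reduce N (M.elementary-zero m))))
        (B.trans (elementary-product m 0) (B.sym (times-factor-zero (ε m) (M.weight (suc m)) (I.product (λ i → I.if ε i factor M.weight (suc i)) m))))
      elementary-product (suc m) (suc r) = B.trans (S.reduce N (M.elementary-suc r m))
        (B.trans (B.+-cong (elementary-product m (suc r)) (weighted-cong (ε m)))
          (B.sym (times-factor-suc (ε m) (M.weight (suc m)) (I.product (λ i → I.if ε i factor M.weight (suc i)) m) r)))
        where
        weighted-cong : ∀ b → (M.if b weighted (M.weight (suc m) S.* M.elementary r m))
          B.≈ (M.if b weighted (M.weight (suc m) S.* I.product (λ i → I.if ε i factor M.weight (suc i)) m r))
        weighted-cong true  = S.*-cong-mod {M.weight (suc m)} {M.weight (suc m)} B.refl (elementary-product m r)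
        weighted-cong false = B.refl

    module _ {p : ℕ → S.Series} {m : ℕ} (N≤m : N ℕ.≤ m) (p≈ : ∀ r → p r S.≋ S.limit (M.elementary r))
      {c : ℕ → S.Series} {E g : I.Series} (c-g : ∀ i → c i B.≈ B.φ (-1ℤ ^ℤ i / suc i) B.* g i)
      (g≈ : g I.≋ E I.+ I.partialSum (λ i → I.[ ε i ] I.divisorSeries (q i) (suc N)) m) where

      private
        p≋ : p I.≋ I.product (λ i → I.if ε i factor M.weight (suc i)) m
        p≋ = I.coeffwise λ r → B.trans (S.reduce N (p≈ r)) (B.trans (M.limit-elementary r {N} {m} (ℕ.m≤n⇒m≤1+n N≤m)) (elementary-product m r))

        p0 : p 0 B.≈ B.1#
        p0 = S.reduce N (S.trans (p≈ 0) (S.coeffwise λ n → S.at (M.elementary-zero n) n))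

      mod-identity-without-constant-terms : E I.≋ I.0# → I.evenSeries p I.≋ I.exp-exponent {c} {g} c-g
      mod-identity-without-constant-terms = I.identity-without-constant-terms {q} {λ i → M.weight (suc i)} {r} {N} inv (λ i → B.refl) nilpotent ε {p} {m} p0 p≋ {c} {E} {g} c-g g≈

      mod-identity-with-constant-terms : E I.≋ I.const (B.φ (ℚ.- ½)) I.* I.e I./T →
        I.evenSeries p I.≋ I.ι [2/X]arcsin[X/2] I.* I.exp-exponent {c} {g} c-g
      mod-identity-with-constant-terms = I.identity-with-constant-terms {q} {λ i → M.weight (suc i)} {r} {N} inv (λ i → B.refl) nilpotent ε {p} {m} p0 p≋ {c} {E} {g} c-g g≈

-- PowerSeries takes the equality of the coefficients as part of its argument, and stuck
-- terms such as f ^ n remember it; hence series operations that differ only in that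
-- equality have to be compared by induction.
module ChangeOfEquality {c ℓ} (A : ℚ-Algebra c ℓ) {ℓ′} (_∼_ : ℚ-Algebra.Carrier A → ℚ-Algebra.Carrier A → Set ℓ′) where
  private
    module A = ℚ-Algebra A
  open Derivative A

  rawRing∼ : RawRing c ℓ′
  rawRing∼ = record { _≈_ = _∼_ ; _+_ = A._+_ ; _*_ = A._*_ ; -_ = A.-_ ; 0# = A.0# ; 1# = A.1# }

  module F = PowerSeries rawRing∼
  private
    open module Sum = RawSemiringDefs (RawRing.rawSemiring F.rawRing) using (sum)

  const≋ : ∀ a → F.const a ≋ const a
  const≋ a = coeffwise λ { zero → A.refl ; (suc n) → A.refl }

  var≋ : F.var ≋ var
  var≋ = coeffwise λ { zero → A.refl ; (suc n) → at (const≋ A.1#) n }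

  ^≋ : ∀ {f g} → f ≋ g → ∀ n → f F.^ n ≋ g ^ n
  ^≋ p zero            = const≋ A.1#
  ^≋ {f} {g} p (suc n) = *-cong {f} {g} {f F.^ n} {g ^ n} p (^≋ p n)

  Σ≥0≋ : ∀ {f g : ℕ → Series} → (∀ i → f i ≋ g i) → F.Σ≥0 f ≋ Σ≥0 g
  Σ≥0≋ {f} {g} p = coeffwise λ n → at (sum≋ {f} {g} p (suc n)) n
    where
    sum≋ : ∀ {f g : ℕ → Series} → (∀ i → f i ≋ g i) → ∀ n → sum {n} (λ i → f (toℕ i)) ≋ partialSum g n
    sum≋ p zero    = const≋ A.0#
    sum≋ {f} {g} p (suc n) = +-cong (p 0) (sum≋ {f ∘ suc} {g ∘ suc} (p ∘ suc) n)

  ⟪⟫≋ : ∀ f {g g′} → g ≋ g′ → f F.⟪ g ⟫ ≋ f ⟪ g′ ⟫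
  ⟪⟫≋ f {g} {g′} p = Σ≥0≋ {λ i → f i F.• g F.^ i} {λ i → f i • g′ ^ i} λ i → •-cong A.refl (^≋ p i)

-- The two generating functions over series in q

module GeneratingFunctions {c ℓ} (A : ℚ-Algebra c ℓ) where
  open Rationals
  private
    module A = ℚ-Algebra A
    module Q = Derivative ℚ-algebra
    module S = Derivative A
    module E = Eisenstein A
    module F = PowerSeries S.rawRing

  coefficient : (ℕ → S.Series) → ℕ → S.Series
  coefficient g i = A.φ (-1ℤ ^ℤ i / suc i) S.• g (2 ℕ.* suc i)

  ιF : Q.Series → F.Series
  ιF f n = S.const (A.φ (f n))

  expF : F.Series → F.Series
  expF f = ιF expSeries F.⟪ f ⟫

  exponentF : (ℕ → S.Series) → F.Series
  exponentF g = F.Σ≥0 λ i → coefficient g i F.• ιF 2arcsin[X/2] F.^ (2 ℕ.* suc i)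

  evenF : (ℕ → S.Series) → F.Series
  evenF p = F.1# F.+ (F.Σ≥0 λ i → p (suc i) F.• F.var F.^ (2 ℕ.* suc i))

  module Modulo (N : ℕ) where
    open Assembly A N public
    module B = ℚ-Algebra B
    module I = Identity B
    private
      module Ch = ChangeOfEquality B S._≈_

    coefficient-g : ∀ g i → coefficient g i B.≈ B.φ (-1ℤ ^ℤ i / suc i) B.* g (2 ℕ.* suc i)
    coefficient-g g i = S.reduce N (S.const-•≋* (A.φ (-1ℤ ^ℤ i / suc i)) (g (2 ℕ.* suc i)))

    exp-I : (ℕ → S.Series) → I.Series
    exp-I g = I.exp-exponent {coefficient g} {λ j → g (2 ℕ.* suc j)} (coefficient-g g)

    expF≋ : ∀ g → expF (exponentF g) I.≋ exp-I g
    expF≋ g = Ch.⟪⟫≋ (ιF expSeries) (Ch.Σ≥0≋ λ i → I.•-cong {coefficient g i} {coefficient g i} B.refl (Ch.^≋ {ιF 2arcsin[X/2]} {I.u} I.refl (2 ℕ.* suc i)))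

    evenF≋ : ∀ p → evenF p I.≋ I.evenSeries p
    evenF≋ p = I.+-cong (Ch.const≋ S.1#) (Ch.Σ≥0≋ λ i → I.•-cong {p (suc i)} {p (suc i)} B.refl (Ch.^≋ Ch.var≋ (2 ℕ.* suc i)))

    -- The weight minus one, 2(j + 1) - 1, computes to j + (1 + j) rather than to 2j + 1.
    1/!-rewrite : ∀ j (X : ℕ → S.Series) → A.φ 1/[ 2 ℕ.* suc j ℕ.∸ 1 ]! S.• X (2 ℕ.* suc j ℕ.∸ 1) ≡ A.φ 1/[ suc (2 ℕ.* j) ]! S.• X (suc (2 ℕ.* j))
    1/!-rewrite j X = ≡.cong (λ k → A.φ 1/[ k ]! S.• X k) (ℕ.+-suc j (j ℕ.+ 0))

    []-coeff : ∀ b F j X → F j B.≈ X → (I.[ b ] F) j B.≈ (E.if b include X)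
    []-coeff true  F j X p = p
    []-coeff false F j X p = B.reflexive (I.const-0 j)

    include-• : ∀ b a X → (E.if b include (a S.• X)) S.≋ S.const a S.* (E.if b include X)
    include-• true  a X = S.const-•≋* a X
    include-• false a X = S.sym (S.zeroʳ (S.const a))

    divisorSums : ∀ (ε : ℕ → Bool) m j → I.partialSum (λ i → I.[ ε i ] I.divisorSeries (q i) (suc N)) m j
      B.≈ A.φ 1/[ 2 ℕ.* suc j ℕ.∸ 1 ]! S.• S.partialSum (λ i → E.if ε i include E.lambertSum (2 ℕ.* suc j ℕ.∸ 1) (suc i) N) m
    divisorSums ε m j = begin
      I.partialSum (λ i → I.[ ε i ] I.divisorSeries (q i) (suc N)) m j
        ≈⟨ partialSum-coeff (λ i → I.[ ε i ] I.divisorSeries (q i) (suc N)) m j ⟩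
      S.partialSum (λ i → (I.[ ε i ] I.divisorSeries (q i) (suc N)) j) m
        ≈⟨ E.partialSum-cong-mod m (λ i → []-coeff (ε i) (I.divisorSeries (q i) (suc N)) j (d S.• E.lambertSum k (suc i) N) (divisorSeries-coeff (suc i) j)) ⟩
      S.partialSum (λ i → E.if ε i include (d S.• E.lambertSum k (suc i) N)) m
        ≈⟨ S.reduce N (S.partialSum-cong m (λ i → include-• (ε i) d (E.lambertSum k (suc i) N))) ⟩
      S.partialSum (λ i → S.const d S.* (E.if ε i include E.lambertSum k (suc i) N)) m
        ≈⟨ S.reduce N (S.trans (S.partialSum-* (S.const d) (λ i → E.if ε i include E.lambertSum k (suc i) N) m)
             (S.sym (S.const-•≋* d (S.partialSum (λ i → E.if ε i include E.lambertSum k (suc i) N) m)))) ⟩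
      d S.• S.partialSum (λ i → E.if ε i include E.lambertSum k (suc i) N) m
        ≡⟨ 1/!-rewrite j (λ k → S.partialSum (λ i → E.if ε i include E.lambertSum k (suc i) N) m) ⟨
      A.φ 1/[ 2 ℕ.* suc j ℕ.∸ 1 ]! S.• S.partialSum (λ i → E.if ε i include E.lambertSum (2 ℕ.* suc j ℕ.∸ 1) (suc i) N) m ∎
      where
      open SetoidReasoning B.setoid
      k : ℕ
      k = suc (2 ℕ.* j)
      d : A.Carrier
      d = A.φ 1/[ k ]!

    bernoulli-b : ∀ k → ℚ.- (bernoulli k ℚ.* ½ ℚ.* 1/[ k ]!) ≡ ℚ.- ½ ℚ.* I.b k
    bernoulli-b k = ≡.trans
      (solve 4 (λ f b h r → :- ((f :* b) :* h :* r) := (r :* f) :* (:- h :* b)) ≡.refl (fromℕ (k !)) (I.b k) ½ 1/[ k ]!)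
      (≡.trans (≡.cong (ℚ._* (ℚ.- ½ ℚ.* I.b k)) (/-*-fromℕ (+ 1) (k !) {{k !≢0}})) (ℚ.*-identityˡ _))
      where open RingSolver ℚ-algebra

    -- These are the constants -B_k/(2 k!) for k = 2, 4, 6, and so on. The shift `/T` drops B₀,
    -- which accounts for the 1 in K = 1 + z (e /T)(z).
    constantTerms : I.Series
    constantTerms = I.const (B.φ (ℚ.- ½)) I.* I.e I./T

    constantTerms-coeff : ∀ j → constantTerms j B.≈ S.const (E.constantTerm (2 ℕ.* suc j))
    constantTerms-coeff j = begin
      constantTerms j
        ≈⟨ I.const-*-coeff (B.φ (ℚ.- ½)) (I.e I./T) j ⟩
      B.φ (ℚ.- ½) B.* I.e (suc j)
        ≡⟨ ≡.cong (B.φ (ℚ.- ½) B.*_) (I.even-coeff (I.ι I.b) (suc j)) ⟩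
      B.φ (ℚ.- ½) B.* B.φ (I.b (2 ℕ.* suc j))
        ≈⟨ B.φ-* (ℚ.- ½) (I.b (2 ℕ.* suc j)) ⟨
      B.φ (ℚ.- ½ ℚ.* I.b (2 ℕ.* suc j))
        ≡⟨ ≡.cong B.φ (bernoulli-b (2 ℕ.* suc j)) ⟨
      S.const (E.constantTerm (2 ℕ.* suc j)) ∎
      where open SetoidReasoning B.setoid

  module Every = MacMahon A {λ _ → ⊤} (λ _ → yes tt)
  module Odds = MacMahon A odd?

  -- The first sum is written without a filter so that it agrees with `A` by computation; the
  -- trivially true filter is inserted inside the proof of `every-identity`.
  everySum oddSum : ℕ → S.Series
  everySum r = S.limit λ N → Every.sumList (List.map Every.term (decreasing r N))
  oddSum r = S.limit (Odds.elementary r)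

  every-identity : evenF everySum F.≈ ιF [2/X]arcsin[X/2] F.* expF (exponentF E.G)
  every-identity n k = S.at[ result ]< ℕ.≤-refl
    where
    -- Equality modulo q^(k+1) is enough to compare the coefficients of q^k.
    open Modulo (suc k)
    everySum≋ : ∀ r → everySum r S.≋ S.limit (Every.elementary r)
    everySum≋ r = S.coeffwise λ N → A.reflexive (≡.cong (λ L → Every.sumList (List.map Every.term L) N)
      (≡.sym (filter-all (VecAll.all? (λ _ → yes tt)) (All.universal (λ ms → VecAll.universal (λ _ → tt) ms) (decreasing r N)))))
    g≈ : ∀ j → E.G (2 ℕ.* suc j) B.≈ constantTerms j B.+ I.partialSum (λ i → I.[ true ] I.divisorSeries (q i) (suc (suc k))) (suc k) j
    g≈ j = B.trans (E.G-mod (2 ℕ.* suc j) {suc k} {suc k} ℕ.≤-refl)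
      (B.+-cong (B.sym (constantTerms-coeff j)) (B.sym (divisorSums (λ _ → true) (suc k) j)))
    result : evenF everySum n B.≈ (ιF [2/X]arcsin[X/2] F.* expF (exponentF E.G)) n
    result = B.trans (I.at (evenF≋ everySum) n) (B.trans
      (I.at (mod-identity-with-constant-terms (λ _ → yes tt) {everySum} {suc k} ℕ.≤-refl everySum≋ {coefficient E.G} {constantTerms} {λ j → E.G (2 ℕ.* suc j)}
        (coefficient-g E.G) (I.coeffwise g≈) I.refl) n)
      (I.at (I.*-cong {I.ι [2/X]arcsin[X/2]} {ιF [2/X]arcsin[X/2]} {exp-I E.G} {expF (exponentF E.G)} I.refl (I.sym (expF≋ E.G))) n))

  odd-identity : evenF oddSum F.≈ expF (exponentF E.Gᵒ)
  odd-identity n k = S.at[ result ]< ℕ.≤-refl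
    where
    open Modulo (suc k)
    g≈ : ∀ j → E.Gᵒ (2 ℕ.* suc j) B.≈ I.0# j B.+ I.partialSum (λ i → I.[ does (odd? (suc i)) ] I.divisorSeries (q i) (suc (suc k))) (2 ℕ.* suc k) j
    g≈ j = B.trans (E.Gᵒ-mod (2 ℕ.* suc j) (suc k)) (B.trans (B.sym (divisorSums (λ i → does (odd? (suc i))) (2 ℕ.* suc k) j))
      (B.sym (B.trans (B.+-congʳ (B.reflexive (I.const-0 j))) (B.+-identityˡ _))))
    result : evenF oddSum n B.≈ expF (exponentF E.Gᵒ) n
    result = B.trans (I.at (evenF≋ oddSum) n) (B.trans
      -- The product runs over m up to 2(k + 1), the range in which `Gᵒ-mod` leaves the odd indices.
      (I.at (mod-identity-without-constant-terms odd? {oddSum} {2 ℕ.* suc k} (ℕ.m≤m+n (suc k) _) (λ r → S.refl) {coefficient E.Gᵒ} {I.0#} {λ j → E.Gᵒ (2 ℕ.* suc j)}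
        (coefficient-g E.Gᵒ) (I.coeffwise g≈) I.refl) n)
      (I.at (I.sym (expF≋ E.Gᵒ)) n))

-- The theorem over ℚ

open import Defs
open import Data.Nat.Base using (_∸_) renaming (_*_ to _*ℕ_)
open import Data.Product.Base using (_×_; _,_)

-- These equations hold by computation, but comparing the concrete series by computation is
-- infeasible; hence they are stated for variables where possible and then chained.
module Specialisation where
  open GeneratingFunctions ℚ-algebra
  private
    module E = Eisenstein ℚ-algebra
    module F = PowerSeries ℚ⟦q⟧.rawRing

  evenSeries exponent : (ℕ → ℚ⟦q⟧.Series) → ℚ⟦q⟧⟦X⟧.Series
  evenSeries p = 1# + (Σ≥1 λ r → p r • X ^ (2 *ℕ r))
  exponent g = Σ≥1 λ j → ((-1ℤ ^ℤ (j ∸ 1) / j) · g (2 *ℕ j)) • ι 2arcsin[X/2] ^ (2 *ℕ j)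

  evenF≡ : ∀ p → evenF p ≡ evenSeries p
  evenF≡ p = ≡.refl

  expF≡ : ∀ f → expF f ≡ exp f
  expF≡ f = ≡.refl

  exponentF≡ : ∀ g → exponentF g ≡ exponent g
  exponentF≡ g = ≡.refl

  *≡ : ∀ f g → f F.* g ≡ f * g
  *≡ f g = ≡.refl

  A≡ : everySum ≡ A
  A≡ = ≡.refl

  C≡ : oddSum ≡ C
  C≡ = ≡.refl

  G≡ : E.G ≡ G
  G≡ = ≡.refl

  Gᵒ≡ : E.Gᵒ ≡ Gᵒ
  Gᵒ≡ = ≡.refl

  exp-exponent≡ : ∀ {g g′} → g ≡ g′ → expF (exponentF g) ≡ exp (exponent g′)
  exp-exponent≡ {g} ≡.refl = ≡.trans (expF≡ (exponentF g)) (≡.cong exp (exponentF≡ g))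

  A-identity : evenSeries A ≈ ι [2/X]arcsin[X/2] * exp (exponent G)
  A-identity = ≡.subst₂ _≈_ (≡.trans (evenF≡ everySum) (≡.cong evenSeries A≡))
    (≡.trans (*≡ (ιF [2/X]arcsin[X/2]) (expF (exponentF E.G))) (≡.cong (ι [2/X]arcsin[X/2] *_) (exp-exponent≡ G≡)))
    every-identity

  C-identity : evenSeries C ≈ exp (exponent Gᵒ)
  C-identity = ≡.subst₂ _≈_ (≡.trans (evenF≡ oddSum) (≡.cong evenSeries C≡)) (exp-exponent≡ Gᵒ≡) odd-identity

theorem1p1 : (1# + (Σ≥1 λ r → A r • X ^ (2 *ℕ r))
    ≈ ι [2/X]arcsin[X/2] * exp (Σ≥1 λ j → ((-1ℤ ^ℤ (j ∸ 1) / j) · G (2 *ℕ j)) • ι 2arcsin[X/2] ^ (2 *ℕ j)))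
    ×
    (1# + (Σ≥1 λ r → C r • X ^ (2 *ℕ r))
    ≈ exp (Σ≥1 λ j → ((-1ℤ ^ℤ (j ∸ 1) / j) · Gᵒ (2 *ℕ j)) • ι 2arcsin[X/2] ^ (2 *ℕ j)))
theorem1p1 = Specialisation.A-identity , Specialisation.C-identity
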